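{- Let $\mathrm S$ be a dependent type theory admitting all the rules of two-dimensional type theory $\mathrm{ML}_2$. For each context $\Gamma$ of $\mathrm S$, the object $\mathbf 1_\Gamma\in\mathfrak T_{\mathrm S}(\Gamma)$ given by $\Gamma\vdash\mathbf 1\ \mathsf{type}$ provides a retract bireflection of the object $\mathrm{id}_\Gamma\colon\Gamma\to\Gamma$ of $\mathfrak C_{\mathrm S}/\Gamma$ along the $2$-functor $E(\Gamma)\colon\mathfrak T_{\mathrm S}(\Gamma)\to\mathfrak C_{\mathrm S}/\Gamma$.
   Context: **Type theory.** $\mathrm S$ has judgement forms $A\ \mathsf{type}$, $a:A$, $A=B\ \mathsf{type}$, $a=b:A$ (definitional equality), relative to contexts $\Gamma=(x_1:A_1,\dots,x_n:A_n)$ with $A_i$ a type in context $(x_1:A_1,\dots,x_{i-1}:A_{i-1})$; equality rules (definitional equality is a congruence) and structural rules (weakening, contraction, exchange, substitution). All rules are relative to an arbitrary ambient context, and all operations are stable under substitution in it. Rules of $\mathrm{ML}_2$: - $\Sigma$: from $A$ and $x:A\vdash B(x)$ form $\Sigma(A,B)$; from $a:A$, $b:B(a)$ get $\langle a,b\rangle:\Sigma(A,B)$; from $z:\Sigma(A,B)\vdash C(z)\ \mathsf{type}$ and $x:A,y:B(x)\vdash d(x,y):C(\langle x,y\rangle)$ get $z:\Sigma(A,B)\vdash \mathrm E_d(z):C(z)$ with $\mathrm E_d(\langle x,y\rangle)=d(x,y)$. - Unit: $\mathbf 1\ \mathsf{type}$; $\star:\mathbf 1$; from $z:\mathbf 1\vdash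 C(z)\ \mathsf{type}$ and $d:C(\star)$ get $z:\mathbf 1\vdash\mathrm U_d(z):C(z)$ with $\mathrm U_d(\star)=d$. - Identity: from $a,b:A$ form $\mathrm{Id}_A(a,b)$; $\mathrm r(a):\mathrm{Id}_A(a,a)$; from $x,y:A,p:\mathrm{Id}_A(x,y)\vdash C(x,y,p)\ \mathsf{type}$ and $x:A\vdash d(x):C(x,x,\mathrm r(x))$ get $x,y:A,p:\mathrm{Id}_A(x,y)\vdash\mathrm J_d(x,y,p):C(x,y,p)$ with $\mathrm J_d(x,x,\mathrm r(x))=d(x)$. - $\Pi$: form $\Pi(A,B)$; from $x:A\vdash f(x):B(x)$ get $\lambda f:\Pi(A,B)$; from $m:\Pi(A,B)$ get $y:A\vdash m\cdot y:B(y)$; $(\lambda f)\cdot y=f(y)$. - Discrete identity types: if $p,q:\mathrm{Id}_A(a,b)$ and $\alpha:\mathrm{Id}(p,q)$ then $p=q$ and $\alpha=\mathrm r(p)$. - Function extensionality: from $m,n:\Pi(A,B)$ and $x:A\vdash p(x):\mathrm{Id}(m\cdot x,n\cdot x)$ get $\mathsf{ext}(m,n,p):\mathrm{Id}(m,n)$; $\mathsf{ext}(m,m,[x]\mathrm r(m\cdot x))=\mathrm r(m)$; $\mathsf{ext}(m,n,p)\ast x=p(x)$, where $p\ast a:=\mathrm J_{[x]\mathrm r(x\cdot a)}(m,n,p)$. By $\Pi$-abstracting over a telescope $\Delta$ one derives extended identity elimination/computation, in which $C$ and the conclusion live in context $x,y:A,p:\mathrm{Id}_A(x,y),\Delta$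 and $d$ in context $x:A,\Delta[x,x,\mathrm r(x)/x,y,p]$. Vector notation is used: an element $a:\Gamma$ of a context is a list of terms. **Identity contexts.** The identity rules extend to contexts by induction on length. For a single type, elimination into a context $\Theta=(u:\Lambda,v:D(u))$ is componentwise: from $d=(d_1,d_2)$ form $\mathrm J_{d_1}$, then $\mathrm J_{d_2}$ into $D(x,y,p,\mathrm J_{d_1}(x,y,p))$. $\mathrm{Id}_{()}=()$, with $\mathrm J_d=d$. For $\Phi=(x:\Lambda,y:D(x))$: transport $p^*(z):\Upsilon(x)$ for $p:\mathrm{Id}_\Lambda(x,x')$, $z:\Upsilon(x')$ is defined by $\mathrm{Id}_\Lambda$-elimination from $\mathrm r(x)^*(z)=z$; $\mathrm{Id}_\Phi((x,y),(x',y')):=(p:\mathrm{Id}_\Lambda(x,x'),\,q:\mathrm{Id}_{D(x)}(y,p^*y'))$; $\mathrm r(x,y):=(\mathrm r(x),\mathrm r(y))$; elimination for $\mathrm{Id}_\Phi$: first apply elimination for $\mathrm{Id}_{D(x)}$ to $d$, giving $d'(x,y,y',q)$, then $\mathrm{Id}_\Lambda$-elimination with post-context $(y,y',q)$ to $d'$. **The 2-category $\mathfrak C_{\mathrm S}$.** (Modulo $\alpha$-conversion and definitional equality.) Objects: contexts. 1-cells $\Gamma\to\Delta$: judgements $x:\Gamma\vdash f(x):\Delta$, composed by substitution. 2-cells $f\Rightarrow g$: judgements $x:\Gamma\vdash\alpha(x):\mathrm{Id}_\Delta(fx,gx)$. Here $q\circ p$ is defined by elimination on $q$ with $\mathrm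 r(y)\circ p=p$, and $h^\bullet(p):\mathrm{Id}_\Delta(hx,hy)$ by elimination on $p$ with $h^\bullet(\mathrm r(x))=\mathrm r(hx)$; vertical composition is $\beta(x)\circ\alpha(x)$, identities are $\mathrm r(fx)$, whiskerings are $(\alpha k)(x)=\alpha(kx)$, $(h\alpha)(x)=h^\bullet(\alpha(x))$. The slice $\mathfrak C_{\mathrm S}/\Gamma$ has strictly commuting triangles as 1-cells and, as 2-cells, those whose composite with the structure map to $\Gamma$ is an identity. For a type $A$ in context $\Gamma$: $\Gamma.A=(x:\Gamma,y:A(x))$, with projection $\pi_A\colon\Gamma.A\to\Gamma$. **The fibre 2-category $\mathfrak T_{\mathrm S}(\Gamma)$ and $E(\Gamma)$.** Objects: types $A$ in context $\Gamma$. 1-cells $A\to B$: judgements $x:\Gamma,y:A(x)\vdash f(x,y):B(x)$. 2-cells $f\Rightarrow g$: judgements $x:\Gamma,y:A(x)\vdash\alpha(x,y):\mathrm{Id}_{B(x)}(f(x,y),g(x,y))$, with compositions defined from $\circ$, $\mathrm r$ and $(-)^\bullet$ as in $\mathfrak C_{\mathrm S}$. $E(\Gamma)$ sends $A$ to $\pi_A\colon\Gamma.A\to\Gamma$, $f$ to $(x,y)\mapsto(x,f(x,y))$, and $\alpha$ to $(x,y)\mapsto(\mathrm r(x),\alpha(x,y))$. **Retract bireflections.** A functor $P$ is a *surjective equivalence* if there are a functor $I$ with $PI=\mathrm{id}$ and an isomorphism $\theta\colon\mathrm{id}\Rightarrow IP$ with $\theta I=\mathrm{id}_I$, $P\theta=\mathrm{id}_P$.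 For a 2-functor $U\colon\mathbf K\to\mathbf L$ and $x\in\mathbf L$, a *retract bireflection* of $x$ along $U$ is an object $Fx\in\mathbf K$ with a morphism $\eta_x\colon x\to UFx$ such that for each $y\in\mathbf K$ the functor $\mathbf K(Fx,y)\to\mathbf L(x,Uy)$, $h\mapsto Uh\circ\eta_x$, is a surjective equivalence of categories. -}

module Defs where

open import Level using (Level) renaming (suc to lsuc)
open import Data.Nat using (ℕ; zero; suc)
open import Data.Fin using (Fin; zero; suc)
open import Data.Vec using (Vec; []; _∷_; map; tabulate; lookup)
open import Data.Vec.Properties using (tabulate-∘; tabulate-cong; tabulate∘lookup; lookup∘tabulate)
open import Data.Product using (Σ-syntax; _×_; _,_; proj₁; proj₂)
open import Relation.Binary.PropositionalEquality using (_≡_; refl; sym; trans; cong; cong₂; subst)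
open import Relation.Binary.Structures using (IsEquivalence)

-- Objects and arrows carry a specified equality, to be definitional equality of
-- judgements.  Equal arrows have equal endpoints, but not identical ones, so ≋ is
-- heterogeneous: this is a category internal to setoids.
record Category (ℓ : Level) : Set (lsuc ℓ) where
  infix  4 _≈_ _≋_
  infixr 9 _∘_
  field
    Obj  : Set ℓ
    _≈_  : Obj → Obj → Set ℓ
    ≈-isEquivalence : IsEquivalence _≈_

    Hom  : Obj → Obj → Set ℓ
    _≋_  : ∀ {a b c d} → Hom a b → Hom c d → Set ℓ
    ≋-refl  : ∀ {a b} {f : Hom a b} → f ≋ f
    ≋-sym   : ∀ {a b c d} {f : Hom a b} {g : Hom c d} → f ≋ g → g ≋ f
    ≋-trans : ∀ {a b c d x y} {f : Hom a b} {g : Hom c d} {h : Hom x y} → f ≋ g → g ≋ h → f ≋ h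
    ≋-dom   : ∀ {a b c d} {f : Hom a b} {g : Hom c d} → f ≋ g → a ≈ c
    ≋-cod   : ∀ {a b c d} {f : Hom a b} {g : Hom c d} → f ≋ g → b ≈ d
    coe     : ∀ {a b c d} → a ≈ c → b ≈ d → Hom a b → Hom c d
    coe-≋   : ∀ {a b c d} (p : a ≈ c) (q : b ≈ d) (f : Hom a b) → coe p q f ≋ f

    id      : ∀ a → Hom a a
    _∘_     : ∀ {a b c} → Hom b c → Hom a b → Hom a c
    id-cong : ∀ {a b} → a ≈ b → id a ≋ id b
    ∘-cong  : ∀ {a b c a′ b′ c′} {g : Hom b c} {g′ : Hom b′ c′} {f : Hom a b} {f′ : Hom a′ b′} →
              g ≋ g′ → f ≋ f′ → g ∘ f ≋ g′ ∘ f′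
    assoc   : ∀ {a b c d} (h : Hom c d) (g : Hom b c) (f : Hom a b) → (h ∘ g) ∘ f ≋ h ∘ (g ∘ f)
    idˡ     : ∀ {a b} (f : Hom a b) → id b ∘ f ≋ f
    idʳ     : ∀ {a b} (f : Hom a b) → f ∘ id a ≋ f

  module ≈ = IsEquivalence ≈-isEquivalence

record Functor {ℓ} (A B : Category ℓ) : Set ℓ where
  private
    module A = Category A
    module B = Category B
  field
    F₀      : A.Obj → B.Obj
    F₁      : ∀ {a b} → A.Hom a b → B.Hom (F₀ a) (F₀ b)
    F₀-cong : ∀ {a b} → a A.≈ b → F₀ a B.≈ F₀ b
    F₁-cong : ∀ {a b c d} {f : A.Hom a b} {g : A.Hom c d} → f A.≋ g → F₁ f B.≋ F₁ g
    F-id    : ∀ a → F₁ (A.id a) B.≋ B.id (F₀ a)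
    F-∘     : ∀ {a b c} (g : A.Hom b c) (f : A.Hom a b) → F₁ (g A.∘ f) B.≋ F₁ g B.∘ F₁ f

record SurjectiveEquivalence {ℓ} {A B : Category ℓ} (P : Functor A B) : Set ℓ where
  private
    module A = Category A
    module B = Category B
    module P = Functor P
  field
    I : Functor B A
  private module I = Functor I
  field
    PI≈id₀ : ∀ b → P.F₀ (I.F₀ b) B.≈ b
    PI≈id₁ : ∀ {b b′} (f : B.Hom b b′) → P.F₁ (I.F₁ f) B.≋ f

    θ      : ∀ a → A.Hom a (I.F₀ (P.F₀ a))
    θ⁻¹    : ∀ a → A.Hom (I.F₀ (P.F₀ a)) a
    θ-cong : ∀ {a a′} → a A.≈ a′ → θ a A.≋ θ a′
    θ-natural : ∀ {a a′} (f : A.Hom a a′) → θ a′ A.∘ f A.≋ I.F₁ (P.F₁ f) A.∘ θ a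
    θ⁻¹∘θ  : ∀ a → θ⁻¹ a A.∘ θ a A.≋ A.id a
    θ∘θ⁻¹  : ∀ a → θ a A.∘ θ⁻¹ a A.≋ A.id (I.F₀ (P.F₀ a))

    θI≈id  : ∀ b → θ (I.F₀ b) A.≋ A.id (I.F₀ b)
    Pθ≈id  : ∀ a → P.F₁ (θ a) B.≋ B.id (P.F₀ a)

-- Strict 2-categories, with horizontal composition presented by whiskering:
-- h ▹ α is hα and α ◃ k is αk.
record 2-Category (ℓ : Level) : Set (lsuc ℓ) where
  field
    Ob  : Set ℓ
    hom : Ob → Ob → Category ℓ

  1-Cell : Ob → Ob → Set ℓ
  1-Cell x y = Category.Obj (hom x y)

  infix  4 _≈_ _⇒_ _≋_
  _≈_ : ∀ {x y} → 1-Cell x y → 1-Cell x y → Set ℓ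
  _≈_ {x} {y} = Category._≈_ (hom x y)

  _⇒_ : ∀ {x y} → 1-Cell x y → 1-Cell x y → Set ℓ
  _⇒_ {x} {y} = Category.Hom (hom x y)

  _≋_ : ∀ {x y} {f g f′ g′ : 1-Cell x y} → f ⇒ g → f′ ⇒ g′ → Set ℓ
  _≋_ {x} {y} = Category._≋_ (hom x y)

  id₂ : ∀ {x y} (f : 1-Cell x y) → f ⇒ f
  id₂ {x} {y} = Category.id (hom x y)

  infixr 9 _∘ᵥ_
  _∘ᵥ_ : ∀ {x y} {f g h : 1-Cell x y} → g ⇒ h → f ⇒ g → f ⇒ h
  _∘ᵥ_ {x} {y} = Category._∘_ (hom x y)

  infixr 9 _∘₁_ _▹_ _◃_
  field
    id₁   : ∀ x → 1-Cell x x
    _∘₁_  : ∀ {x y z} → 1-Cell y z → 1-Cell x y → 1-Cell x z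
    _▹_   : ∀ {x y z} (h : 1-Cell y z) {f g : 1-Cell x y} → f ⇒ g → h ∘₁ f ⇒ h ∘₁ g
    _◃_   : ∀ {x y z} {f g : 1-Cell y z} → f ⇒ g → (k : 1-Cell x y) → f ∘₁ k ⇒ g ∘₁ k

    ∘₁-cong   : ∀ {x y z} {h h′ : 1-Cell y z} {k k′ : 1-Cell x y} → h ≈ h′ → k ≈ k′ → h ∘₁ k ≈ h′ ∘₁ k′
    ∘₁-assoc  : ∀ {w x y z} (h : 1-Cell y z) (g : 1-Cell x y) (f : 1-Cell w x) →
                (h ∘₁ g) ∘₁ f ≈ h ∘₁ (g ∘₁ f)
    ∘₁-idˡ    : ∀ {x y} (f : 1-Cell x y) → id₁ y ∘₁ f ≈ f
    ∘₁-idʳ    : ∀ {x y} (f : 1-Cell x y) → f ∘₁ id₁ x ≈ f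

    ▹-cong    : ∀ {x y z} {h h′ : 1-Cell y z} {f g f′ g′ : 1-Cell x y} {α : f ⇒ g} {α′ : f′ ⇒ g′} →
                h ≈ h′ → α ≋ α′ → h ▹ α ≋ h′ ▹ α′
    ◃-cong    : ∀ {x y z} {k k′ : 1-Cell x y} {f g f′ g′ : 1-Cell y z} {α : f ⇒ g} {α′ : f′ ⇒ g′} →
                α ≋ α′ → k ≈ k′ → α ◃ k ≋ α′ ◃ k′
    ▹-id      : ∀ {x y z} (h : 1-Cell y z) (f : 1-Cell x y) → h ▹ id₂ f ≋ id₂ (h ∘₁ f)
    ◃-id      : ∀ {x y z} (f : 1-Cell y z) (k : 1-Cell x y) → id₂ f ◃ k ≋ id₂ (f ∘₁ k)
    ▹-∘       : ∀ {x y z} (h : 1-Cell y z) {f g k : 1-Cell x y} (β : g ⇒ k) (α : f ⇒ g) →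
                h ▹ (β ∘ᵥ α) ≋ (h ▹ β) ∘ᵥ (h ▹ α)
    ◃-∘       : ∀ {x y z} {f g h : 1-Cell y z} (β : g ⇒ h) (α : f ⇒ g) (k : 1-Cell x y) →
                (β ∘ᵥ α) ◃ k ≋ (β ◃ k) ∘ᵥ (α ◃ k)
    ▹-id₁     : ∀ {x y} {f g : 1-Cell x y} (α : f ⇒ g) → id₁ y ▹ α ≋ α
    ◃-id₁     : ∀ {x y} {f g : 1-Cell x y} (α : f ⇒ g) → α ◃ id₁ x ≋ α
    ▹-∘₁      : ∀ {w x y z} (h : 1-Cell y z) (k : 1-Cell x y) {f g : 1-Cell w x} (α : f ⇒ g) →
                (h ∘₁ k) ▹ α ≋ h ▹ (k ▹ α)
    ◃-∘₁      : ∀ {w x y z} {f g : 1-Cell y z} (α : f ⇒ g) (h : 1-Cell x y) (k : 1-Cell w x) →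
                α ◃ (h ∘₁ k) ≋ (α ◃ h) ◃ k
    ▹-◃       : ∀ {w x y z} (h : 1-Cell y z) {f g : 1-Cell x y} (α : f ⇒ g) (k : 1-Cell w x) →
                (h ▹ α) ◃ k ≋ h ▹ (α ◃ k)
    interchange : ∀ {x y z} {h k : 1-Cell y z} {f g : 1-Cell x y} (β : h ⇒ k) (α : f ⇒ g) →
                (β ◃ g) ∘ᵥ (h ▹ α) ≋ (k ▹ α) ∘ᵥ (β ◃ f)

  module _ {x y : Ob} where
    open Category (hom x y) public
      using (≋-refl; ≋-sym; ≋-trans; ≋-dom; ≋-cod; coe; coe-≋; id-cong; ∘-cong; assoc; idˡ; idʳ; module ≈)

record 2-Functor {ℓ} (K L : 2-Category ℓ) : Set ℓ where
  private
    module K = 2-Category K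
    module L = 2-Category L
  field
    F₀  : K.Ob → L.Ob
    F   : ∀ x y → Functor (K.hom x y) (L.hom (F₀ x) (F₀ y))

  F₁ : ∀ {x y} → K.1-Cell x y → L.1-Cell (F₀ x) (F₀ y)
  F₁ = Functor.F₀ (F _ _)

  F₂ : ∀ {x y} {f g : K.1-Cell x y} → f K.⇒ g → F₁ f L.⇒ F₁ g
  F₂ = Functor.F₁ (F _ _)

  field
    F-id₁ : ∀ x → F₁ (K.id₁ x) L.≈ L.id₁ (F₀ x)
    F-∘₁  : ∀ {x y z} (g : K.1-Cell y z) (f : K.1-Cell x y) → F₁ (g K.∘₁ f) L.≈ F₁ g L.∘₁ F₁ f
    F-▹   : ∀ {x y z} (h : K.1-Cell y z) {f g : K.1-Cell x y} (α : f K.⇒ g) →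
            F₂ (h K.▹ α) L.≋ F₁ h L.▹ F₂ α
    F-◃   : ∀ {x y z} {f g : K.1-Cell y z} (α : f K.⇒ g) (k : K.1-Cell x y) →
            F₂ (α K.◃ k) L.≋ F₂ α L.◃ F₁ k

transpose : ∀ {ℓ} {K L : 2-Category ℓ} (U : 2-Functor K L) →
            let module K = 2-Category K ; module L = 2-Category L ; module U = 2-Functor U in
            ∀ {x a} (η : L.1-Cell x (U.F₀ a)) y → Functor (K.hom a y) (L.hom x (U.F₀ y))
transpose {K = K} {L} U η y = record
  { F₀      = λ h → U.F₁ h L.∘₁ η
  ; F₁      = λ α → U.F₂ α L.◃ η
  ; F₀-cong = λ p → L.∘₁-cong (Functor.F₀-cong (U.F _ y) p) L.≈.refl
  ; F₁-cong = λ p → L.◃-cong (Functor.F₁-cong (U.F _ y) p) L.≈.refl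
  ; F-id    = λ h → L.≋-trans (L.◃-cong (Functor.F-id (U.F _ y) h) L.≈.refl) (L.◃-id (U.F₁ h) η)
  ; F-∘     = λ β α → L.≋-trans (L.◃-cong (Functor.F-∘ (U.F _ y) β α) L.≈.refl) (L.◃-∘ (U.F₂ β) (U.F₂ α) η)
  }
  where
  module L = 2-Category L
  module U = 2-Functor U

record RetractBireflection {ℓ} {K L : 2-Category ℓ} (U : 2-Functor K L)
                           (x : 2-Category.Ob L) (Fx : 2-Category.Ob K) : Set ℓ where
  private
    module L = 2-Category L
    module U = 2-Functor U
  field
    η : L.1-Cell x (U.F₀ Fx)
    surjectiveEquivalence : ∀ y → SurjectiveEquivalence (transpose U η y)

module Slice {ℓ} (K : 2-Category ℓ) (o : 2-Category.Ob K) where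
  open 2-Category K

  record Over : Set ℓ where
    constructor over
    field
      {total} : Ob
      base    : 1-Cell total o
  open Over

  record Triangle (x y : Over) : Set ℓ where
    constructor triangle
    field
      arrow    : 1-Cell (total x) (total y)
      commutes : base y ∘₁ arrow ≈ base x
  open Triangle

  record Triangle₂ {x y : Over} (f g : Triangle x y) : Set ℓ where
    constructor triangle₂
    field
      cell     : arrow f ⇒ arrow g
      identity : base y ▹ cell ≋ id₂ (base x)
  open Triangle₂

  homOver : Over → Over → Category ℓ
  homOver x y = record
    { Obj = Triangle x y
    ; _≈_ = λ f g → arrow f ≈ arrow g
    ; ≈-isEquivalence = record { refl = ≈.refl ; sym = ≈.sym ; trans = ≈.trans }
    ; Hom = Triangle₂
    ; _≋_ = λ α β → cell α ≋ cell β
    ; ≋-refl = ≋-refl ; ≋-sym = ≋-sym ; ≋-trans = ≋-trans ; ≋-dom = ≋-dom ; ≋-cod = ≋-cod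
    ; coe = λ p q α → triangle₂ (coe p q (cell α))
                        (≋-trans (▹-cong ≈.refl (coe-≋ p q (cell α))) (identity α))
    ; coe-≋ = λ p q α → coe-≋ p q (cell α)
    ; id = λ f → triangle₂ (id₂ (arrow f))
                   (≋-trans (▹-id (base y) (arrow f)) (id-cong (commutes f)))
    ; _∘_ = λ β α → triangle₂ (cell β ∘ᵥ cell α)
                   (≋-trans (▹-∘ (base y) (cell β) (cell α))
                     (≋-trans (∘-cong (identity β) (identity α)) (idˡ (id₂ (base x)))))
    ; id-cong = id-cong
    ; ∘-cong = ∘-cong
    ; assoc = λ γ β α → assoc (cell γ) (cell β) (cell α)
    ; idˡ = λ α → idˡ (cell α)
    ; idʳ = λ α → idʳ (cell α)
    }

  slice : 2-Category ℓ
  slice = record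
    { Ob = Over
    ; hom = homOver
    ; id₁ = λ x → triangle (id₁ (total x)) (∘₁-idʳ (base x))
    ; _∘₁_ = λ {x} {y} {z} g f → triangle (arrow g ∘₁ arrow f)
        (≈.trans (≈.sym (∘₁-assoc (base z) (arrow g) (arrow f)))
          (≈.trans (∘₁-cong (commutes g) ≈.refl) (commutes f)))
    ; _▹_ = λ {x} {y} {z} h α → triangle₂ (arrow h ▹ cell α)
        (≋-trans (≋-sym (▹-∘₁ (base z) (arrow h) (cell α)))
          (≋-trans (▹-cong (commutes h) ≋-refl) (identity α)))
    ; _◃_ = λ {x} {y} {z} α k → triangle₂ (cell α ◃ arrow k)
        (≋-trans (≋-sym (▹-◃ (base z) (cell α) (arrow k)))
          (≋-trans (◃-cong (identity α) ≈.refl)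
            (≋-trans (◃-id (base y) (arrow k)) (id-cong (commutes k)))))
    ; ∘₁-cong = ∘₁-cong
    ; ∘₁-assoc = λ h g f → ∘₁-assoc (arrow h) (arrow g) (arrow f)
    ; ∘₁-idˡ = λ f → ∘₁-idˡ (arrow f)
    ; ∘₁-idʳ = λ f → ∘₁-idʳ (arrow f)
    ; ▹-cong = ▹-cong
    ; ◃-cong = ◃-cong
    ; ▹-id = λ h f → ▹-id (arrow h) (arrow f)
    ; ◃-id = λ f k → ◃-id (arrow f) (arrow k)
    ; ▹-∘ = λ h β α → ▹-∘ (arrow h) (cell β) (cell α)
    ; ◃-∘ = λ β α k → ◃-∘ (cell β) (cell α) (arrow k)
    ; ▹-id₁ = λ α → ▹-id₁ (cell α)
    ; ◃-id₁ = λ α → ◃-id₁ (cell α)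
    ; ▹-∘₁ = λ h k α → ▹-∘₁ (arrow h) (arrow k) (cell α)
    ; ◃-∘₁ = λ α h k → ◃-∘₁ (cell α) (arrow h) (arrow k)
    ; ▹-◃ = λ h α k → ▹-◃ (arrow h) (cell α) (arrow k)
    ; interchange = λ β α → interchange (cell β) (cell α)
    }

-- Data with the operations of a 2-category, together with a map to a
-- 2-category that preserves them and reflects equality of cells, form a
-- 2-category.
record LocalEmbedding {ℓ} (K : 2-Category ℓ) : Set (lsuc ℓ) where
  private module K = 2-Category K
  infix  4 _≈_ _⇒_ _≋_
  infixr 9 _∘ᵥ_ _∘₁_ _▹_ _◃_
  field
    Ob     : Set ℓ
    1-Cell : Ob → Ob → Set ℓ
    _≈_    : ∀ {x y} → 1-Cell x y → 1-Cell x y → Set ℓ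
    _⇒_    : ∀ {x y} → 1-Cell x y → 1-Cell x y → Set ℓ
    _≋_    : ∀ {x y} {f g f′ g′ : 1-Cell x y} → f ⇒ g → f′ ⇒ g′ → Set ℓ
    coe    : ∀ {x y} {f g f′ g′ : 1-Cell x y} → f ≈ f′ → g ≈ g′ → f ⇒ g → f′ ⇒ g′
    coe-≋  : ∀ {x y} {f g f′ g′ : 1-Cell x y} (p : f ≈ f′) (q : g ≈ g′) (α : f ⇒ g) → coe p q α ≋ α
    id₂    : ∀ {x y} (f : 1-Cell x y) → f ⇒ f
    _∘ᵥ_   : ∀ {x y} {f g h : 1-Cell x y} → g ⇒ h → f ⇒ g → f ⇒ h
    id₁    : ∀ x → 1-Cell x x
    _∘₁_   : ∀ {x y z} → 1-Cell y z → 1-Cell x y → 1-Cell x z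
    _▹_    : ∀ {x y z} (h : 1-Cell y z) {f g : 1-Cell x y} → f ⇒ g → h ∘₁ f ⇒ h ∘₁ g
    _◃_    : ∀ {x y z} {f g : 1-Cell y z} → f ⇒ g → (k : 1-Cell x y) → f ∘₁ k ⇒ g ∘₁ k

    E₀     : Ob → K.Ob
    E₁     : ∀ {x y} → 1-Cell x y → K.1-Cell (E₀ x) (E₀ y)
    E₂     : ∀ {x y} {f g : 1-Cell x y} → f ⇒ g → E₁ f K.⇒ E₁ g

    E₁-cong  : ∀ {x y} {f g : 1-Cell x y} → f ≈ g → E₁ f K.≈ E₁ g
    E₁-cong⁻ : ∀ {x y} {f g : 1-Cell x y} → E₁ f K.≈ E₁ g → f ≈ g
    E₂-cong  : ∀ {x y} {f g f′ g′ : 1-Cell x y} {α : f ⇒ g} {β : f′ ⇒ g′} → α ≋ β → E₂ α K.≋ E₂ β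
    E₂-cong⁻ : ∀ {x y} {f g f′ g′ : 1-Cell x y} {α : f ⇒ g} {β : f′ ⇒ g′} → E₂ α K.≋ E₂ β → α ≋ β
    E-id₂    : ∀ {x y} (f : 1-Cell x y) → E₂ (id₂ f) K.≋ K.id₂ (E₁ f)
    E-∘ᵥ     : ∀ {x y} {f g h : 1-Cell x y} (β : g ⇒ h) (α : f ⇒ g) → E₂ (β ∘ᵥ α) K.≋ E₂ β K.∘ᵥ E₂ α
    E-id₁    : ∀ x → E₁ (id₁ x) K.≈ K.id₁ (E₀ x)
    E-∘₁     : ∀ {x y z} (g : 1-Cell y z) (f : 1-Cell x y) → E₁ (g ∘₁ f) K.≈ E₁ g K.∘₁ E₁ f
    E-▹      : ∀ {x y z} (h : 1-Cell y z) {f g : 1-Cell x y} (α : f ⇒ g) → E₂ (h ▹ α) K.≋ E₁ h K.▹ E₂ α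
    E-◃      : ∀ {x y z} {f g : 1-Cell y z} (α : f ⇒ g) (k : 1-Cell x y) → E₂ (α ◃ k) K.≋ E₂ α K.◃ E₁ k

  homs : Ob → Ob → Category ℓ
  homs x y = record
    { Obj = 1-Cell x y
    ; _≈_ = _≈_
    ; ≈-isEquivalence = record
      { refl = E₁-cong⁻ K.≈.refl
      ; sym = λ p → E₁-cong⁻ (K.≈.sym (E₁-cong p))
      ; trans = λ p q → E₁-cong⁻ (K.≈.trans (E₁-cong p) (E₁-cong q)) }
    ; Hom = _⇒_
    ; _≋_ = _≋_
    ; ≋-refl = E₂-cong⁻ K.≋-refl
    ; ≋-sym = λ p → E₂-cong⁻ (K.≋-sym (E₂-cong p))
    ; ≋-trans = λ p q → E₂-cong⁻ (K.≋-trans (E₂-cong p) (E₂-cong q))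
    ; ≋-dom = λ p → E₁-cong⁻ (K.≋-dom (E₂-cong p))
    ; ≋-cod = λ p → E₁-cong⁻ (K.≋-cod (E₂-cong p))
    ; coe = coe
    ; coe-≋ = coe-≋
    ; id = id₂
    ; _∘_ = _∘ᵥ_
    ; id-cong = λ {f} {g} p → E₂-cong⁻
        (K.≋-trans (E-id₂ f) (K.≋-trans (K.id-cong (E₁-cong p)) (K.≋-sym (E-id₂ g))))
    ; ∘-cong = λ p q → E₂-cong⁻
        (K.≋-trans (E-∘ᵥ _ _) (K.≋-trans (K.∘-cong (E₂-cong p) (E₂-cong q)) (K.≋-sym (E-∘ᵥ _ _))))
    ; assoc = λ γ β α → E₂-cong⁻
        (K.≋-trans (E-∘ᵥ (γ ∘ᵥ β) α) (K.≋-trans (K.∘-cong (E-∘ᵥ γ β) K.≋-refl)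
        (K.≋-trans (K.assoc (E₂ γ) (E₂ β) (E₂ α)) (K.≋-sym
        (K.≋-trans (E-∘ᵥ γ (β ∘ᵥ α)) (K.∘-cong K.≋-refl (E-∘ᵥ β α)))))))
    ; idˡ = λ {f} {g} α → E₂-cong⁻
        (K.≋-trans (E-∘ᵥ (id₂ g) α) (K.≋-trans (K.∘-cong (E-id₂ g) K.≋-refl) (K.idˡ (E₂ α))))
    ; idʳ = λ {f} {g} α → E₂-cong⁻
        (K.≋-trans (E-∘ᵥ α (id₂ f)) (K.≋-trans (K.∘-cong K.≋-refl (E-id₂ f)) (K.idʳ (E₂ α))))
    }

  domain : 2-Category ℓ
  domain = record
    { Ob = Ob
    ; hom = homs
    ; id₁ = id₁
    ; _∘₁_ = _∘₁_
    ; _▹_ = _▹_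
    ; _◃_ = _◃_
    ; ∘₁-cong = λ {_} {_} {_} {h} {h′} {k} {k′} p q → E₁-cong⁻
        (K.≈.trans (E-∘₁ h k) (K.≈.trans (K.∘₁-cong (E₁-cong p) (E₁-cong q)) (K.≈.sym (E-∘₁ h′ k′))))
    ; ∘₁-assoc = λ h g f → E₁-cong⁻
        (K.≈.trans (E-∘₁ (h ∘₁ g) f) (K.≈.trans (K.∘₁-cong (E-∘₁ h g) K.≈.refl)
        (K.≈.trans (K.∘₁-assoc (E₁ h) (E₁ g) (E₁ f)) (K.≈.sym
        (K.≈.trans (E-∘₁ h (g ∘₁ f)) (K.∘₁-cong K.≈.refl (E-∘₁ g f)))))))
    ; ∘₁-idˡ = λ {_} {y} f → E₁-cong⁻
        (K.≈.trans (E-∘₁ (id₁ y) f) (K.≈.trans (K.∘₁-cong (E-id₁ y) K.≈.refl) (K.∘₁-idˡ (E₁ f))))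
    ; ∘₁-idʳ = λ {x} f → E₁-cong⁻
        (K.≈.trans (E-∘₁ f (id₁ x)) (K.≈.trans (K.∘₁-cong K.≈.refl (E-id₁ x)) (K.∘₁-idʳ (E₁ f))))
    ; ▹-cong = λ p q → E₂-cong⁻
        (K.≋-trans (E-▹ _ _) (K.≋-trans (K.▹-cong (E₁-cong p) (E₂-cong q)) (K.≋-sym (E-▹ _ _))))
    ; ◃-cong = λ p q → E₂-cong⁻
        (K.≋-trans (E-◃ _ _) (K.≋-trans (K.◃-cong (E₂-cong p) (E₁-cong q)) (K.≋-sym (E-◃ _ _))))
    ; ▹-id = λ h f → E₂-cong⁻
        (K.≋-trans (E-▹ h (id₂ f)) (K.≋-trans (K.▹-cong K.≈.refl (E-id₂ f))
        (K.≋-trans (K.▹-id (E₁ h) (E₁ f)) (K.≋-sym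
        (K.≋-trans (E-id₂ (h ∘₁ f)) (K.id-cong (E-∘₁ h f)))))))
    ; ◃-id = λ f k → E₂-cong⁻
        (K.≋-trans (E-◃ (id₂ f) k) (K.≋-trans (K.◃-cong (E-id₂ f) K.≈.refl)
        (K.≋-trans (K.◃-id (E₁ f) (E₁ k)) (K.≋-sym
        (K.≋-trans (E-id₂ (f ∘₁ k)) (K.id-cong (E-∘₁ f k)))))))
    ; ▹-∘ = λ h β α → E₂-cong⁻
        (K.≋-trans (E-▹ h (β ∘ᵥ α)) (K.≋-trans (K.▹-cong K.≈.refl (E-∘ᵥ β α))
        (K.≋-trans (K.▹-∘ (E₁ h) (E₂ β) (E₂ α)) (K.≋-sym
        (K.≋-trans (E-∘ᵥ (h ▹ β) (h ▹ α)) (K.∘-cong (E-▹ h β) (E-▹ h α)))))))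
    ; ◃-∘ = λ β α k → E₂-cong⁻
        (K.≋-trans (E-◃ (β ∘ᵥ α) k) (K.≋-trans (K.◃-cong (E-∘ᵥ β α) K.≈.refl)
        (K.≋-trans (K.◃-∘ (E₂ β) (E₂ α) (E₁ k)) (K.≋-sym
        (K.≋-trans (E-∘ᵥ (β ◃ k) (α ◃ k)) (K.∘-cong (E-◃ β k) (E-◃ α k)))))))
    ; ▹-id₁ = λ {_} {y} α → E₂-cong⁻
        (K.≋-trans (E-▹ (id₁ y) α) (K.≋-trans (K.▹-cong (E-id₁ y) K.≋-refl) (K.▹-id₁ (E₂ α))))
    ; ◃-id₁ = λ {x} α → E₂-cong⁻
        (K.≋-trans (E-◃ α (id₁ x)) (K.≋-trans (K.◃-cong K.≋-refl (E-id₁ x)) (K.◃-id₁ (E₂ α))))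
    ; ▹-∘₁ = λ h k α → E₂-cong⁻
        (K.≋-trans (E-▹ (h ∘₁ k) α) (K.≋-trans (K.▹-cong (E-∘₁ h k) K.≋-refl)
        (K.≋-trans (K.▹-∘₁ (E₁ h) (E₁ k) (E₂ α)) (K.≋-sym
        (K.≋-trans (E-▹ h (k ▹ α)) (K.▹-cong K.≈.refl (E-▹ k α)))))))
    ; ◃-∘₁ = λ α h k → E₂-cong⁻
        (K.≋-trans (E-◃ α (h ∘₁ k)) (K.≋-trans (K.◃-cong K.≋-refl (E-∘₁ h k))
        (K.≋-trans (K.◃-∘₁ (E₂ α) (E₁ h) (E₁ k)) (K.≋-sym
        (K.≋-trans (E-◃ (α ◃ h) k) (K.◃-cong (E-◃ α h) K.≈.refl))))))
    ; ▹-◃ = λ h α k → E₂-cong⁻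
        (K.≋-trans (E-◃ (h ▹ α) k) (K.≋-trans (K.◃-cong (E-▹ h α) K.≈.refl)
        (K.≋-trans (K.▹-◃ (E₁ h) (E₂ α) (E₁ k)) (K.≋-sym
        (K.≋-trans (E-▹ h (α ◃ k)) (K.▹-cong K.≈.refl (E-◃ α k)))))))
    ; interchange = λ {_} {_} {_} {h} {k} {f} {g} β α → E₂-cong⁻
        (K.≋-trans (E-∘ᵥ (β ◃ g) (h ▹ α)) (K.≋-trans (K.∘-cong (E-◃ β g) (E-▹ h α))
        (K.≋-trans (K.interchange (E₂ β) (E₂ α)) (K.≋-sym
        (K.≋-trans (E-∘ᵥ (k ▹ α) (β ◃ f)) (K.∘-cong (E-▹ k α) (E-◃ β f)))))))
    }

  embedding : 2-Functor domain K
  embedding = record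
    { F₀ = E₀
    ; F = λ x y → record
      { F₀ = E₁ ; F₁ = E₂ ; F₀-cong = E₁-cong ; F₁-cong = E₂-cong ; F-id = E-id₂ ; F-∘ = E-∘ᵥ }
    ; F-id₁ = E-id₁
    ; F-∘₁ = E-∘₁
    ; F-▹ = E-▹
    ; F-◃ = E-◃
    }

-- Raw expressions in n de Bruijn variables, so that α-equivalent expressions
-- coincide.  A substitution has the term for the most recent variable at its
-- head.
record Presyntax (ℓ : Level) : Set (lsuc ℓ) where
  infixl 40 _[_]ᵀ _[_]
  field
    Ty Tm  : ℕ → Set ℓ
    var    : ∀ {n} → Fin n → Tm n
    _[_]ᵀ  : ∀ {m n} → Ty n → Vec (Tm m) n → Ty m
    _[_]   : ∀ {m n} → Tm n → Vec (Tm m) n → Tm m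

  Sub : ℕ → ℕ → Set ℓ
  Sub m n = Vec (Tm m) n

  id : ∀ {n} → Sub n n
  id = tabulate var

  wk : ∀ {n} → Sub (suc n) n
  wk = tabulate (λ i → var (suc i))

  infixl 35 _∘_
  _∘_ : ∀ {l m n} → Sub m n → Sub l m → Sub l n
  σ ∘ τ = map (_[ τ ]) σ

  field
    var-[]  : ∀ {m n} (i : Fin n) (σ : Sub m n) → var i [ σ ] ≡ lookup σ i
    []ᵀ-id  : ∀ {n} (A : Ty n) → A [ id ]ᵀ ≡ A
    []-id   : ∀ {n} (a : Tm n) → a [ id ] ≡ a
    []ᵀ-∘   : ∀ {l m n} (A : Ty n) (σ : Sub m n) (τ : Sub l m) → A [ σ ]ᵀ [ τ ]ᵀ ≡ A [ σ ∘ τ ]ᵀ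
    []-∘    : ∀ {l m n} (a : Tm n) (σ : Sub m n) (τ : Sub l m) → a [ σ ] [ τ ] ≡ a [ σ ∘ τ ]

  infixl 45 _↑
  _↑ : ∀ {m n} → Sub m n → Sub (suc m) (suc n)
  σ ↑ = var zero ∷ (σ ∘ wk)

  wk² : ∀ {n} → Sub (suc (suc n)) n
  wk² = wk ∘ wk

  wk³ : ∀ {n} → Sub (suc (suc (suc n))) n
  wk³ = wk² ∘ wk

  v0 : ∀ {n} → Tm (suc n)
  v0 = var zero

  v1 : ∀ {n} → Tm (suc (suc n))
  v1 = var (suc zero)

  v2 : ∀ {n} → Tm (suc (suc (suc n)))
  v2 = var (suc (suc zero))

  infixl 20 _▷_
  data Ctx : ℕ → Set ℓ where
    []  : Ctx zero
    _▷_ : ∀ {n} → Ctx n → Ty n → Ctx (suc n)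

-- The derivable judgements, as arbitrary relations: a theory may have more
-- types, terms and equalities than the rules below force.
record Judgements {ℓ} (P : Presyntax ℓ) : Set (lsuc ℓ) where
  open Presyntax P
  infix 4 _⊢_type _⊢_≐_type _⊢_∶_ _⊢_≐_∶_
  field
    _⊢_type    : ∀ {n} → Ctx n → Ty n → Set ℓ
    _⊢_≐_type  : ∀ {n} → Ctx n → Ty n → Ty n → Set ℓ
    _⊢_∶_      : ∀ {n} → Ctx n → Tm n → Ty n → Set ℓ
    _⊢_≐_∶_    : ∀ {n} → Ctx n → Tm n → Tm n → Ty n → Set ℓ

  infix 4 _ctx _⊢ˢ_∶_ _⊢ˢ_≐_∶_
  data _ctx : ∀ {n} → Ctx n → Set ℓ where
    []  : [] ctx
    _▷_ : ∀ {n} {Γ : Ctx n} {A} → Γ ctx → Γ ⊢ A type → Γ ▷ A ctx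

  data _⊢ˢ_∶_ {m} (Γ : Ctx m) : ∀ {n} → Sub m n → Ctx n → Set ℓ where
    []  : Γ ctx → Γ ⊢ˢ [] ∶ []
    cons : ∀ {n} {Δ : Ctx n} {A σ a} →
          Γ ⊢ˢ σ ∶ Δ → Δ ⊢ A type → Γ ⊢ a ∶ A [ σ ]ᵀ → Γ ⊢ˢ a ∷ σ ∶ Δ ▷ A

  data _⊢ˢ_≐_∶_ {m} (Γ : Ctx m) : ∀ {n} → Sub m n → Sub m n → Ctx n → Set ℓ where
    []  : Γ ctx → Γ ⊢ˢ [] ≐ [] ∶ []
    cons : ∀ {n} {Δ : Ctx n} {A σ τ a b} →
          Γ ⊢ˢ σ ≐ τ ∶ Δ → Δ ⊢ A type → Γ ⊢ a ≐ b ∶ A [ σ ]ᵀ → Γ ⊢ˢ a ∷ σ ≐ b ∷ τ ∶ Δ ▷ A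

  data _∋_∶_ : ∀ {n} → Ctx n → Fin n → Ty n → Set ℓ where
    here  : ∀ {n} {Γ : Ctx n} {A} → (Γ ▷ A) ∋ zero ∶ A [ wk ]ᵀ
    there : ∀ {n} {Γ : Ctx n} {A B i} → Γ ∋ i ∶ A → (Γ ▷ B) ∋ suc i ∶ A [ wk ]ᵀ

-- Substitution along arbitrary context morphisms yields weakening,
-- contraction and exchange.
record Structural {ℓ} (P : Presyntax ℓ) (𝒥 : Judgements P) : Set ℓ where
  open Presyntax P
  open Judgements 𝒥
  field
    type⇒ctx  : ∀ {n} {Γ : Ctx n} {A} → Γ ⊢ A type → Γ ctx
    term⇒type : ∀ {n} {Γ : Ctx n} {A a} → Γ ⊢ a ∶ A → Γ ⊢ A type
    ≐type⇒type : ∀ {n} {Γ : Ctx n} {A B} → Γ ⊢ A ≐ B type → Γ ⊢ A type × Γ ⊢ B type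
    ≐term⇒term : ∀ {n} {Γ : Ctx n} {A a b} → Γ ⊢ a ≐ b ∶ A → Γ ⊢ a ∶ A × Γ ⊢ b ∶ A

    ≐type-refl  : ∀ {n} {Γ : Ctx n} {A} → Γ ⊢ A type → Γ ⊢ A ≐ A type
    ≐type-sym   : ∀ {n} {Γ : Ctx n} {A B} → Γ ⊢ A ≐ B type → Γ ⊢ B ≐ A type
    ≐type-trans : ∀ {n} {Γ : Ctx n} {A B C} → Γ ⊢ A ≐ B type → Γ ⊢ B ≐ C type → Γ ⊢ A ≐ C type
    ≐-refl      : ∀ {n} {Γ : Ctx n} {A a} → Γ ⊢ a ∶ A → Γ ⊢ a ≐ a ∶ A
    ≐-sym       : ∀ {n} {Γ : Ctx n} {A a b} → Γ ⊢ a ≐ b ∶ A → Γ ⊢ b ≐ a ∶ A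
    ≐-trans     : ∀ {n} {Γ : Ctx n} {A a b c} → Γ ⊢ a ≐ b ∶ A → Γ ⊢ b ≐ c ∶ A → Γ ⊢ a ≐ c ∶ A

    conv   : ∀ {n} {Γ : Ctx n} {A B a} → Γ ⊢ a ∶ A → Γ ⊢ A ≐ B type → Γ ⊢ a ∶ B
    ≐-conv : ∀ {n} {Γ : Ctx n} {A B a b} → Γ ⊢ a ≐ b ∶ A → Γ ⊢ A ≐ B type → Γ ⊢ a ≐ b ∶ B

    var-rule : ∀ {n} {Γ : Ctx n} {i A} → Γ ctx → Γ ∋ i ∶ A → Γ ⊢ var i ∶ A

    sub-type   : ∀ {m n} {Γ : Ctx m} {Δ : Ctx n} {σ A} →
                 Γ ⊢ˢ σ ∶ Δ → Δ ⊢ A type → Γ ⊢ A [ σ ]ᵀ type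
    sub-term   : ∀ {m n} {Γ : Ctx m} {Δ : Ctx n} {σ A a} →
                 Γ ⊢ˢ σ ∶ Δ → Δ ⊢ a ∶ A → Γ ⊢ a [ σ ] ∶ A [ σ ]ᵀ
    sub-≐type  : ∀ {m n} {Γ : Ctx m} {Δ : Ctx n} {σ τ A B} →
                 Γ ⊢ˢ σ ≐ τ ∶ Δ → Δ ⊢ A ≐ B type → Γ ⊢ A [ σ ]ᵀ ≐ B [ τ ]ᵀ type
    sub-≐term  : ∀ {m n} {Γ : Ctx m} {Δ : Ctx n} {σ τ A a b} →
                 Γ ⊢ˢ σ ≐ τ ∶ Δ → Δ ⊢ a ≐ b ∶ A → Γ ⊢ a [ σ ] ≐ b [ τ ] ∶ A [ σ ]ᵀ

record TypeTheory (ℓ : Level) : Set (lsuc ℓ) where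
  field
    presyntax  : Presyntax ℓ
    judgements : Judgements presyntax
    structural : Structural presyntax judgements
  open Presyntax presyntax public
  open Judgements judgements public
  open Structural structural public

-- Eliminators are open terms: J A C d lives in the context
-- x : A, y : A, p : Id A x y, and similarly for app, E and U.  Operations carry
-- all their annotations, which a presyntax is free to ignore.
record Operations {ℓ} (S : TypeTheory ℓ) : Set ℓ where
  open TypeTheory S
  field
    Sg    : ∀ {n} → Ty n → Ty (suc n) → Ty n
    pair  : ∀ {n} → Ty n → Ty (suc n) → Tm n → Tm n → Tm n
    E     : ∀ {n} → Ty n → Ty (suc n) → Ty (suc n) → Tm (suc (suc n)) → Tm (suc n)
    One   : ∀ {n} → Ty n
    ⋆     : ∀ {n} → Tm n
    U     : ∀ {n} → Ty (suc n) → Tm n → Tm (suc n)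
    Id    : ∀ {n} → Ty n → Tm n → Tm n → Ty n
    r     : ∀ {n} → Ty n → Tm n → Tm n
    J     : ∀ {n} → Ty n → Ty (suc (suc (suc n))) → Tm (suc n) → Tm (suc (suc (suc n)))
    Pi    : ∀ {n} → Ty n → Ty (suc n) → Ty n
    lam   : ∀ {n} → Ty n → Ty (suc n) → Tm (suc n) → Tm n
    app   : ∀ {n} → Ty n → Ty (suc n) → Tm n → Tm (suc n)
    ext   : ∀ {n} → Ty n → Ty (suc n) → Tm n → Tm n → Tm (suc n) → Tm n

    Sg-[]   : ∀ {m n} A B (σ : Sub m n) → Sg A B [ σ ]ᵀ ≡ Sg (A [ σ ]ᵀ) (B [ σ ↑ ]ᵀ)
    pair-[] : ∀ {m n} A B a b (σ : Sub m n) →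
              pair A B a b [ σ ] ≡ pair (A [ σ ]ᵀ) (B [ σ ↑ ]ᵀ) (a [ σ ]) (b [ σ ])
    E-[]    : ∀ {m n} A B C d (σ : Sub m n) →
              E A B C d [ σ ↑ ] ≡ E (A [ σ ]ᵀ) (B [ σ ↑ ]ᵀ) (C [ σ ↑ ]ᵀ) (d [ σ ↑ ↑ ])
    One-[]  : ∀ {m n} (σ : Sub m n) → One [ σ ]ᵀ ≡ One
    ⋆-[]    : ∀ {m n} (σ : Sub m n) → ⋆ [ σ ] ≡ ⋆
    U-[]    : ∀ {m n} C d (σ : Sub m n) → U C d [ σ ↑ ] ≡ U (C [ σ ↑ ]ᵀ) (d [ σ ])
    Id-[]   : ∀ {m n} A a b (σ : Sub m n) → Id A a b [ σ ]ᵀ ≡ Id (A [ σ ]ᵀ) (a [ σ ]) (b [ σ ])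
    r-[]    : ∀ {m n} A a (σ : Sub m n) → r A a [ σ ] ≡ r (A [ σ ]ᵀ) (a [ σ ])
    J-[]    : ∀ {m n} A C d (σ : Sub m n) →
              J A C d [ σ ↑ ↑ ↑ ] ≡ J (A [ σ ]ᵀ) (C [ σ ↑ ↑ ↑ ]ᵀ) (d [ σ ↑ ])
    Pi-[]   : ∀ {m n} A B (σ : Sub m n) → Pi A B [ σ ]ᵀ ≡ Pi (A [ σ ]ᵀ) (B [ σ ↑ ]ᵀ)
    lam-[]  : ∀ {m n} A B f (σ : Sub m n) →
              lam A B f [ σ ] ≡ lam (A [ σ ]ᵀ) (B [ σ ↑ ]ᵀ) (f [ σ ↑ ])
    app-[]  : ∀ {m n} A B f (σ : Sub m n) →
              app A B f [ σ ↑ ] ≡ app (A [ σ ]ᵀ) (B [ σ ↑ ]ᵀ) (f [ σ ])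
    ext-[]  : ∀ {m n} A B f g p (σ : Sub m n) →
              ext A B f g p [ σ ] ≡
              ext (A [ σ ]ᵀ) (B [ σ ↑ ]ᵀ) (f [ σ ]) (g [ σ ]) (p [ σ ↑ ])

  infixl 20 _▷Id_
  _▷Id_ : ∀ {n} → Ctx n → Ty n → Ctx (suc (suc (suc n)))
  Γ ▷Id A = Γ ▷ A ▷ A [ wk ]ᵀ ▷ Id (A [ wk² ]ᵀ) v1 v0

  -- (x , x , r x)
  diag : ∀ {n} → Ty n → Sub (suc n) (suc (suc (suc n)))
  diag A = r (A [ wk ]ᵀ) v0 ∷ v0 ∷ v0 ∷ wk

  ap : ∀ {n} → Ty n → Ty (suc n) → Tm n → Tm n → Tm n
  ap A B f a = app A B f [ a ∷ id ]

  -- p ∗ a : Id (f · a) (g · a) for p : Id (Pi A B) f g and a : A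
  happly : ∀ {n} → Ty n → Ty (suc n) → Tm n → Tm n → Tm n → Tm n → Tm n
  happly A B f g p a =
    J (Pi A B)
      (Id (B [ a ∷ id ]ᵀ [ wk³ ]ᵀ)
          (ap (A [ wk³ ]ᵀ) (B [ wk³ ↑ ]ᵀ) v2 (a [ wk³ ]))
          (ap (A [ wk³ ]ᵀ) (B [ wk³ ↑ ]ᵀ) v1 (a [ wk³ ])))
      (r (B [ a ∷ id ]ᵀ [ wk ]ᵀ) (ap (A [ wk ]ᵀ) (B [ wk ↑ ]ᵀ) v0 (a [ wk ])))
      [ p ∷ g ∷ f ∷ id ]

record ML₂ {ℓ} (S : TypeTheory ℓ) : Set ℓ where
  open TypeTheory S
  field operations : Operations S
  open Operations operations public
  field
    Sg-form : ∀ {n} {Γ : Ctx n} {A B} → Γ ▷ A ⊢ B type → Γ ⊢ Sg A B type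
    Sg-intro : ∀ {n} {Γ : Ctx n} {A B a b} → Γ ▷ A ⊢ B type →
      Γ ⊢ a ∶ A → Γ ⊢ b ∶ B [ a ∷ id ]ᵀ → Γ ⊢ pair A B a b ∶ Sg A B
    Sg-elim : ∀ {n} {Γ : Ctx n} {A B C d} → Γ ▷ A ⊢ B type → Γ ▷ Sg A B ⊢ C type →
      Γ ▷ A ▷ B ⊢ d ∶ C [ pair (A [ wk² ]ᵀ) (B [ wk² ↑ ]ᵀ) v1 v0 ∷ wk² ]ᵀ →
      Γ ▷ Sg A B ⊢ E A B C d ∶ C
    Sg-comp : ∀ {n} {Γ : Ctx n} {A B C d} → Γ ▷ A ⊢ B type → Γ ▷ Sg A B ⊢ C type →
      Γ ▷ A ▷ B ⊢ d ∶ C [ pair (A [ wk² ]ᵀ) (B [ wk² ↑ ]ᵀ) v1 v0 ∷ wk² ]ᵀ →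
      Γ ▷ A ▷ B ⊢ E A B C d [ pair (A [ wk² ]ᵀ) (B [ wk² ↑ ]ᵀ) v1 v0 ∷ wk² ] ≐ d
                  ∶ C [ pair (A [ wk² ]ᵀ) (B [ wk² ↑ ]ᵀ) v1 v0 ∷ wk² ]ᵀ

    One-form : ∀ {n} {Γ : Ctx n} → Γ ctx → Γ ⊢ One type
    One-intro : ∀ {n} {Γ : Ctx n} → Γ ctx → Γ ⊢ ⋆ ∶ One
    One-elim : ∀ {n} {Γ : Ctx n} {C d} → Γ ▷ One ⊢ C type →
      Γ ⊢ d ∶ C [ ⋆ ∷ id ]ᵀ → Γ ▷ One ⊢ U C d ∶ C
    One-comp : ∀ {n} {Γ : Ctx n} {C d} → Γ ▷ One ⊢ C type →
      Γ ⊢ d ∶ C [ ⋆ ∷ id ]ᵀ → Γ ⊢ U C d [ ⋆ ∷ id ] ≐ d ∶ C [ ⋆ ∷ id ]ᵀ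

    Id-form : ∀ {n} {Γ : Ctx n} {A a b} → Γ ⊢ a ∶ A → Γ ⊢ b ∶ A → Γ ⊢ Id A a b type
    Id-intro : ∀ {n} {Γ : Ctx n} {A a} → Γ ⊢ a ∶ A → Γ ⊢ r A a ∶ Id A a a
    Id-elim : ∀ {n} {Γ : Ctx n} {A C d} → Γ ▷Id A ⊢ C type →
      Γ ▷ A ⊢ d ∶ C [ diag A ]ᵀ → Γ ▷Id A ⊢ J A C d ∶ C
    Id-comp : ∀ {n} {Γ : Ctx n} {A C d} → Γ ▷Id A ⊢ C type →
      Γ ▷ A ⊢ d ∶ C [ diag A ]ᵀ → Γ ▷ A ⊢ J A C d [ diag A ] ≐ d ∶ C [ diag A ]ᵀ

    Pi-form : ∀ {n} {Γ : Ctx n} {A B} → Γ ▷ A ⊢ B type → Γ ⊢ Pi A B type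
    Pi-intro : ∀ {n} {Γ : Ctx n} {A B f} → Γ ▷ A ⊢ f ∶ B → Γ ⊢ lam A B f ∶ Pi A B
    Pi-elim : ∀ {n} {Γ : Ctx n} {A B f} → Γ ▷ A ⊢ B type →
      Γ ⊢ f ∶ Pi A B → Γ ▷ A ⊢ app A B f ∶ B
    Pi-comp : ∀ {n} {Γ : Ctx n} {A B f} → Γ ▷ A ⊢ f ∶ B →
      Γ ▷ A ⊢ app A B (lam A B f) ≐ f ∶ B

    Id-disc : ∀ {n} {Γ : Ctx n} {A a b p q α} → Γ ⊢ α ∶ Id (Id A a b) p q →
      Γ ⊢ p ∶ Id A a b → Γ ⊢ q ∶ Id A a b → Γ ⊢ p ≐ q ∶ Id A a b
    Id-disc-r : ∀ {n} {Γ : Ctx n} {A a b p q α} → Γ ⊢ α ∶ Id (Id A a b) p q →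
      Γ ⊢ p ∶ Id A a b → Γ ⊢ q ∶ Id A a b → Γ ⊢ α ≐ r (Id A a b) p ∶ Id (Id A a b) p q

    ext-rule : ∀ {n} {Γ : Ctx n} {A B f g p} → Γ ▷ A ⊢ B type →
      Γ ⊢ f ∶ Pi A B → Γ ⊢ g ∶ Pi A B →
      Γ ▷ A ⊢ p ∶ Id B (app A B f) (app A B g) → Γ ⊢ ext A B f g p ∶ Id (Pi A B) f g
    ext-r : ∀ {n} {Γ : Ctx n} {A B f} → Γ ▷ A ⊢ B type → Γ ⊢ f ∶ Pi A B →
      Γ ⊢ ext A B f f (r B (app A B f)) ≐ r (Pi A B) f ∶ Id (Pi A B) f f
    ext-∗ : ∀ {n} {Γ : Ctx n} {A B f g p} → Γ ▷ A ⊢ B type →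
      Γ ⊢ f ∶ Pi A B → Γ ⊢ g ∶ Pi A B →
      Γ ▷ A ⊢ p ∶ Id B (app A B f) (app A B g) →
      Γ ▷ A ⊢ happly (A [ wk ]ᵀ) (B [ wk ↑ ]ᵀ) (f [ wk ]) (g [ wk ]) (ext A B f g p [ wk ]) v0
              ≐ p ∶ Id B (app A B f) (app A B g)

    Sg-cong : ∀ {n} {Γ : Ctx n} {A A′ B B′} → Γ ⊢ A ≐ A′ type → Γ ▷ A ⊢ B ≐ B′ type →
      Γ ⊢ Sg A B ≐ Sg A′ B′ type
    pair-cong : ∀ {n} {Γ : Ctx n} {A A′ B B′ a a′ b b′} → Γ ⊢ A ≐ A′ type →
      Γ ▷ A ⊢ B ≐ B′ type → Γ ⊢ a ≐ a′ ∶ A → Γ ⊢ b ≐ b′ ∶ B [ a ∷ id ]ᵀ →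
      Γ ⊢ pair A B a b ≐ pair A′ B′ a′ b′ ∶ Sg A B
    E-cong : ∀ {n} {Γ : Ctx n} {A A′ B B′ C C′ d d′} → Γ ⊢ A ≐ A′ type →
      Γ ▷ A ⊢ B ≐ B′ type → Γ ▷ Sg A B ⊢ C ≐ C′ type →
      Γ ▷ A ▷ B ⊢ d ≐ d′ ∶ C [ pair (A [ wk² ]ᵀ) (B [ wk² ↑ ]ᵀ) v1 v0 ∷ wk² ]ᵀ →
      Γ ▷ Sg A B ⊢ E A B C d ≐ E A′ B′ C′ d′ ∶ C
    U-cong : ∀ {n} {Γ : Ctx n} {C C′ d d′} → Γ ▷ One ⊢ C ≐ C′ type →
      Γ ⊢ d ≐ d′ ∶ C [ ⋆ ∷ id ]ᵀ → Γ ▷ One ⊢ U C d ≐ U C′ d′ ∶ C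
    Id-cong : ∀ {n} {Γ : Ctx n} {A A′ a a′ b b′} → Γ ⊢ A ≐ A′ type →
      Γ ⊢ a ≐ a′ ∶ A → Γ ⊢ b ≐ b′ ∶ A → Γ ⊢ Id A a b ≐ Id A′ a′ b′ type
    r-cong : ∀ {n} {Γ : Ctx n} {A A′ a a′} → Γ ⊢ A ≐ A′ type →
      Γ ⊢ a ≐ a′ ∶ A → Γ ⊢ r A a ≐ r A′ a′ ∶ Id A a a
    J-cong : ∀ {n} {Γ : Ctx n} {A A′ C C′ d d′} → Γ ⊢ A ≐ A′ type →
      Γ ▷Id A ⊢ C ≐ C′ type → Γ ▷ A ⊢ d ≐ d′ ∶ C [ diag A ]ᵀ →
      Γ ▷Id A ⊢ J A C d ≐ J A′ C′ d′ ∶ C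
    Pi-cong : ∀ {n} {Γ : Ctx n} {A A′ B B′} → Γ ⊢ A ≐ A′ type → Γ ▷ A ⊢ B ≐ B′ type →
      Γ ⊢ Pi A B ≐ Pi A′ B′ type
    lam-cong : ∀ {n} {Γ : Ctx n} {A A′ B B′ f f′} → Γ ⊢ A ≐ A′ type →
      Γ ▷ A ⊢ B ≐ B′ type → Γ ▷ A ⊢ f ≐ f′ ∶ B → Γ ⊢ lam A B f ≐ lam A′ B′ f′ ∶ Pi A B
    app-cong : ∀ {n} {Γ : Ctx n} {A A′ B B′ f f′} → Γ ⊢ A ≐ A′ type →
      Γ ▷ A ⊢ B ≐ B′ type → Γ ⊢ f ≐ f′ ∶ Pi A B → Γ ▷ A ⊢ app A B f ≐ app A′ B′ f′ ∶ B
    ext-cong : ∀ {n} {Γ : Ctx n} {A A′ B B′ f f′ g g′ p p′} → Γ ⊢ A ≐ A′ type →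
      Γ ▷ A ⊢ B ≐ B′ type → Γ ⊢ f ≐ f′ ∶ Pi A B → Γ ⊢ g ≐ g′ ∶ Pi A B →
      Γ ▷ A ⊢ p ≐ p′ ∶ Id B (app A B f) (app A B g) →
      Γ ⊢ ext A B f g p ≐ ext A′ B′ f′ g′ p′ ∶ Id (Pi A B) f g

module Substitution {ℓ} (S : TypeTheory ℓ) where
  open TypeTheory S

  ∘-assoc : ∀ {k l m n} (σ : Sub m n) (τ : Sub l m) (υ : Sub k l) → σ ∘ τ ∘ υ ≡ σ ∘ (τ ∘ υ)
  ∘-assoc []      τ υ = refl
  ∘-assoc (a ∷ σ) τ υ = cong₂ _∷_ ([]-∘ a τ υ) (∘-assoc σ τ υ)

  ∘-id : ∀ {m n} (σ : Sub m n) → σ ∘ id ≡ σ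
  ∘-id []      = refl
  ∘-id (a ∷ σ) = cong₂ _∷_ ([]-id a) (∘-id σ)

  tabulate-var-∘ : ∀ {l m n} (f : Fin n → Fin m) (σ : Sub l m) →
                   tabulate (λ i → var (f i)) ∘ σ ≡ tabulate (λ i → lookup σ (f i))
  tabulate-var-∘ f σ = trans (sym (tabulate-∘ (_[ σ ]) (λ i → var (f i))))
                             (tabulate-cong (λ i → var-[] (f i) σ))

  id-∘ : ∀ {m n} (σ : Sub m n) → id ∘ σ ≡ σ
  id-∘ σ = trans (tabulate-var-∘ (λ i → i) σ) (tabulate∘lookup σ)

  wk-∷ : ∀ {m n} (a : Tm m) (σ : Sub m n) → wk ∘ (a ∷ σ) ≡ σ
  wk-∷ a σ = trans (tabulate-var-∘ suc (a ∷ σ)) (tabulate∘lookup σ)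

  ∘wk-∷ : ∀ {l m n} (τ : Sub m n) (a : Tm l) (σ : Sub l m) → τ ∘ wk ∘ (a ∷ σ) ≡ τ ∘ σ
  ∘wk-∷ τ a σ = trans (∘-assoc τ wk (a ∷ σ)) (cong (τ ∘_) (wk-∷ a σ))

  ↑-∷ : ∀ {l m n} (τ : Sub m n) (a : Tm l) (σ : Sub l m) → τ ↑ ∘ (a ∷ σ) ≡ a ∷ (τ ∘ σ)
  ↑-∷ τ a σ = cong₂ _∷_ (var-[] zero (a ∷ σ)) (∘wk-∷ τ a σ)

  []ᵀ≡ : ∀ {l m n} (A : Ty n) {σ : Sub m n} {τ : Sub l m} {υ : Sub l n} →
         σ ∘ τ ≡ υ → A [ σ ]ᵀ [ τ ]ᵀ ≡ A [ υ ]ᵀ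
  []ᵀ≡ A {σ} {τ} eq = trans ([]ᵀ-∘ A σ τ) (cong (A [_]ᵀ) eq)

  []≡ : ∀ {l m n} (a : Tm n) {σ : Sub m n} {τ : Sub l m} {υ : Sub l n} →
        σ ∘ τ ≡ υ → a [ σ ] [ τ ] ≡ a [ υ ]
  []≡ a {σ} {τ} eq = trans ([]-∘ a σ τ) (cong (a [_]) eq)

  cast : ∀ {n} {Γ : Ctx n} {A B a} → A ≡ B → Γ ⊢ a ∶ A → Γ ⊢ a ∶ B
  cast {Γ = Γ} {a = a} = subst (Γ ⊢ a ∶_)

  cast≐ : ∀ {n} {Γ : Ctx n} {A B a b} → A ≡ B → Γ ⊢ a ≐ b ∶ A → Γ ⊢ a ≐ b ∶ B
  cast≐ {Γ = Γ} {a = a} {b} = subst (Γ ⊢ a ≐ b ∶_)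

  castᵗ : ∀ {n} {Γ : Ctx n} {A a b} → a ≡ b → Γ ⊢ a ∶ A → Γ ⊢ b ∶ A
  castᵗ {Γ = Γ} {A} = subst (Γ ⊢_∶ A)

  castˢ : ∀ {m n} {Γ : Ctx m} {Δ : Ctx n} {σ τ} → σ ≡ τ → Γ ⊢ˢ σ ∶ Δ → Γ ⊢ˢ τ ∶ Δ
  castˢ {Γ = Γ} {Δ} = subst (Γ ⊢ˢ_∶ Δ)

  cast≐ˢ : ∀ {m n} {Γ : Ctx m} {Δ : Ctx n} {σ σ′ τ τ′} → σ ≡ σ′ → τ ≡ τ′ →
           Γ ⊢ˢ σ ≐ τ ∶ Δ → Γ ⊢ˢ σ′ ≐ τ′ ∶ Δ
  cast≐ˢ refl refl p = p

  cast≐ᵗ : ∀ {n} {Γ : Ctx n} {A a a′ b b′} → a ≡ a′ → b ≡ b′ → Γ ⊢ a ≐ b ∶ A → Γ ⊢ a′ ≐ b′ ∶ A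
  cast≐ᵗ refl refl p = p

  ≡⇒≐ : ∀ {n} {Γ : Ctx n} {A a b} → a ≡ b → Γ ⊢ a ∶ A → Γ ⊢ a ≐ b ∶ A
  ≡⇒≐ refl = ≐-refl

  ⊢dom : ∀ {m n} {Γ : Ctx m} {Δ : Ctx n} {σ} → Γ ⊢ˢ σ ∶ Δ → Γ ctx
  ⊢dom ([] Γ!)      = Γ!
  ⊢dom (cons σ! _ _) = ⊢dom σ!

  ⊢cod : ∀ {m n} {Γ : Ctx m} {Δ : Ctx n} {σ} → Γ ⊢ˢ σ ∶ Δ → Δ ctx
  ⊢cod ([] _)        = []
  ⊢cod (cons σ! A! _) = ⊢cod σ! ▷ A!

  ▷type : ∀ {n} {Γ : Ctx n} {A} → Γ ▷ A ctx → Γ ⊢ A type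
  ▷type (_ ▷ A!) = A!

  ▷ctx : ∀ {n} {Γ : Ctx n} {A} → Γ ▷ A ctx → Γ ctx
  ▷ctx (Γ! ▷ _) = Γ!

  ⊢∘ : ∀ {l m n} {Γ : Ctx l} {Δ : Ctx m} {Θ : Ctx n} {σ τ} →
       Δ ⊢ˢ σ ∶ Θ → Γ ⊢ˢ τ ∶ Δ → Γ ⊢ˢ σ ∘ τ ∶ Θ
  ⊢∘ ([] _)         τ! = [] (⊢dom τ!)
  ⊢∘ {τ = τ} (cons {A = A} {σ} σ! A! a!) τ! =
    cons (⊢∘ σ! τ!) A! (cast ([]ᵀ-∘ A σ τ) (sub-term τ! a!))

  ⊢tabulate : ∀ {m n} {Γ : Ctx m} {Δ : Ctx n} (σ : Sub m n) → Γ ctx → Δ ctx →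
              (∀ {i A} → Δ ∋ i ∶ A → Γ ⊢ lookup σ i ∶ A [ σ ]ᵀ) → Γ ⊢ˢ σ ∶ Δ
  ⊢tabulate []      Γ! []        h = [] Γ!
  ⊢tabulate (a ∷ σ) Γ! (Δ! ▷ A!) h =
    cons (⊢tabulate σ Γ! Δ! (λ {i} {A} x → cast ([]ᵀ≡ A (wk-∷ a σ)) (h (there x)))) A!
         (cast ([]ᵀ≡ _ (wk-∷ a σ)) (h here))

  ⊢wk : ∀ {n} {Γ : Ctx n} {A} → Γ ⊢ A type → Γ ▷ A ⊢ˢ wk ∶ Γ
  ⊢wk {Γ = Γ} {A} A! = ⊢tabulate wk (type⇒ctx A! ▷ A!) (type⇒ctx A!)
    (λ {i} x → castᵗ (sym (lookup∘tabulate (λ j → var (suc j)) i)) (var-rule (type⇒ctx A! ▷ A!) (there x)))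

  ⊢id : ∀ {n} {Γ : Ctx n} → Γ ctx → Γ ⊢ˢ id ∶ Γ
  ⊢id []        = [] []
  ⊢id (Γ! ▷ A!) = cons (⊢wk A!) A! (var-rule (Γ! ▷ A!) here)

  ⊢v0 : ∀ {n} {Γ : Ctx n} {A} → Γ ⊢ A type → Γ ▷ A ⊢ v0 ∶ A [ wk ]ᵀ
  ⊢v0 A! = var-rule (type⇒ctx A! ▷ A!) here

  wk-term : ∀ {n} {Γ : Ctx n} {A B b} → Γ ⊢ A type → Γ ⊢ b ∶ B → Γ ▷ A ⊢ b [ wk ] ∶ B [ wk ]ᵀ
  wk-term A! b! = sub-term (⊢wk A!) b!

  wk-type : ∀ {n} {Γ : Ctx n} {A B} → Γ ⊢ A type → Γ ⊢ B type → Γ ▷ A ⊢ B [ wk ]ᵀ type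
  wk-type A! B! = sub-type (⊢wk A!) B!

  ⊢∘wk : ∀ {m n} {Γ : Ctx m} {Δ : Ctx n} {A σ} → Γ ⊢ A type → Γ ⊢ˢ σ ∶ Δ → Γ ▷ A ⊢ˢ σ ∘ wk ∶ Δ
  ⊢∘wk A! σ! = ⊢∘ σ! (⊢wk A!)

  ⊢↑ : ∀ {m n} {Γ : Ctx m} {Δ : Ctx n} {A σ} → Γ ⊢ˢ σ ∶ Δ → Δ ⊢ A type →
       Γ ▷ A [ σ ]ᵀ ⊢ˢ σ ↑ ∶ Δ ▷ A
  ⊢↑ {A = A} {σ} σ! A! = cons (⊢∘wk A′ σ!) A! (cast ([]ᵀ-∘ A σ wk) (⊢v0 A′))
    where A′ = sub-type σ! A!

  ≐ˢ-refl : ∀ {m n} {Γ : Ctx m} {Δ : Ctx n} {σ} → Γ ⊢ˢ σ ∶ Δ → Γ ⊢ˢ σ ≐ σ ∶ Δ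
  ≐ˢ-refl ([] Γ!)        = [] Γ!
  ≐ˢ-refl (cons σ! A! a!) = cons (≐ˢ-refl σ!) A! (≐-refl a!)

  ≐ˢ-left : ∀ {m n} {Γ : Ctx m} {Δ : Ctx n} {σ τ} → Γ ⊢ˢ σ ≐ τ ∶ Δ → Γ ⊢ˢ σ ∶ Δ
  ≐ˢ-left ([] Γ!)         = [] Γ!
  ≐ˢ-left (cons στ A! ab) = cons (≐ˢ-left στ) A! (proj₁ (≐term⇒term ab))

  sub-cong : ∀ {m n} {Γ : Ctx m} {Δ : Ctx n} {A σ τ} → Γ ⊢ˢ σ ≐ τ ∶ Δ → Δ ⊢ A type →
             Γ ⊢ A [ σ ]ᵀ ≐ A [ τ ]ᵀ type
  sub-cong στ A! = sub-≐type στ (≐type-refl A!)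

  ≐ˢ-sym : ∀ {m n} {Γ : Ctx m} {Δ : Ctx n} {σ τ} → Γ ⊢ˢ σ ≐ τ ∶ Δ → Γ ⊢ˢ τ ≐ σ ∶ Δ
  ≐ˢ-sym ([] Γ!)         = [] Γ!
  ≐ˢ-sym (cons στ A! ab) = cons (≐ˢ-sym στ) A! (≐-conv (≐-sym ab) (sub-cong στ A!))

  ≐ˢ-right : ∀ {m n} {Γ : Ctx m} {Δ : Ctx n} {σ τ} → Γ ⊢ˢ σ ≐ τ ∶ Δ → Γ ⊢ˢ τ ∶ Δ
  ≐ˢ-right στ = ≐ˢ-left (≐ˢ-sym στ)

  ≐ˢ-trans : ∀ {m n} {Γ : Ctx m} {Δ : Ctx n} {σ τ υ} →
             Γ ⊢ˢ σ ≐ τ ∶ Δ → Γ ⊢ˢ τ ≐ υ ∶ Δ → Γ ⊢ˢ σ ≐ υ ∶ Δ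
  ≐ˢ-trans ([] Γ!)         ([] _)         = [] Γ!
  ≐ˢ-trans (cons στ A! ab) (cons τυ _ bc) =
    cons (≐ˢ-trans στ τυ) A! (≐-trans ab (≐-conv bc (sub-cong (≐ˢ-sym στ) A!)))

  ≡⇒≐ˢ : ∀ {m n} {Γ : Ctx m} {Δ : Ctx n} {σ τ} → σ ≡ τ → Γ ⊢ˢ σ ∶ Δ → Γ ⊢ˢ σ ≐ τ ∶ Δ
  ≡⇒≐ˢ refl = ≐ˢ-refl

  ∘-cong : ∀ {l m n} {Γ : Ctx l} {Δ : Ctx m} {Θ : Ctx n} {σ σ′ τ τ′} →
           Δ ⊢ˢ σ ≐ σ′ ∶ Θ → Γ ⊢ˢ τ ≐ τ′ ∶ Δ → Γ ⊢ˢ σ ∘ τ ≐ σ′ ∘ τ′ ∶ Θ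
  ∘-cong ([] _) ττ′ = [] (⊢dom (≐ˢ-left ττ′))
  ∘-cong {τ = τ} (cons {A = A} {σ} σσ′ A! ab) ττ′ =
    cons (∘-cong σσ′ ττ′) A! (cast≐ ([]ᵀ-∘ A σ τ) (sub-≐term ττ′ ab))

  ∘-congˡ : ∀ {l m n} {Γ : Ctx l} {Δ : Ctx m} {Θ : Ctx n} {σ σ′ τ} →
            Δ ⊢ˢ σ ≐ σ′ ∶ Θ → Γ ⊢ˢ τ ∶ Δ → Γ ⊢ˢ σ ∘ τ ≐ σ′ ∘ τ ∶ Θ
  ∘-congˡ σσ′ τ! = ∘-cong σσ′ (≐ˢ-refl τ!)

  ∘-congʳ : ∀ {l m n} {Γ : Ctx l} {Δ : Ctx m} {Θ : Ctx n} {σ τ τ′} →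
            Δ ⊢ˢ σ ∶ Θ → Γ ⊢ˢ τ ≐ τ′ ∶ Δ → Γ ⊢ˢ σ ∘ τ ≐ σ ∘ τ′ ∶ Θ
  ∘-congʳ σ! ττ′ = ∘-cong (≐ˢ-refl σ!) ττ′

  ⊢swap : ∀ {n} {Γ : Ctx n} {A B} → Γ ⊢ A ≐ B type → Γ ▷ A ⊢ˢ id ∶ Γ ▷ B
  ⊢swap AB = cons (⊢wk A!) B! (conv (⊢v0 A!) (sub-cong′ (⊢wk A!)))
    where
    A! = proj₁ (≐type⇒type AB)
    B! = proj₂ (≐type⇒type AB)
    sub-cong′ : ∀ {m} {Δ : Ctx m} {σ} → Δ ⊢ˢ σ ∶ _ → Δ ⊢ _ [ σ ]ᵀ ≐ _ [ σ ]ᵀ type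
    sub-cong′ σ! = sub-≐type (≐ˢ-refl σ!) AB

trip : ℕ → ℕ
trip zero    = zero
trip (suc n) = suc (suc (suc (trip n)))

module Paths {ℓ} (S : TypeTheory ℓ) (M : ML₂ S) where
  open TypeTheory S
  open ML₂ M
  open Substitution S

  -- e turns terms over X of a type pulled back along σ : X → Y into terms over Y
  -- (in the case of J, σ is the morphism x ↦ (x , x , r x)).
  record Elim {m n} (X : Ctx m) (Y : Ctx n) (σ : Sub m n) (e : Ty n → Tm m → Tm n) : Set ℓ where
    field
      ⊢along : X ⊢ˢ σ ∶ Y
      ⊢elim  : ∀ {C d} → Y ⊢ C type → X ⊢ d ∶ C [ σ ]ᵀ → Y ⊢ e C d ∶ C
      elim-β : ∀ {C d} → Y ⊢ C type → X ⊢ d ∶ C [ σ ]ᵀ → X ⊢ e C d [ σ ] ≐ d ∶ C [ σ ]ᵀ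

  open Elim

  -- Extended elimination, with one more type B in the post-context, obtained by
  -- Π-abstraction; iterating it gives any post-context.
  extend : ∀ {m n} → (Ty n → Tm m → Tm n) → Sub m n → Ty n → Ty (suc n) → Tm (suc m) → Tm (suc n)
  extend e σ B C d = app B C (e (Pi B C) (lam (B [ σ ]ᵀ) (C [ σ ↑ ]ᵀ) d))

  Elim-extend : ∀ {m n} {X : Ctx m} {Y : Ctx n} {σ e B} → Y ⊢ B type → Elim X Y σ e →
                Elim (X ▷ B [ σ ]ᵀ) (Y ▷ B) (σ ↑) (extend e σ B)
  Elim-extend {X = X} {Y} {σ} {e} {B} B! 𝓔 = record
    { ⊢along = ⊢↑ (⊢along 𝓔) B!
    ; ⊢elim  = λ C! d! → Pi-elim C! (⊢elim 𝓔 (Pi-form C!) (⊢lam d!))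
    ; elim-β = β
    }
    where
    ⊢lam : ∀ {C d} → X ▷ B [ σ ]ᵀ ⊢ d ∶ C [ σ ↑ ]ᵀ →
           X ⊢ lam (B [ σ ]ᵀ) (C [ σ ↑ ]ᵀ) d ∶ Pi B C [ σ ]ᵀ
    ⊢lam {C} d! = cast (sym (Pi-[] B C σ)) (Pi-intro d!)
    β : ∀ {C d} → Y ▷ B ⊢ C type → X ▷ B [ σ ]ᵀ ⊢ d ∶ C [ σ ↑ ]ᵀ →
        X ▷ B [ σ ]ᵀ ⊢ extend e σ B C d [ σ ↑ ] ≐ d ∶ C [ σ ↑ ]ᵀ
    β {C} {d} C! d! = cast≐ᵗ (sym (app-[] B C _ σ)) refl
      (≐-trans (app-cong (≐type-refl (sub-type (⊢along 𝓔) B!))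
                         (≐type-refl (sub-type (⊢↑ (⊢along 𝓔) B!) C!))
                         (cast≐ (Pi-[] B C σ) (elim-β 𝓔 (Pi-form C!) (⊢lam d!))))
               (Pi-comp d!))

  Elim-swap : ∀ {m n} {X : Ctx m} {A B} {Y : Ctx n} {σ e} → X ⊢ A ≐ B type →
              Elim (X ▷ A) Y σ e → Elim (X ▷ B) Y σ e
  Elim-swap {σ = σ} AB 𝓔 = record
    { ⊢along = castˢ (∘-id _) (⊢∘ (⊢along 𝓔) to)
    ; ⊢elim  = λ C! d! → ⊢elim 𝓔 C! (back d!)
    ; elim-β = λ C! d! → cast≐ ([]ᵀ-id _) (cast≐ᵗ ([]-id _) ([]-id _)
                 (sub-≐term (≐ˢ-refl to) (elim-β 𝓔 C! (back d!))))
    }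
    where
    to = ⊢swap (≐type-sym AB)
    back : ∀ {d C} → _ ⊢ d ∶ C → _ ⊢ d ∶ C
    back d! = cast ([]ᵀ-id _) (castᵗ ([]-id _) (sub-term (⊢swap AB) d!))

  Elim-∘ : ∀ {k m n} {X : Ctx k} {Y : Ctx m} {Z : Ctx n} {σ τ e f} →
           Elim X Y σ e → Elim Y Z τ f → Elim X Z (τ ∘ σ) (λ C d → f C (e (C [ τ ]ᵀ) d))
  Elim-∘ {σ = σ} {τ} 𝓔 𝓕 = record
    { ⊢along = ⊢∘ (⊢along 𝓕) (⊢along 𝓔)
    ; ⊢elim  = λ C! d! → ⊢elim 𝓕 C! (⊢elim 𝓔 (C!′ C!) (d!′ d!))
    ; elim-β = λ {C} C! d! →
        cast≐ ([]ᵀ-∘ C τ σ) (cast≐ᵗ ([]-∘ _ τ σ) refl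
          (≐-trans (sub-≐term (≐ˢ-refl (⊢along 𝓔)) (elim-β 𝓕 C! (⊢elim 𝓔 (C!′ C!) (d!′ d!))))
                   (elim-β 𝓔 (C!′ C!) (d!′ d!))))
    }
    where
    C!′ : ∀ {C} → _ ⊢ C type → _ ⊢ C [ τ ]ᵀ type
    C!′ = sub-type (⊢along 𝓕)
    d!′ : ∀ {C d} → _ ⊢ d ∶ C [ τ ∘ σ ]ᵀ → _ ⊢ d ∶ C [ τ ]ᵀ [ σ ]ᵀ
    d!′ {C} = cast (sym ([]ᵀ-∘ C τ σ))

  Elim-J : ∀ {n} {Γ : Ctx n} {A} → Γ ⊢ A type → Elim (Γ ▷ A) (Γ ▷Id A) (diag A) (J A)
  Elim-J {Γ = Γ} {A} A! = record
    { ⊢along = cons (cons (cons (⊢wk A!) A! (⊢v0 A!)) A₁ (cast (sym ([]ᵀ≡ A (wk-∷ _ _))) (⊢v0 A!)))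
                    Id! (cast eq (Id-intro (⊢v0 A!)))
    ; ⊢elim  = Id-elim
    ; elim-β = Id-comp
    }
    where
    A₁ : Γ ▷ A ⊢ A [ wk ]ᵀ type
    A₁ = wk-type A! A!
    Id! : Γ ▷ A ▷ A [ wk ]ᵀ ⊢ Id (A [ wk² ]ᵀ) v1 v0 type
    Id! = Id-form (castᵗ (trans (var-[] zero wk) refl)
                         (cast ([]ᵀ-∘ A wk wk) (wk-term A₁ (⊢v0 A!))))
                  (cast ([]ᵀ-∘ A wk wk) (⊢v0 A₁))
    eq : Id (A [ wk ]ᵀ) v0 v0 ≡ Id (A [ wk² ]ᵀ) v1 v0 [ v0 ∷ v0 ∷ wk ]ᵀ
    eq = sym (trans (Id-[] _ _ _ _)
      (cong₃ Id ([]ᵀ≡ A (trans (∘wk-∷ wk _ _) (wk-∷ _ _))) (var-[] _ _) (var-[] _ _)))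
      where
      cong₃ : ∀ {A : Set ℓ} {B : Set ℓ} {C : Set ℓ} {D : Set ℓ} (f : A → B → C → D) {x x′ y y′ z z′} →
              x ≡ x′ → y ≡ y′ → z ≡ z′ → f x y z ≡ f x′ y′ z′
      cong₃ f refl refl refl = refl

  src tgt : ∀ n → Sub (trip n) n
  src zero    = []
  src (suc n) = v2 ∷ src n ∘ wk³
  tgt zero    = []
  tgt (suc n) = v1 ∷ tgt n ∘ wk³

  rfl : ∀ {n} → Ctx n → Sub n (trip n)
  rfl []      = []
  rfl (Φ ▷ A) = r (A [ wk ]ᵀ) v0 ∷ v0 ∷ v0 ∷ rfl Φ ∘ wk

  -- IdCtx Φ is the context x, y : Φ, p : Id_Φ (x , y), with its variables listed
  -- in the order x₁ , y₁ , p₁ , x₂ , y₂ , p₂ , …; src and tgt project out x and y,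
  -- and rfl is x ↦ (x , x , r x).
  -- tr Φ A is z ↦ p* z, and IdTy Φ A is the type Id (y , p* y′) of identifications
  -- between y : A x and y′ : A x′ over p : Id_Φ (x , x′).
  -- jay Φ is the elimination rule for Id_Φ: first eliminate along J A, then along
  -- jay Φ with post-context y , y′ , q.
  IdCtx : ∀ {n} → Ctx n → Ctx (trip n)
  jay   : ∀ {n} → Ctx n → Ty (trip n) → Tm n → Tm (trip n)
  tr    : ∀ {n} → Ctx n → Ty n → Tm (suc (trip n))
  IdTy  : ∀ {n} → Ctx n → Ty n → Ty (suc (suc (trip n)))

  IdCtx []          = []
  IdCtx (Φ ▷ A) = IdCtx Φ ▷ A [ src _ ]ᵀ ▷ A [ tgt _ ∘ wk ]ᵀ ▷ IdTy Φ A

  IdTy Φ A = Id (A [ src _ ∘ wk² ]ᵀ) v1 (tr Φ A [ v0 ∷ wk² ])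

  tr Φ A = extend (jay Φ) (rfl Φ) (A [ tgt _ ]ᵀ) (A [ src _ ∘ wk ]ᵀ) v0

  jay []      C d = d
  jay (Φ ▷ A) C d =
    extend (extend (extend (jay Φ) (rfl Φ) (A [ src _ ]ᵀ))
                   (rfl Φ ↑) (A [ tgt _ ∘ wk ]ᵀ))
           (rfl Φ ↑ ↑) (IdTy Φ A)
           C (J A (C [ rfl Φ ↑ ↑ ↑ ]ᵀ) d)

  wk²-∷ : ∀ {m n} (b a : Tm m) (σ : Sub m n) → wk² ∘ (b ∷ a ∷ σ) ≡ σ
  wk²-∷ b a σ = trans (∘wk-∷ wk b (a ∷ σ)) (wk-∷ a σ)

  wk³-∷ : ∀ {m n} (c b a : Tm m) (σ : Sub m n) → wk³ ∘ (c ∷ b ∷ a ∷ σ) ≡ σ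
  wk³-∷ c b a σ = trans (∘wk-∷ wk² c _) (wk²-∷ b a σ)

  ∘wk²-∷ : ∀ {l m n} (τ : Sub m n) (b a : Tm l) (σ : Sub l m) → τ ∘ wk² ∘ (b ∷ a ∷ σ) ≡ τ ∘ σ
  ∘wk²-∷ τ b a σ = trans (∘-assoc τ wk² _) (cong (τ ∘_) (wk²-∷ b a σ))

  ∘wk³-∷ : ∀ {l m n} (τ : Sub m n) (c b a : Tm l) (σ : Sub l m) →
           τ ∘ wk³ ∘ (c ∷ b ∷ a ∷ σ) ≡ τ ∘ σ
  ∘wk³-∷ τ c b a σ = trans (∘-assoc τ wk³ _) (cong (τ ∘_) (wk³-∷ c b a σ))

  src-∷ : ∀ {m} n (q b a : Tm m) (γ : Sub m (trip n)) →
          src (suc n) ∘ (q ∷ b ∷ a ∷ γ) ≡ a ∷ src n ∘ γ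
  src-∷ n q b a γ = cong₂ _∷_ (var-[] _ _) (∘wk³-∷ (src n) q b a γ)

  tgt-∷ : ∀ {m} n (q b a : Tm m) (γ : Sub m (trip n)) →
          tgt (suc n) ∘ (q ∷ b ∷ a ∷ γ) ≡ b ∷ tgt n ∘ γ
  tgt-∷ n q b a γ = cong₂ _∷_ (var-[] _ _) (∘wk³-∷ (tgt n) q b a γ)

  src-rfl : ∀ {n} (Φ : Ctx n) → src n ∘ rfl Φ ≡ id
  src-rfl []      = refl
  src-rfl {suc n} (Φ ▷ A) = trans (src-∷ n _ _ _ _) (cong (v0 ∷_)
    (trans (sym (∘-assoc (src n) (rfl Φ) wk)) (trans (cong (_∘ wk) (src-rfl Φ)) (id-∘ wk))))

  tgt-rfl : ∀ {n} (Φ : Ctx n) → tgt n ∘ rfl Φ ≡ id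
  tgt-rfl []      = refl
  tgt-rfl {suc n} (Φ ▷ A) = trans (tgt-∷ n _ _ _ _) (cong (v0 ∷_)
    (trans (sym (∘-assoc (tgt n) (rfl Φ) wk)) (trans (cong (_∘ wk) (tgt-rfl Φ)) (id-∘ wk))))

  Id≡ : ∀ {n} {A A′ : Ty n} {a a′ b b′} → A ≡ A′ → a ≡ a′ → b ≡ b′ → Id A a b ≡ Id A′ a′ b′
  Id≡ refl refl refl = refl

  IdTy-∷ : ∀ {m n} (Φ : Ctx n) A (b a : Tm m) γ →
           IdTy Φ A [ b ∷ a ∷ γ ]ᵀ ≡ Id (A [ src n ∘ γ ]ᵀ) a (tr Φ A [ b ∷ γ ])
  IdTy-∷ {n = n} Φ A b a γ = trans (Id-[] _ _ _ _)
    (Id≡ ([]ᵀ≡ A (∘wk²-∷ (src n) b a γ)) (var-[] _ _)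
         ([]≡ (tr Φ A) (cong₂ _∷_ (var-[] _ _) (wk²-∷ b a γ))))

  record WellFormed {n} (Φ : Ctx n) : Set ℓ where
    field
      Φ!      : Φ ctx
      IdCtx!  : IdCtx Φ ctx
      ⊢src    : IdCtx Φ ⊢ˢ src n ∶ Φ
      ⊢tgt    : IdCtx Φ ⊢ˢ tgt n ∶ Φ
      Elim-Id : Elim Φ (IdCtx Φ) (rfl Φ) (jay Φ)

    ⊢rfl : Φ ⊢ˢ rfl Φ ∶ IdCtx Φ
    ⊢rfl = ⊢along Elim-Id

  open WellFormed

  module Transport {n} {Φ : Ctx n} (W : WellFormed Φ) {A} (A! : Φ ⊢ A type) where

    private
      Asrc! : IdCtx Φ ⊢ A [ src n ]ᵀ type
      Asrc! = sub-type (⊢src W) A!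
      Atgt! : IdCtx Φ ⊢ A [ tgt n ]ᵀ type
      Atgt! = sub-type (⊢tgt W) A!
      C! : IdCtx Φ ▷ A [ tgt n ]ᵀ ⊢ A [ src n ∘ wk ]ᵀ type
      C! = subst (IdCtx Φ ▷ A [ tgt n ]ᵀ ⊢_type) ([]ᵀ-∘ A (src n) wk) (wk-type Atgt! Asrc!)
      eqA : A [ tgt n ]ᵀ [ rfl Φ ]ᵀ ≡ A
      eqA = trans ([]ᵀ≡ A (tgt-rfl Φ)) ([]ᵀ-id A)
      eqC : A [ src n ∘ wk ]ᵀ [ rfl Φ ↑ ]ᵀ ≡ A [ wk ]ᵀ
      eqC = []ᵀ≡ A (trans (∘wk-∷ (src n) v0 (rfl Φ ∘ wk))
                  (trans (sym (∘-assoc (src n) (rfl Φ) wk))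
                  (trans (cong (_∘ wk) (src-rfl Φ)) (id-∘ wk))))
      d! : Φ ▷ A [ tgt n ]ᵀ [ rfl Φ ]ᵀ ⊢ v0 ∶ A [ src n ∘ wk ]ᵀ [ rfl Φ ↑ ]ᵀ
      d! = cast (sym eqC) (subst (λ B → Φ ▷ B ⊢ v0 ∶ A [ wk ]ᵀ) (sym eqA) (⊢v0 A!))
      𝓔 = Elim-extend Atgt! (Elim-Id W)

    ⊢tr₀ : IdCtx Φ ▷ A [ tgt n ]ᵀ ⊢ tr Φ A ∶ A [ src n ∘ wk ]ᵀ
    ⊢tr₀ = ⊢elim 𝓔 C! d!

    tr-β₀ : Φ ▷ A ⊢ tr Φ A [ rfl Φ ↑ ] ≐ v0 ∶ A [ wk ]ᵀ
    tr-β₀ = subst (λ B → Φ ▷ B ⊢ tr Φ A [ rfl Φ ↑ ] ≐ v0 ∶ A [ wk ]ᵀ) eqA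
              (cast≐ eqC (elim-β 𝓔 C! d!))

    tr-cong : ∀ {m} {Γ : Ctx m} {b b′ γ γ′} → Γ ⊢ˢ γ ≐ γ′ ∶ IdCtx Φ →
              Γ ⊢ b ≐ b′ ∶ A [ tgt n ∘ γ ]ᵀ →
              Γ ⊢ tr Φ A [ b ∷ γ ] ≐ tr Φ A [ b′ ∷ γ′ ] ∶ A [ src n ∘ γ ]ᵀ
    tr-cong {b = b} {γ = γ} γγ′ bb′ = cast≐ ([]ᵀ≡ A (∘wk-∷ (src n) b γ))
      (sub-≐term (cons γγ′ Atgt! (cast≐ (sym ([]ᵀ-∘ A (tgt n) γ)) bb′)) (≐-refl ⊢tr₀))

    ⊢tr : ∀ {m} {Γ : Ctx m} {b γ} → Γ ⊢ˢ γ ∶ IdCtx Φ → Γ ⊢ b ∶ A [ tgt n ∘ γ ]ᵀ →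
          Γ ⊢ tr Φ A [ b ∷ γ ] ∶ A [ src n ∘ γ ]ᵀ
    ⊢tr γ! b! = proj₁ (≐term⇒term (tr-cong (≐ˢ-refl γ!) (≐-refl b!)))

    tr-β : ∀ {m} {Γ : Ctx m} {b σ} → Γ ⊢ˢ σ ∶ Φ → Γ ⊢ b ∶ A [ σ ]ᵀ →
           Γ ⊢ tr Φ A [ b ∷ rfl Φ ∘ σ ] ≐ b ∶ A [ σ ]ᵀ
    tr-β {b = b} {σ} σ! b! =
      cast≐ ([]ᵀ≡ A (wk-∷ b σ))
        (cast≐ᵗ ([]≡ (tr Φ A) (↑-∷ (rfl Φ) b σ)) (var-[] zero (b ∷ σ))
          (sub-≐term (≐ˢ-refl (cons σ! A! b!)) tr-β₀))

    ⊢IdTy : IdCtx Φ ▷ A [ src n ]ᵀ ▷ A [ tgt n ∘ wk ]ᵀ ⊢ IdTy Φ A type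
    ⊢IdTy = Id-form
      (cast ([]ᵀ≡ A (∘-assoc (src n) wk wk)) (cast (cong _[ wk ]ᵀ ([]ᵀ-∘ A (src n) wk))
        (castᵗ (var-[] zero wk) (wk-term Atgt′! (⊢v0 Asrc!)))))
      (⊢tr (⊢∘ (⊢wk Asrc!) (⊢wk Atgt′!))
           (cast ([]ᵀ≡ A (∘-assoc (tgt n) wk wk)) (⊢v0 Atgt′!)))
      where
      Atgt′! : IdCtx Φ ▷ A [ src n ]ᵀ ⊢ A [ tgt n ∘ wk ]ᵀ type
      Atgt′! = sub-type (⊢∘ (⊢tgt W) (⊢wk Asrc!)) A!

    IdCtx▷! : IdCtx (Φ ▷ A) ctx
    IdCtx▷! = type⇒ctx ⊢IdTy ▷ ⊢IdTy

    module _ {m} {Γ : Ctx m} where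
      ⊢path : ∀ {γ a b q} → Γ ⊢ˢ γ ∶ IdCtx Φ → Γ ⊢ a ∶ A [ src n ∘ γ ]ᵀ →
              Γ ⊢ b ∶ A [ tgt n ∘ γ ]ᵀ →
              Γ ⊢ q ∶ Id (A [ src n ∘ γ ]ᵀ) a (tr Φ A [ b ∷ γ ]) →
              Γ ⊢ˢ q ∷ b ∷ a ∷ γ ∶ IdCtx (Φ ▷ A)
      ⊢path {γ} {a} {b} γ! a! b! q! =
        cons (cons (cons γ! Asrc! (cast (sym ([]ᵀ-∘ A (src n) γ)) a!))
                   (▷type (type⇒ctx ⊢IdTy)) (cast (sym ([]ᵀ≡ A (∘wk-∷ (tgt n) a γ))) b!))
             ⊢IdTy (cast (sym (IdTy-∷ Φ A b a γ)) q!)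

      path-cong : ∀ {γ a b q γ′ a′ b′ q′} → Γ ⊢ˢ γ ≐ γ′ ∶ IdCtx Φ →
              Γ ⊢ a ≐ a′ ∶ A [ src n ∘ γ ]ᵀ → Γ ⊢ b ≐ b′ ∶ A [ tgt n ∘ γ ]ᵀ →
              Γ ⊢ q ≐ q′ ∶ Id (A [ src n ∘ γ ]ᵀ) a (tr Φ A [ b ∷ γ ]) →
              Γ ⊢ˢ q ∷ b ∷ a ∷ γ ≐ q′ ∷ b′ ∷ a′ ∷ γ′ ∶ IdCtx (Φ ▷ A)
      path-cong {γ} {a} {b} γ! a! b! q! =
        cons (cons (cons γ! Asrc! (cast≐ (sym ([]ᵀ-∘ A (src n) γ)) a!))
                   (▷type (type⇒ctx ⊢IdTy)) (cast≐ (sym ([]ᵀ≡ A (∘wk-∷ (tgt n) a γ))) b!))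
             ⊢IdTy (cast≐ (sym (IdTy-∷ Φ A b a γ)) q!)

      unpath : ∀ {γ a b q} → Γ ⊢ˢ q ∷ b ∷ a ∷ γ ∶ IdCtx (Φ ▷ A) →
               Γ ⊢ˢ γ ∶ IdCtx Φ × Γ ⊢ a ∶ A [ src n ∘ γ ]ᵀ ×
               Γ ⊢ b ∶ A [ tgt n ∘ γ ]ᵀ ×
               Γ ⊢ q ∶ Id (A [ src n ∘ γ ]ᵀ) a (tr Φ A [ b ∷ γ ])
      unpath {γ} {a} {b} (cons (cons (cons γ! _ a!) _ b!) _ q!) =
        γ! , cast ([]ᵀ-∘ A (src n) γ) a! , cast ([]ᵀ≡ A (∘wk-∷ (tgt n) a γ)) b! ,
        cast (IdTy-∷ Φ A b a γ) q!

      unpath-cong : ∀ {γ a b q γ′ a′ b′ q′} →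
               Γ ⊢ˢ q ∷ b ∷ a ∷ γ ≐ q′ ∷ b′ ∷ a′ ∷ γ′ ∶ IdCtx (Φ ▷ A) →
               Γ ⊢ˢ γ ≐ γ′ ∶ IdCtx Φ × Γ ⊢ a ≐ a′ ∶ A [ src n ∘ γ ]ᵀ ×
               Γ ⊢ b ≐ b′ ∶ A [ tgt n ∘ γ ]ᵀ ×
               Γ ⊢ q ≐ q′ ∶ Id (A [ src n ∘ γ ]ᵀ) a (tr Φ A [ b ∷ γ ])
      unpath-cong {γ} {a} {b} (cons (cons (cons γ! _ a!) _ b!) _ q!) =
        γ! , cast≐ ([]ᵀ-∘ A (src n) γ) a! , cast≐ ([]ᵀ≡ A (∘wk-∷ (tgt n) a γ)) b! ,
        cast≐ (IdTy-∷ Φ A b a γ) q!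

  ⊢∘wk³ : ∀ {l m} {Γ : Ctx l} {Δ : Ctx m} {A B C} {σ : Sub l m} →
          Γ ▷ A ▷ B ▷ C ctx → Γ ⊢ˢ σ ∶ Δ → Γ ▷ A ▷ B ▷ C ⊢ˢ σ ∘ wk³ ∶ Δ
  ⊢∘wk³ (_ ▷ A! ▷ B! ▷ C!) σ! = ⊢∘ σ! (⊢∘ (⊢∘ (⊢wk A!) (⊢wk B!)) (⊢wk C!))

  id-wk³ : ∀ {n} → id {suc (suc (suc n))} ≡ v0 ∷ v1 ∷ v2 ∷ wk³
  id-wk³ = cong (λ σ → v0 ∷ v1 ∷ v2 ∷ σ) (trans (sym (wk³-∷ v0 v1 v2 _)) (∘-id wk³))

  WellFormed-▷ : ∀ {n} {Φ : Ctx n} {A} → WellFormed Φ → Φ ⊢ A type → WellFormed (Φ ▷ A)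
  WellFormed-▷ {n} {Φ} {A} W A! = record
    { Φ!      = Φ! W ▷ A!
    ; IdCtx!  = IdCtx▷!
    ; ⊢src    = cons (⊢∘wk³ IdCtx▷! (⊢src W)) A! (p .proj₂ .proj₁)
    ; ⊢tgt    = cons (⊢∘wk³ IdCtx▷! (⊢tgt W)) A! (p .proj₂ .proj₂ .proj₁)
    ; Elim-Id = record
      { ⊢along = castˢ along-eq (⊢along 𝓔)
      ; ⊢elim  = λ {C} C! d! → ⊢elim 𝓔 C! (cast (cong (C [_]ᵀ) (sym along-eq)) d!)
      ; elim-β = λ {C} {d} C! d! →
          subst (λ σ → Φ ▷ A ⊢ jay (Φ ▷ A) C d [ σ ] ≐ d ∶ C [ σ ]ᵀ) along-eq
            (elim-β 𝓔 C! (cast (cong (C [_]ᵀ) (sym along-eq)) d!))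
      }
    }
    where
    open Transport W A!
    p = unpath (castˢ id-wk³ (⊢id IdCtx▷!))
    ρ = rfl Φ
    src-wk : ∀ {m} (τ : Sub m n) → src n ∘ (ρ ∘ τ) ≡ τ
    src-wk τ = trans (sym (∘-assoc (src n) ρ τ)) (trans (cong (_∘ τ) (src-rfl Φ)) (id-∘ τ))
    tgt-wk : ∀ {m} (τ : Sub m n) → tgt n ∘ (ρ ∘ τ) ≡ τ
    tgt-wk τ = trans (sym (∘-assoc (tgt n) ρ τ)) (trans (cong (_∘ τ) (tgt-rfl Φ)) (id-∘ τ))
    along-eq : ρ ↑ ↑ ↑ ∘ diag A ≡ rfl (Φ ▷ A)
    along-eq = trans (↑-∷ (ρ ↑ ↑) _ _) (cong (r (A [ wk ]ᵀ) v0 ∷_)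
              (trans (↑-∷ (ρ ↑) _ _) (cong (v0 ∷_) (↑-∷ ρ v0 wk))))
    A₁ : A [ src n ]ᵀ [ ρ ]ᵀ ≡ A
    A₁ = trans ([]ᵀ≡ A (src-rfl Φ)) ([]ᵀ-id A)
    A₂ : A [ tgt n ∘ wk ]ᵀ [ ρ ↑ ]ᵀ ≡ A [ wk ]ᵀ
    A₂ = []ᵀ≡ A (trans (∘wk-∷ (tgt n) v0 (ρ ∘ wk)) (tgt-wk wk))
    A!₁ = wk-type A! A!
    last : Φ ▷ A ▷ A [ wk ]ᵀ ⊢ IdTy Φ A [ ρ ↑ ↑ ]ᵀ ≐ Id (A [ wk² ]ᵀ) v1 v0 type
    last = subst (Φ ▷ A ▷ A [ wk ]ᵀ ⊢_≐ Id (A [ wk² ]ᵀ) v1 v0 type)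
        (sym (trans (cong (IdTy Φ A [_]ᵀ) ↑↑-eq)
             (trans (IdTy-∷ Φ A v0 v1 (ρ ∘ wk²)) (Id≡ (cong (A [_]ᵀ) (src-wk wk²)) refl refl))))
        (Id-cong (≐type-refl (sub-type wk²! A!)) (≐-refl v1!)
          (tr-β wk²! (cast ([]ᵀ-∘ A wk wk) (⊢v0 A!₁))))
      where
      wk²! = ⊢∘ (⊢wk A!) (⊢wk A!₁)
      v1! : Φ ▷ A ▷ A [ wk ]ᵀ ⊢ v1 ∶ A [ wk² ]ᵀ
      v1! = castᵗ (var-[] zero wk) (cast ([]ᵀ-∘ A wk wk) (wk-term A!₁ (⊢v0 A!)))
      ↑↑-eq : ρ ↑ ↑ ≡ v0 ∷ v1 ∷ ρ ∘ wk²
      ↑↑-eq = cong (v0 ∷_) (cong₂ _∷_ (var-[] zero wk) (∘-assoc ρ wk wk))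
    e₃ : Ty (trip (suc n)) → Tm (suc (suc (suc n))) → Tm (trip (suc n))
    e₃ = extend (extend (extend (jay Φ) ρ (A [ src n ]ᵀ)) (ρ ↑) (A [ tgt n ∘ wk ]ᵀ)) (ρ ↑ ↑) (IdTy Φ A)
    𝓔₃ : Elim (Φ ▷Id A) (IdCtx (Φ ▷ A)) (ρ ↑ ↑ ↑) e₃
    𝓔₃ = Elim-swap last
      (subst (λ X → Elim (X ▷ IdTy Φ A [ ρ ↑ ↑ ]ᵀ) (IdCtx (Φ ▷ A)) (ρ ↑ ↑ ↑) e₃)
        (cong₂ (λ B C → Φ ▷ B ▷ C) A₁ A₂)
        (Elim-extend ⊢IdTy (Elim-extend (▷type (type⇒ctx ⊢IdTy))
          (Elim-extend (sub-type (⊢src W) A!) (Elim-Id W)))))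
    𝓔 = Elim-∘ (Elim-J A!) 𝓔₃

  wellFormed : ∀ {n} {Φ : Ctx n} → Φ ctx → WellFormed Φ
  wellFormed []        = record
    { Φ! = [] ; IdCtx! = [] ; ⊢src = [] [] ; ⊢tgt = [] []
    ; Elim-Id = record
      { ⊢along = [] []
      ; ⊢elim  = λ {C} _ d! → cast ([]ᵀ-id C) d!
      ; elim-β = λ {C} {d} _ d! → cast≐ᵗ (sym ([]-id d)) refl (≐-refl d!) } }
  wellFormed (Φ! ▷ A!) = WellFormed-▷ (wellFormed Φ!) A!

dbl : ℕ → ℕ → ℕ
dbl zero    m = m
dbl (suc n) m = suc (suc (dbl n m))

module Cells {ℓ} (S : TypeTheory ℓ) (M : ML₂ S) where
  open TypeTheory S
  open ML₂ M
  open Substitution S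
  open Paths S M
  open Elim
  open WellFormed

  -- (f , g , α) as a morphism into IdCtx; pth recovers α.
  inter : ∀ {m n} → Sub m n → Sub m n → Vec (Tm m) n → Sub m (trip n)
  inter []      []      []      = []
  inter (a ∷ f) (b ∷ g) (q ∷ α) = q ∷ b ∷ a ∷ inter f g α

  pth : ∀ {m} n → Sub m (trip n) → Vec (Tm m) n
  pth zero    []              = []
  pth (suc n) (q ∷ b ∷ a ∷ γ) = q ∷ pth n γ

  src-inter : ∀ {m n} (f g : Sub m n) α → src n ∘ inter f g α ≡ f
  src-inter []      []      []      = refl
  src-inter {n = suc n} (a ∷ f) (b ∷ g) (q ∷ α) =
    trans (src-∷ n q b a (inter f g α)) (cong (a ∷_) (src-inter f g α))

  tgt-inter : ∀ {m n} (f g : Sub m n) α → tgt n ∘ inter f g α ≡ g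
  tgt-inter []      []      []      = refl
  tgt-inter {n = suc n} (a ∷ f) (b ∷ g) (q ∷ α) =
    trans (tgt-∷ n q b a (inter f g α)) (cong (b ∷_) (tgt-inter f g α))

  inter-pth : ∀ {m} n (γ : Sub m (trip n)) → inter (src n ∘ γ) (tgt n ∘ γ) (pth n γ) ≡ γ
  inter-pth zero    []              = refl
  inter-pth (suc n) (q ∷ b ∷ a ∷ γ) =
    trans (cong₂ (λ f g → inter f g (q ∷ pth n γ)) (src-∷ n q b a γ) (tgt-∷ n q b a γ))
          (cong (λ δ → q ∷ b ∷ a ∷ δ) (inter-pth n γ))

  inter-∘ : ∀ {l m n} (f g : Sub m n) α (τ : Sub l m) →
            inter f g α ∘ τ ≡ inter (f ∘ τ) (g ∘ τ) (map (_[ τ ]) α)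
  inter-∘ []      []      []      τ = refl
  inter-∘ (a ∷ f) (b ∷ g) (q ∷ α) τ = cong (λ δ → q [ τ ] ∷ b [ τ ] ∷ a [ τ ] ∷ δ) (inter-∘ f g α τ)

  cons⁻ : ∀ {m n} {Γ : Ctx m} {Δ : Ctx n} {A a b σ τ} → Γ ⊢ˢ a ∷ σ ≐ b ∷ τ ∶ Δ ▷ A →
          Γ ⊢ˢ σ ≐ τ ∶ Δ × Γ ⊢ a ≐ b ∶ A [ σ ]ᵀ
  cons⁻ (cons στ _ ab) = στ , ab

  respan : ∀ {m n} {Γ : Ctx m} {Δ : Ctx n} → Δ ctx → ∀ {γ f g} → Γ ⊢ˢ γ ∶ IdCtx Δ →
           Γ ⊢ˢ src n ∘ γ ≐ f ∶ Δ → Γ ⊢ˢ tgt n ∘ γ ≐ g ∶ Δ →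
           Γ ⊢ˢ γ ≐ inter f g (pth n γ) ∶ IdCtx Δ
  respan [] {[]} {[]} {[]} γ! _ _ = ≐ˢ-refl γ!
  respan {n = suc n} (Δ! ▷ A!) {q ∷ b ∷ a ∷ γ} {a′ ∷ f} {b′ ∷ g} γ! s t =
    path-cong (respan Δ! γ₀! (proj₁ s′) (proj₁ t′)) (proj₂ s′) (proj₂ t′) (≐-refl q!)
    where
    open Transport (wellFormed Δ!) A!
    s′ = cons⁻ (cast≐ˢ (src-∷ n q b a γ) refl s)
    t′ = cons⁻ (cast≐ˢ (tgt-∷ n q b a γ) refl t)
    γ₀! = unpath γ! .proj₁
    q! = unpath γ! .proj₂ .proj₂ .proj₂

  -- Elimination into the context Id_Δ (f , g), component by component.
  fill : ∀ {l m n} → (Ty m → Tm l → Tm m) → Ctx n → Sub m n → Sub m n → Vec (Tm l) n → Vec (Tm m) n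
  fill e []      []      []      []      = []
  fill e (Δ ▷ A) (a ∷ f) (b ∷ g) (q ∷ α) =
    e (Id (A [ f ]ᵀ) a (tr Δ A [ b ∷ inter f g (fill e Δ f g α) ])) q ∷ fill e Δ f g α

  ⊢fill-β : ∀ {l m n} {X : Ctx l} {Y : Ctx m} {σ e} → Elim X Y σ e → ∀ {Δ : Ctx n} → Δ ctx →
            ∀ {f g α} → Y ⊢ˢ f ∶ Δ → Y ⊢ˢ g ∶ Δ → X ⊢ˢ inter (f ∘ σ) (g ∘ σ) α ∶ IdCtx Δ →
            Y ⊢ˢ inter f g (fill e Δ f g α) ∶ IdCtx Δ ×
            X ⊢ˢ inter f g (fill e Δ f g α) ∘ σ ≐ inter (f ∘ σ) (g ∘ σ) α ∶ IdCtx Δ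
  ⊢fill-β 𝓔 [] {[]} {[]} {[]} f! g! α! = [] (⊢cod (⊢along 𝓔)) , [] (⊢dom (⊢along 𝓔))
  ⊢fill-β {X = X} {Y} {σ} {e} 𝓔 {Δ ▷ A} (Δ! ▷ A!) {a ∷ f} {b ∷ g} {q ∷ α} (cons f! _ a!) (cons g! _ b!) α! =
    ⊢path γ! a!′ b!′ (cast (Id≡ srcA refl refl) (⊢elim 𝓔 C! q!)) ,
    path-cong γσ (≐-refl (cast eqS (sub-term (⊢along 𝓔) a!)))
                 (≐-refl (cast eqT (sub-term (⊢along 𝓔) b!)))
                 (cast≐ (trans C[σ] (Id≡ (cong (A [_]ᵀ) (sym sγσ)) refl refl)) (elim-β 𝓔 C! q!))
    where
    open Transport (wellFormed Δ!) A!
    φ = fill e Δ f g α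
    γ = inter f g φ
    δ! = unpath α! .proj₁
    ih = ⊢fill-β 𝓔 Δ! f! g! δ!
    γ! = ih .proj₁
    γσ = ih .proj₂
    srcA : A [ f ]ᵀ ≡ A [ src _ ∘ γ ]ᵀ
    srcA = cong (A [_]ᵀ) (sym (src-inter f g φ))
    a!′ = cast srcA a!
    b!′ : Y ⊢ b ∶ A [ tgt _ ∘ γ ]ᵀ
    b!′ = cast (cong (A [_]ᵀ) (sym (tgt-inter f g φ))) b!
    C = Id (A [ f ]ᵀ) a (tr Δ A [ b ∷ γ ])
    C! : Y ⊢ C type
    C! = Id-form a! (cast (sym srcA) (⊢tr γ! b!′))
    sγσ : src _ ∘ (γ ∘ σ) ≡ f ∘ σ
    sγσ = trans (sym (∘-assoc (src _) γ σ)) (cong (_∘ σ) (src-inter f g φ))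
    tγσ : tgt _ ∘ (γ ∘ σ) ≡ g ∘ σ
    tγσ = trans (sym (∘-assoc (tgt _) γ σ)) (cong (_∘ σ) (tgt-inter f g φ))
    eqS : A [ f ]ᵀ [ σ ]ᵀ ≡ A [ src _ ∘ (γ ∘ σ) ]ᵀ
    eqS = []ᵀ≡ A (sym sγσ)
    eqT : A [ g ]ᵀ [ σ ]ᵀ ≡ A [ tgt _ ∘ (γ ∘ σ) ]ᵀ
    eqT = []ᵀ≡ A (sym tγσ)
    C[σ] : C [ σ ]ᵀ ≡ Id (A [ f ∘ σ ]ᵀ) (a [ σ ]) (tr Δ A [ b [ σ ] ∷ γ ∘ σ ])
    C[σ] = trans (Id-[] _ _ _ _) (Id≡ ([]ᵀ-∘ A f σ) refl ([]-∘ _ _ σ))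
    δs : A [ src _ ∘ inter (f ∘ σ) (g ∘ σ) α ]ᵀ ≡ A [ f ∘ σ ]ᵀ
    δs = cong (A [_]ᵀ) (src-inter (f ∘ σ) (g ∘ σ) α)
    q! : X ⊢ q ∶ C [ σ ]ᵀ
    q! = cast (sym C[σ]) (conv (cast (Id≡ δs refl refl) (unpath α! .proj₂ .proj₂ .proj₂))
      (Id-cong (≐type-refl (sub-type (⊢∘ f! (⊢along 𝓔)) A!))
               (≐-refl (cast ([]ᵀ-∘ A f σ) (sub-term (⊢along 𝓔) a!)))
               (cast≐ δs (tr-cong (≐ˢ-sym γσ)
                 (≐-refl (unpath α! .proj₂ .proj₂ .proj₁))))))

  -- By discreteness, identifications that agree on the image of σ are equal.
  uniq-term : ∀ {l m} {X : Ctx l} {Y : Ctx m} {σ e} → Elim X Y σ e → ∀ {A a b p q} →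
              Y ⊢ p ∶ Id A a b → Y ⊢ q ∶ Id A a b →
              X ⊢ p [ σ ] ≐ q [ σ ] ∶ Id A a b [ σ ]ᵀ → Y ⊢ p ≐ q ∶ Id A a b
  uniq-term 𝓔 p! q! pq =
    Id-disc (⊢elim 𝓔 (Id-form p! q!)
              (cast (sym (Id-[] _ _ _ _))
                (conv (Id-intro (proj₁ (≐term⇒term pq)))
                      (Id-cong (≐type-refl (term⇒type (proj₁ (≐term⇒term pq))))
                               (≐-refl (proj₁ (≐term⇒term pq))) pq))))
            p! q!

  uniq : ∀ {l m n} {X : Ctx l} {Y : Ctx m} {σ e} → Elim X Y σ e → ∀ {Δ : Ctx n} → Δ ctx →
         ∀ {γ γ′} → Y ⊢ˢ γ ∶ IdCtx Δ → Y ⊢ˢ γ′ ∶ IdCtx Δ →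
         Y ⊢ˢ src n ∘ γ ≐ src n ∘ γ′ ∶ Δ → Y ⊢ˢ tgt n ∘ γ ≐ tgt n ∘ γ′ ∶ Δ →
         X ⊢ˢ γ ∘ σ ≐ γ′ ∘ σ ∶ IdCtx Δ → Y ⊢ˢ γ ≐ γ′ ∶ IdCtx Δ
  uniq 𝓔 [] {[]} {[]} γ! γ′! s t r = ≐ˢ-refl γ!
  uniq {n = suc n} {σ = σ} 𝓔 {Δ ▷ A} (Δ! ▷ A!) {q ∷ b ∷ a ∷ γ} {q′ ∷ b′ ∷ a′ ∷ γ′} γ! γ′! s t rr =
    path-cong γγ′ aa′ bb′
      (uniq-term 𝓔 q! (conv q′! (≐type-sym (Id-cong (sub-cong (∘-congʳ (⊢src W) γγ′) A!) aa′ (tr-cong γγ′ bb′))))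
        (cast≐ (sym (trans (Id-[] _ _ _ σ) (Id≡ ([]ᵀ≡ A (∘-assoc (src n) γ σ)) refl ([]-∘ _ _ σ)))) qq′))
    where
    W = wellFormed Δ!
    open Transport W A!
    s′ = cons⁻ (cast≐ˢ (src-∷ n q b a γ) (src-∷ n q′ b′ a′ γ′) s)
    t′ = cons⁻ (cast≐ˢ (tgt-∷ n q b a γ) (tgt-∷ n q′ b′ a′ γ′) t)
    aa′ = s′ .proj₂
    bb′ = t′ .proj₂
    q! = unpath γ! .proj₂ .proj₂ .proj₂
    q′! = unpath γ′! .proj₂ .proj₂ .proj₂
    r′ = unpath-cong rr
    qq′ = r′ .proj₂ .proj₂ .proj₂
    γγ′ = uniq 𝓔 Δ! (unpath γ! .proj₁) (unpath γ′! .proj₁) (s′ .proj₁) (t′ .proj₁) (r′ .proj₁)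

  -- Into Δ Y k is the context Y , x : Δ , p : Id_Δ (x , k), for k : Y → Δ, with the
  -- variables of x and p interleaved; proj projects to Y, and gen k is (x , k , p).

  proj : ∀ {m} n → Sub (dbl n m) m
  proj zero    = id
  proj (suc n) = proj n ∘ wk²

  gen : ∀ {m n} → Sub m n → Sub (dbl n m) (trip n)
  gen []      = []
  gen {n = suc n} (b ∷ k) = v0 ∷ b [ proj n ∘ wk² ] ∷ v1 ∷ gen k ∘ wk²

  Into : ∀ {m n} → Ctx n → Ctx m → Sub m n → Ctx (dbl n m)
  Into []      Y []      = Y
  Into {n = suc n} (Δ ▷ A) Y (b ∷ k) =
    Into Δ Y k ▷ A [ src n ∘ gen k ]ᵀ ▷
    Id (A [ src n ∘ (gen k ∘ wk) ]ᵀ) v0 (tr Δ A [ b [ proj n ∘ wk ] ∷ gen k ∘ wk ])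

  lifts : ∀ {l m} n → Sub l m → Sub (dbl n l) (dbl n m)
  lifts zero    σ = σ
  lifts (suc n) σ = lifts n σ ↑ ↑

  intoElim : ∀ {l m n} → Ctx n → Sub m n → Sub l m →
             (Ty m → Tm l → Tm m) → (Ty (dbl n m) → Tm (dbl n l) → Tm (dbl n m))
  intoElim []      []      σ e = e
  intoElim {n = suc n} (Δ ▷ A) (b ∷ k) σ e =
    extend (extend (intoElim Δ k σ e) (lifts n σ) (A [ src n ∘ gen k ]ᵀ))
           (lifts n σ ↑) (Id (A [ src n ∘ (gen k ∘ wk) ]ᵀ) v0 (tr Δ A [ b [ proj n ∘ wk ] ∷ gen k ∘ wk ]))

  pairing : ∀ {l m} n → Sub l m → Sub l (trip n) → Sub l (dbl n m)
  pairing zero    κ []              = κ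
  pairing (suc n) κ (q ∷ b ∷ a ∷ γ) = q ∷ a ∷ pairing n κ γ

  tgt-gen : ∀ {m n} (k : Sub m n) → tgt n ∘ gen k ≡ k ∘ proj n
  tgt-gen []      = refl
  tgt-gen {n = suc n} (b ∷ k) = trans (tgt-∷ n v0 (b [ proj n ∘ wk² ]) v1 (gen k ∘ wk²))
    (cong (b [ proj n ∘ wk² ] ∷_)
      (trans (sym (∘-assoc (tgt n) (gen k) wk²))
             (trans (cong (_∘ wk²) (tgt-gen k)) (∘-assoc k (proj n) wk²))))

  ↑↑-∷ : ∀ {l m n} (τ : Sub m n) (b a : Tm l) (σ : Sub l m) → τ ↑ ↑ ∘ (b ∷ a ∷ σ) ≡ b ∷ a ∷ (τ ∘ σ)
  ↑↑-∷ τ b a σ = trans (↑-∷ (τ ↑) b (a ∷ σ)) (cong (b ∷_) (↑-∷ τ a σ))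

  wk²-↑↑ : ∀ {m n} (τ : Sub m n) → wk² ∘ τ ↑ ↑ ≡ τ ∘ wk²
  wk²-↑↑ τ = trans (cong (λ υ → wk² ∘ (v0 ∷ υ)) eq) (wk²-∷ v0 v1 (τ ∘ wk²))
    where
    eq : τ ↑ ∘ wk ≡ v1 ∷ τ ∘ wk²
    eq = cong₂ _∷_ (var-[] zero wk) (∘-assoc τ wk wk)

  proj-lifts : ∀ {l m} n (σ : Sub l m) → proj n ∘ lifts n σ ≡ σ ∘ proj n
  proj-lifts zero    σ = trans (id-∘ σ) (sym (∘-id σ))
  proj-lifts (suc n) σ = trans (∘-assoc (proj n) wk² _) (trans (cong (proj n ∘_) (wk²-↑↑ (lifts n σ)))
    (trans (sym (∘-assoc (proj n) (lifts n σ) wk²)) (trans (cong (_∘ wk²) (proj-lifts n σ)) (∘-assoc σ (proj n) wk²))))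

  gen-lifts : ∀ {l m n} (k : Sub m n) (σ : Sub l m) → gen k ∘ lifts n σ ≡ gen (k ∘ σ)
  gen-lifts []      σ = refl
  gen-lifts {n = suc n} (b ∷ k) σ = cong₂ _∷_ (var-[] zero _) (cong₂ _∷_
    (trans ([]≡ b (proj-lifts (suc n) σ)) (sym ([]-∘ b σ _)))
    (cong₂ _∷_ (trans (var-[] (suc zero) _) (var-[] zero wk))
      (trans (∘-assoc (gen k) wk² _) (trans (cong (gen k ∘_) (wk²-↑↑ (lifts n σ)))
        (trans (sym (∘-assoc (gen k) (lifts n σ) wk²)) (cong (_∘ wk²) (gen-lifts k σ)))))))

  proj-pairing : ∀ {l m} n (κ : Sub l m) γ → proj n ∘ pairing n κ γ ≡ κ
  proj-pairing zero    κ []              = id-∘ κ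
  proj-pairing (suc n) κ (q ∷ b ∷ a ∷ γ) = trans (∘wk²-∷ (proj n) q a _) (proj-pairing n κ γ)

  pairing-∘ : ∀ {k l m} n (κ : Sub l m) γ (τ : Sub k l) →
              pairing n κ γ ∘ τ ≡ pairing n (κ ∘ τ) (γ ∘ τ)
  pairing-∘ zero    κ []              τ = refl
  pairing-∘ (suc n) κ (q ∷ b ∷ a ∷ γ) τ = cong (λ υ → q [ τ ] ∷ a [ τ ] ∷ υ) (pairing-∘ n κ γ τ)

  lifts-pairing : ∀ {k l m} n (σ : Sub l m) (κ : Sub k l) γ →
                  lifts n σ ∘ pairing n κ γ ≡ pairing n (σ ∘ κ) γ
  lifts-pairing zero    σ κ []              = refl
  lifts-pairing (suc n) σ κ (q ∷ b ∷ a ∷ γ) =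
    trans (↑↑-∷ (lifts n σ) q a (pairing n κ γ)) (cong (λ υ → q ∷ a ∷ υ) (lifts-pairing n σ κ γ))

  module IntoStep {m n} {Y : Ctx m} {Δ : Ctx n} {k : Sub m n} {A b}
                  (Δ! : Δ ctx) (A! : Δ ⊢ A type) (b! : Y ⊢ b ∶ A [ k ]ᵀ)
                  (⊢proj : Into Δ Y k ⊢ˢ proj n ∶ Y) (⊢gen : Into Δ Y k ⊢ˢ gen k ∶ IdCtx Δ) where

    open Transport (wellFormed Δ!) A!

    T₁ = A [ src n ∘ gen k ]ᵀ
    T₂ = Id (A [ src n ∘ (gen k ∘ wk) ]ᵀ) v0 (tr Δ A [ b [ proj n ∘ wk ] ∷ gen k ∘ wk ])

    tgt-gen∘ : ∀ {l} (τ : Sub l (dbl n m)) → k ∘ (proj n ∘ τ) ≡ tgt n ∘ (gen k ∘ τ)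
    tgt-gen∘ τ = trans (sym (∘-assoc k (proj n) τ))
      (trans (cong (_∘ τ) (sym (tgt-gen k))) (∘-assoc (tgt n) (gen k) τ))

    ⊢T₁ : Into Δ Y k ⊢ T₁ type
    ⊢T₁ = sub-type (⊢∘ (⊢src (wellFormed Δ!)) ⊢gen) A!

    ⊢b : ∀ {l} {Γ : Ctx l} {τ} → Γ ⊢ˢ τ ∶ Into Δ Y k →
         Γ ⊢ b [ proj n ∘ τ ] ∶ A [ tgt n ∘ (gen k ∘ τ) ]ᵀ
    ⊢b {τ = τ} τ! = cast ([]ᵀ≡ A (tgt-gen∘ τ)) (sub-term (⊢∘ ⊢proj τ!) b!)

    ⊢T₂ : Into Δ Y k ▷ T₁ ⊢ T₂ type
    ⊢T₂ = Id-form (cast ([]ᵀ≡ A (∘-assoc (src n) (gen k) wk)) (⊢v0 ⊢T₁))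
                  (⊢tr (⊢∘wk ⊢T₁ ⊢gen) (⊢b (⊢wk ⊢T₁)))

    T₂-∷ : ∀ {l} (a : Tm l) τ →
           T₂ [ a ∷ τ ]ᵀ ≡ Id (A [ src n ∘ (gen k ∘ τ) ]ᵀ) a (tr Δ A [ b [ proj n ∘ τ ] ∷ gen k ∘ τ ])
    T₂-∷ a τ = trans (Id-[] _ _ _ _)
      (Id≡ ([]ᵀ≡ A (trans (∘-assoc (src n) (gen k ∘ wk) (a ∷ τ)) (cong (src n ∘_) (∘wk-∷ (gen k) a τ))))
           (var-[] zero _)
           ([]≡ (tr Δ A) (cong₂ _∷_ ([]≡ b (∘wk-∷ (proj n) a τ)) (∘wk-∷ (gen k) a τ))))

    ⊢gen▷ : Into Δ Y k ▷ T₁ ▷ T₂ ⊢ˢ gen (b ∷ k) ∶ IdCtx (Δ ▷ A)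
    ⊢gen▷ = ⊢path (⊢∘ ⊢gen wk²!) a! (⊢b wk²!)
      (cast (T₂-∷ v1 wk²)
        (castT (⊢v0 ⊢T₂)))
      where
      wk²! : Into Δ Y k ▷ T₁ ▷ T₂ ⊢ˢ wk² ∶ Into Δ Y k
      wk²! = ⊢∘ (⊢wk ⊢T₁) (⊢wk ⊢T₂)
      a! : Into Δ Y k ▷ T₁ ▷ T₂ ⊢ v1 ∶ A [ src n ∘ (gen k ∘ wk²) ]ᵀ
      a! = cast (trans (cong _[ wk ]ᵀ ([]ᵀ≡ A (∘-assoc (src n) (gen k) wk)))
                       ([]ᵀ≡ A (trans (∘-assoc (src n) (gen k ∘ wk) wk)
                                      (cong (src n ∘_) (∘-assoc (gen k) wk wk)))))
                (castᵗ (var-[] zero wk) (wk-term ⊢T₂ (⊢v0 ⊢T₁)))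
      wk-eq : ∀ {i} → wk {suc i} ≡ v1 ∷ wk²
      wk-eq {i} = cong (v1 ∷_) (trans (sym (wk²-∷ v0 v1 _)) (∘-id wk²))
      castT : ∀ {v} → Into Δ Y k ▷ T₁ ▷ T₂ ⊢ v ∶ T₂ [ wk ]ᵀ →
              Into Δ Y k ▷ T₁ ▷ T₂ ⊢ v ∶ T₂ [ v1 ∷ wk² ]ᵀ
      castT = cast (cong (T₂ [_]ᵀ) wk-eq)

    ⊢proj▷ : Into Δ Y k ▷ T₁ ▷ T₂ ⊢ˢ proj (suc n) ∶ Y
    ⊢proj▷ = ⊢∘ ⊢proj (⊢∘ (⊢wk ⊢T₁) (⊢wk ⊢T₂))

  ⊢proj-gen : ∀ {m n} {Y : Ctx m} {Δ : Ctx n} → Δ ctx → ∀ {k} → Y ⊢ˢ k ∶ Δ →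
              Into Δ Y k ⊢ˢ proj n ∶ Y × Into Δ Y k ⊢ˢ gen k ∶ IdCtx Δ
  ⊢proj-gen [] {[]} k! = ⊢id (⊢dom k!) , [] (⊢dom k!)
  ⊢proj-gen (Δ! ▷ A!) {b ∷ k} (cons k! _ b!) = ⊢proj▷ , ⊢gen▷
    where open IntoStep Δ! A! b! (⊢proj-gen Δ! k! .proj₁) (⊢proj-gen Δ! k! .proj₂)

  Elim-Into : ∀ {l m n} {X : Ctx l} {Y : Ctx m} {σ e} → Elim X Y σ e → ∀ {Δ : Ctx n} → Δ ctx →
              ∀ {k} → Y ⊢ˢ k ∶ Δ →
              Elim (Into Δ X (k ∘ σ)) (Into Δ Y k) (lifts n σ) (intoElim Δ k σ e)
  Elim-Into 𝓔 [] {[]} k! = 𝓔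
  Elim-Into {l} {m} {suc n} {X} {Y} {σ} {e} 𝓔 {Δ ▷ A} (Δ! ▷ A!) {b ∷ k} (cons k! _ b!) =
    subst (λ Z → Elim Z (Into (Δ ▷ A) Y (b ∷ k)) (lifts (suc n) σ) (intoElim (Δ ▷ A) (b ∷ k) σ e))
      (cong₂ (λ B C → Into Δ X (k ∘ σ) ▷ B ▷ C) eq₁ eq₂)
      (Elim-extend ⊢T₂ (Elim-extend ⊢T₁ (Elim-Into 𝓔 Δ! k!)))
    where
    open IntoStep Δ! A! b! (⊢proj-gen Δ! k! .proj₁) (⊢proj-gen Δ! k! .proj₂)
    τ = lifts n σ
    eq₁ : T₁ [ τ ]ᵀ ≡ A [ src n ∘ gen (k ∘ σ) ]ᵀ
    eq₁ = []ᵀ≡ A (trans (∘-assoc (src n) (gen k) τ) (cong (src n ∘_) (gen-lifts k σ)))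
    gen-wk : gen k ∘ (τ ∘ wk) ≡ gen (k ∘ σ) ∘ wk
    gen-wk = trans (sym (∘-assoc (gen k) τ wk)) (cong (_∘ wk) (gen-lifts k σ))
    proj-wk : proj n ∘ (τ ∘ wk) ≡ σ ∘ (proj n ∘ wk)
    proj-wk = trans (sym (∘-assoc (proj n) τ wk))
      (trans (cong (_∘ wk) (proj-lifts n σ)) (∘-assoc σ (proj n) wk))
    eq₂ : T₂ [ τ ↑ ]ᵀ ≡ Id (A [ src n ∘ (gen (k ∘ σ) ∘ wk) ]ᵀ) v0
                            (tr Δ A [ b [ σ ] [ proj n ∘ wk ] ∷ gen (k ∘ σ) ∘ wk ])
    eq₂ = trans (T₂-∷ v0 (τ ∘ wk))
      (Id≡ (cong (λ υ → A [ src n ∘ υ ]ᵀ) gen-wk) refl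
           (cong₂ (λ c υ → tr Δ A [ c ∷ υ ])
             (trans (cong (b [_]) proj-wk) (sym ([]-∘ b σ _))) gen-wk))

  pairing-cong : ∀ {l m n} {Γ : Ctx l} {Y : Ctx m} {Δ : Ctx n} → Δ ctx → ∀ {k κ κ′ γ γ′} →
    Y ⊢ˢ k ∶ Δ → Γ ⊢ˢ κ ≐ κ′ ∶ Y → Γ ⊢ˢ γ ≐ γ′ ∶ IdCtx Δ → Γ ⊢ˢ tgt n ∘ γ ≐ k ∘ κ ∶ Δ →
    Γ ⊢ˢ pairing n κ γ ≐ pairing n κ′ γ′ ∶ Into Δ Y k ×
    Γ ⊢ˢ gen k ∘ pairing n κ γ ≐ γ ∶ IdCtx Δ
  pairing-cong [] {[]} {γ = []} {[]} k! κκ′ γγ′ t = κκ′ , γγ′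
  pairing-cong {n = suc n} {Γ} {Y} {Δ ▷ A} (Δ! ▷ A!) {b ∷ k} {κ} {κ′} {q ∷ c ∷ a ∷ γ} {q′ ∷ c′ ∷ a′ ∷ γ′}
               (cons k! _ b!) κκ′ γγ′ t =
    cons (cons (ih .proj₁) ⊢T₁ (cast≐ (sym ([]ᵀ≡ A (∘-assoc (src n) (gen k) π))) aa′)) ⊢T₂
         (cast≐ (sym T₂-π) qq′) ,
    cast≐ˢ (sym gen-π) refl
      (path-cong (ih .proj₂) (≐-refl (proj₁ (≐term⇒term aa′)))
        (cast≐ eqc bc) (≐-refl (proj₁ (≐term⇒term (cast≐ (Id≡ refl refl
           (cong (λ d → tr Δ A [ b [ d ] ∷ gen k ∘ π ]) (proj-pairing n κ γ))) qq′)))))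
    where
    open IntoStep Δ! A! b! (⊢proj-gen Δ! k! .proj₁) (⊢proj-gen Δ! k! .proj₂)
    open Transport (wellFormed Δ!) A!
    π = pairing n κ γ
    p = unpath-cong γγ′
    t′ = cons⁻ (cast≐ˢ (tgt-∷ n q c a γ) refl t)
    ih = pairing-cong Δ! k! κκ′ (p .proj₁) (t′ .proj₁)
    genγ : Γ ⊢ A [ src n ∘ γ ]ᵀ ≐ A [ src n ∘ (gen k ∘ π) ]ᵀ type
    genγ = sub-cong (∘-congʳ (⊢src (wellFormed Δ!)) (≐ˢ-sym (ih .proj₂))) A!
    aa′ : Γ ⊢ a ≐ a′ ∶ A [ src n ∘ (gen k ∘ π) ]ᵀ
    aa′ = ≐-conv (p .proj₂ .proj₁) genγ
    cb : Γ ⊢ c ≐ b [ κ ] ∶ A [ tgt n ∘ γ ]ᵀ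
    cb = t′ .proj₂
    tgt-π : tgt n ∘ (gen k ∘ π) ≡ k ∘ κ
    tgt-π = trans (sym (tgt-gen∘ π)) (cong (k ∘_) (proj-pairing n κ γ))
    eqc : A [ k ∘ κ ]ᵀ ≡ A [ tgt n ∘ (gen k ∘ π) ]ᵀ
    eqc = cong (A [_]ᵀ) (sym tgt-π)
    bc : Γ ⊢ b [ κ ] ≐ c ∶ A [ k ∘ κ ]ᵀ
    bc = ≐-conv (≐-sym cb) (sub-cong (t′ .proj₁) A!)
    qq′ : Γ ⊢ q ≐ q′ ∶ Id (A [ src n ∘ (gen k ∘ π) ]ᵀ) a (tr Δ A [ b [ proj n ∘ π ] ∷ gen k ∘ π ])
    qq′ = ≐-conv (p .proj₂ .proj₂ .proj₂)
      (Id-cong genγ (≐-refl (proj₁ (≐term⇒term (p .proj₂ .proj₁))))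
        (tr-cong (≐ˢ-sym (ih .proj₂))
          (cast≐ᵗ refl (cong (b [_]) (sym (proj-pairing n κ γ))) cb)))
    T₂-π : T₂ [ a ∷ π ]ᵀ ≡ Id (A [ src n ∘ (gen k ∘ π) ]ᵀ) a (tr Δ A [ b [ proj n ∘ π ] ∷ gen k ∘ π ])
    T₂-π = T₂-∷ a π
    gen-π : gen (b ∷ k) ∘ (q ∷ a ∷ π) ≡ q ∷ b [ κ ] ∷ a ∷ gen k ∘ π
    gen-π = cong₂ _∷_ (var-[] zero _) (cong₂ _∷_
      ([]≡ b (trans (∘wk²-∷ (proj n) q a π) (proj-pairing n κ γ)))
      (cong₂ _∷_ (var-[] _ _) (∘wk²-∷ (gen k) q a π)))

module Composition {ℓ} (S : TypeTheory ℓ) (M : ML₂ S) where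
  open TypeTheory S
  open ML₂ M
  open Substitution S
  open Paths S M
  open Cells S M
  open Elim
  open WellFormed

  -- q ∘ p, in the context y, z : Δ, q : Id y z, x : Δ, p : Id x y, by elimination
  -- on q from r y ∘ p = p.
  compᴳ : ∀ {n} → Ctx n → Sub (dbl n (trip n)) (trip n)
  compᴳ {n} Δ = inter f g (fill (intoElim Δ (src n) (rfl Δ) (jay Δ)) Δ f g (pth n (gen (src n ∘ rfl Δ))))
    where
    f = src n ∘ gen (src n)
    g = tgt n ∘ proj n

  compose : ∀ {m n} → Ctx n → Sub m (trip n) → Sub m (trip n) → Sub m (trip n)
  compose {n = n} Δ γ₂ γ₁ = compᴳ Δ ∘ pairing n γ₂ γ₁

  -- h• p, in the context x, y : Γ, p : Id x y, by elimination from h• (r x) = r (h x).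
  bulletᴳ : ∀ {m n} → Ctx m → Ctx n → Sub m n → Sub (trip m) (trip n)
  bulletᴳ {m} {n} Γ Δ h = inter f g (fill (jay Γ) Δ f g (pth n (rfl Δ ∘ h)))
    where
    f = h ∘ src m
    g = h ∘ tgt m

  ∘-assoc-cong : ∀ {k l m n} (σ : Sub m n) (τ : Sub l m) (υ : Sub k l) {ω : Sub k m} →
                 τ ∘ υ ≡ ω → σ ∘ τ ∘ υ ≡ σ ∘ ω
  ∘-assoc-cong σ τ υ eq = trans (∘-assoc σ τ υ) (cong (σ ∘_) eq)

  ∘-cong-assoc : ∀ {k l m n} (σ : Sub m n) (τ : Sub l m) (υ : Sub k l) {ω : Sub l n} →
                 σ ∘ τ ≡ ω → σ ∘ (τ ∘ υ) ≡ ω ∘ υ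
  ∘-cong-assoc σ τ υ eq = trans (sym (∘-assoc σ τ υ)) (cong (_∘ υ) eq)

  module _ {n} {Δ : Ctx n} (Δ! : Δ ctx) where
    private
      W = wellFormed Δ!

    src-rfl∘ : ∀ {m} (y : Sub m n) → src n ∘ (rfl Δ ∘ y) ≡ y
    src-rfl∘ y = trans (∘-cong-assoc (src n) (rfl Δ) y (src-rfl Δ)) (id-∘ y)

    tgt-rfl∘ : ∀ {m} (y : Sub m n) → tgt n ∘ (rfl Δ ∘ y) ≡ y
    tgt-rfl∘ y = trans (∘-cong-assoc (tgt n) (rfl Δ) y (tgt-rfl Δ)) (id-∘ y)

    src-cong : ∀ {m} {Γ : Ctx m} {γ γ′} → Γ ⊢ˢ γ ≐ γ′ ∶ IdCtx Δ → Γ ⊢ˢ src n ∘ γ ≐ src n ∘ γ′ ∶ Δ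
    src-cong = ∘-congʳ (⊢src W)

    tgt-cong : ∀ {m} {Γ : Ctx m} {γ γ′} → Γ ⊢ˢ γ ≐ γ′ ∶ IdCtx Δ → Γ ⊢ˢ tgt n ∘ γ ≐ tgt n ∘ γ′ ∶ Δ
    tgt-cong = ∘-congʳ (⊢tgt W)

    ⊢rfl∘ : ∀ {m} {Γ : Ctx m} {y} → Γ ⊢ˢ y ∶ Δ → Γ ⊢ˢ rfl Δ ∘ y ∶ IdCtx Δ
    ⊢rfl∘ = ⊢∘ (⊢rfl W)

    private
      f = src n ∘ gen (src n)
      g = tgt n ∘ proj n
      ⊢pg = ⊢proj-gen Δ! (⊢src W)
      𝓔 = Elim-Into (Elim-Id W) Δ! (⊢src W)
      σ = lifts n (rfl Δ)
      X = Into Δ Δ (src n ∘ rfl Δ)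
      δ = gen (src n ∘ rfl Δ)
      f! = ⊢∘ (⊢src W) (⊢pg .proj₂)
      g! = ⊢∘ (⊢tgt W) (⊢pg .proj₁)
      δ-eq : inter (f ∘ σ) (g ∘ σ) (pth n δ) ≡ δ
      δ-eq = trans (cong₂ (λ s t → inter s t (pth n δ))
          (∘-assoc-cong (src n) (gen (src n)) σ (gen-lifts (src n) (rfl Δ)))
          (trans (∘-assoc-cong (tgt n) (proj n) σ (proj-lifts n (rfl Δ)))
          (trans (tgt-rfl∘ (proj n))
          (trans (sym (id-∘ (proj n)))
          (trans (cong (_∘ proj n) (sym (src-rfl Δ)))
                 (sym (tgt-gen (src n ∘ rfl Δ))))))))
        (inter-pth n δ)
      ⊢sr : Δ ⊢ˢ src n ∘ rfl Δ ∶ Δ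
      ⊢sr = ⊢∘ (⊢src W) (⊢rfl W)
      ⊢δ : X ⊢ˢ δ ∶ IdCtx Δ
      ⊢δ = ⊢proj-gen Δ! ⊢sr .proj₂
      ⊢β = ⊢fill-β 𝓔 Δ! f! g! (castˢ (sym δ-eq) ⊢δ)

    ⊢compᴳ : Into Δ (IdCtx Δ) (src n) ⊢ˢ compᴳ Δ ∶ IdCtx Δ
    ⊢compᴳ = ⊢β .proj₁

    compᴳ-β : X ⊢ˢ compᴳ Δ ∘ σ ≐ δ ∶ IdCtx Δ
    compᴳ-β = cast≐ˢ refl δ-eq (⊢β .proj₂)

    module _ {m} {Γ : Ctx m} where
      compose-cong : ∀ {γ₂ γ₂′ γ₁ γ₁′} → Γ ⊢ˢ γ₂ ≐ γ₂′ ∶ IdCtx Δ → Γ ⊢ˢ γ₁ ≐ γ₁′ ∶ IdCtx Δ →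
        Γ ⊢ˢ tgt n ∘ γ₁ ≐ src n ∘ γ₂ ∶ Δ →
        Γ ⊢ˢ compose Δ γ₂ γ₁ ≐ compose Δ γ₂′ γ₁′ ∶ IdCtx Δ
      compose-cong e₂ e₁ t = ∘-congʳ ⊢compᴳ (pairing-cong Δ! (⊢src W) e₂ e₁ t .proj₁)

      ⊢compose : ∀ {γ₂ γ₁} → Γ ⊢ˢ γ₂ ∶ IdCtx Δ → Γ ⊢ˢ γ₁ ∶ IdCtx Δ →
        Γ ⊢ˢ tgt n ∘ γ₁ ≐ src n ∘ γ₂ ∶ Δ → Γ ⊢ˢ compose Δ γ₂ γ₁ ∶ IdCtx Δ
      ⊢compose γ₂! γ₁! t = ≐ˢ-left (compose-cong (≐ˢ-refl γ₂!) (≐ˢ-refl γ₁!) t)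

      src-compose : ∀ {γ₂ γ₁} → Γ ⊢ˢ γ₂ ∶ IdCtx Δ → Γ ⊢ˢ γ₁ ∶ IdCtx Δ →
        Γ ⊢ˢ tgt n ∘ γ₁ ≐ src n ∘ γ₂ ∶ Δ → Γ ⊢ˢ src n ∘ compose Δ γ₂ γ₁ ≐ src n ∘ γ₁ ∶ Δ
      src-compose {γ₂} {γ₁} γ₂! γ₁! t = cast≐ˢ
        (sym (trans (∘-cong-assoc (src n) (compᴳ Δ) _ (src-inter f g _))
                    (∘-assoc (src n) (gen (src n)) _))) refl
        (src-cong (pairing-cong Δ! (⊢src W) (≐ˢ-refl γ₂!) (≐ˢ-refl γ₁!) t .proj₂))

    tgt-compose : ∀ {m} (γ₂ γ₁ : Sub m (trip n)) → tgt n ∘ compose Δ γ₂ γ₁ ≡ tgt n ∘ γ₂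
    tgt-compose γ₂ γ₁ = trans (∘-cong-assoc (tgt n) (compᴳ Δ) _ (tgt-inter f g _))
      (∘-assoc-cong (tgt n) (proj n) _ (proj-pairing n γ₂ γ₁))

    compose-∘ : ∀ {l m} (γ₂ γ₁ : Sub m (trip n)) (τ : Sub l m) →
                compose Δ γ₂ γ₁ ∘ τ ≡ compose Δ (γ₂ ∘ τ) (γ₁ ∘ τ)
    compose-∘ γ₂ γ₁ τ = ∘-assoc-cong (compᴳ Δ) _ τ (pairing-∘ n γ₂ γ₁ τ)

    compose-rflˡ : ∀ {m} {Γ : Ctx m} {γ y} → Γ ⊢ˢ γ ∶ IdCtx Δ → Γ ⊢ˢ tgt n ∘ γ ≐ y ∶ Δ →
                   Γ ⊢ˢ compose Δ (rfl Δ ∘ y) γ ≐ γ ∶ IdCtx Δ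
    compose-rflˡ {Γ = Γ} {γ} {y} γ! t = ≐ˢ-trans
      (cast≐ˢ (∘-assoc-cong (compᴳ Δ) σ _ (lifts-pairing n (rfl Δ) y γ)) refl
        (∘-congˡ compᴳ-β (≐ˢ-left (pc .proj₁)))) (pc .proj₂)
      where
      y! = ≐ˢ-right t
      pc = pairing-cong Δ! ⊢sr (≐ˢ-refl y!) (≐ˢ-refl γ!)
             (cast≐ˢ refl (sym (trans (cong (_∘ y) (src-rfl Δ)) (id-∘ y))) t)

    path-ind : ∀ {k} {Θ : Ctx k} → Θ ctx → ∀ {F G} →
               IdCtx Δ ⊢ˢ F ∶ IdCtx Θ → IdCtx Δ ⊢ˢ G ∶ IdCtx Θ →
               IdCtx Δ ⊢ˢ src k ∘ F ≐ src k ∘ G ∶ Θ → IdCtx Δ ⊢ˢ tgt k ∘ F ≐ tgt k ∘ G ∶ Θ →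
               Δ ⊢ˢ F ∘ rfl Δ ≐ G ∘ rfl Δ ∶ IdCtx Θ → IdCtx Δ ⊢ˢ F ≐ G ∶ IdCtx Θ
    path-ind Θ! = uniq (Elim-Id W) Θ!

    path-ind₂ : ∀ {k} {Θ : Ctx k} → Θ ctx → ∀ {F G} →
      let Y = Into Δ (IdCtx Δ) (src n) in
      Y ⊢ˢ F ∶ IdCtx Θ → Y ⊢ˢ G ∶ IdCtx Θ →
      Y ⊢ˢ src k ∘ F ≐ src k ∘ G ∶ Θ → Y ⊢ˢ tgt k ∘ F ≐ tgt k ∘ G ∶ Θ →
      Into Δ Δ (src n ∘ rfl Δ) ⊢ˢ F ∘ lifts n (rfl Δ) ≐ G ∘ lifts n (rfl Δ) ∶ IdCtx Θ →
      Y ⊢ˢ F ≐ G ∶ IdCtx Θ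
    path-ind₂ Θ! = uniq 𝓔 Θ!

    compose-rflʳ : ∀ {m} {Γ : Ctx m} {γ x} → Γ ⊢ˢ γ ∶ IdCtx Δ → Γ ⊢ˢ src n ∘ γ ≐ x ∶ Δ →
                   Γ ⊢ˢ compose Δ γ (rfl Δ ∘ x) ≐ γ ∶ IdCtx Δ
    compose-rflʳ {Γ = Γ} {γ} {x} γ! s = ≐ˢ-trans
      (compose-cong (≐ˢ-refl γ!) (∘-congʳ (⊢rfl W) (≐ˢ-sym s))
        (cast≐ˢ (sym (tgt-rfl∘ x)) refl (≐ˢ-sym s)))
      (cast≐ˢ (trans (compose-∘ id (rfl Δ ∘ src n) γ)
                (cong₂ (compose Δ) (id-∘ γ) (∘-assoc (rfl Δ) (src n) γ))) (id-∘ γ)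
        (∘-congˡ generic γ!))
      where
      id! = ⊢id (IdCtx! W)
      rs! = ⊢rfl∘ (⊢src W)
      meet : IdCtx Δ ⊢ˢ tgt n ∘ (rfl Δ ∘ src n) ≐ src n ∘ id ∶ Δ
      meet = ≡⇒≐ˢ (trans (tgt-rfl∘ (src n)) (sym (∘-id (src n))))
               (⊢∘ (⊢tgt W) rs!)
      generic : IdCtx Δ ⊢ˢ compose Δ id (rfl Δ ∘ src n) ≐ id ∶ IdCtx Δ
      generic = path-ind Δ! (⊢compose id! rs! meet) id!
        (≐ˢ-trans (src-compose id! rs! meet)
                  (≡⇒≐ˢ (trans (src-rfl∘ (src n)) (sym (∘-id (src n)))) (⊢∘ (⊢src W) rs!)))
        (≡⇒≐ˢ (tgt-compose id _) (⊢∘ (⊢tgt W) (⊢compose id! rs! meet)))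
        (cast≐ˢ (sym (trans (compose-∘ id (rfl Δ ∘ src n) (rfl Δ))
                       (cong₂ (compose Δ) (trans (id-∘ (rfl Δ)) (sym (∘-id (rfl Δ))))
                         (trans (∘-assoc-cong (rfl Δ) (src n) (rfl Δ) (src-rfl Δ)) (∘-id (rfl Δ))))))
                (sym (id-∘ (rfl Δ)))
          (compose-rflˡ (⊢rfl W) (≡⇒≐ˢ (tgt-rfl Δ) (⊢∘ (⊢tgt W) (⊢rfl W)))))

    compose-assoc : ∀ {m} {Γ : Ctx m} {γ₃ γ₂ γ₁} →
      Γ ⊢ˢ γ₃ ∶ IdCtx Δ → Γ ⊢ˢ γ₂ ∶ IdCtx Δ → Γ ⊢ˢ γ₁ ∶ IdCtx Δ →
      Γ ⊢ˢ tgt n ∘ γ₂ ≐ src n ∘ γ₃ ∶ Δ → Γ ⊢ˢ tgt n ∘ γ₁ ≐ src n ∘ γ₂ ∶ Δ →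
      Γ ⊢ˢ compose Δ (compose Δ γ₃ γ₂) γ₁ ≐ compose Δ γ₃ (compose Δ γ₂ γ₁) ∶ IdCtx Δ
    compose-assoc {Γ = Γ} {γ₃} {γ₂} {γ₁} γ₃! γ₂! γ₁! t₃ t₂ = ≐ˢ-trans
      (compose-cong (compose-cong s≐ (≐ˢ-sym q≐) t₃) (≐ˢ-sym p≐)
        (≐ˢ-trans t₂ (≐ˢ-sym (src-compose γ₃! γ₂! t₃))))
      (≐ˢ-trans (cast≐ˢ (eqL π) (eqR π) (∘-congˡ generic π!))
        (≐ˢ-sym (compose-cong s≐ (compose-cong (≐ˢ-sym q≐) (≐ˢ-sym p≐) t₂)
          (cast≐ˢ (sym (tgt-compose γ₂ γ₁)) refl t₃))))
      where
      k₁ = src n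
      Y₁ = Into Δ (IdCtx Δ) k₁
      k₂ = src n ∘ gen k₁
      ⊢1 = ⊢proj-gen Δ! (⊢src W)
      k₂! : Y₁ ⊢ˢ k₂ ∶ Δ
      k₂! = ⊢∘ (⊢src W) (⊢1 .proj₂)
      Y₂ = Into Δ Y₁ k₂
      ⊢2 = ⊢proj-gen Δ! k₂!
      s = proj n ∘ proj n
      q = gen k₁ ∘ proj n
      p = gen k₂
      s! : Y₂ ⊢ˢ s ∶ IdCtx Δ
      s! = ⊢∘ (⊢1 .proj₁) (⊢2 .proj₁)
      q! : Y₂ ⊢ˢ q ∶ IdCtx Δ
      q! = ⊢∘ (⊢1 .proj₂) (⊢2 .proj₁)
      p! : Y₂ ⊢ˢ p ∶ IdCtx Δ
      p! = ⊢2 .proj₂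
      tq : tgt n ∘ q ≡ src n ∘ s
      tq = trans (∘-cong-assoc (tgt n) (gen k₁) (proj n) (tgt-gen k₁)) (∘-assoc (src n) (proj n) (proj n))
      tp : tgt n ∘ p ≡ src n ∘ q
      tp = trans (tgt-gen k₂) (∘-assoc (src n) (gen k₁) (proj n))
      tq! = ≡⇒≐ˢ tq (⊢∘ (⊢tgt W) q!)
      tp! = ≡⇒≐ˢ tp (⊢∘ (⊢tgt W) p!)
      ρ = lifts n (lifts n (rfl Δ))
      𝓔₂ = Elim-Into 𝓔 Δ! k₂!
      ρ! = ⊢along 𝓔₂
      sq! = ⊢compose s! q! tq!
      qp! = ⊢compose q! p! tp!
      meetL = ≐ˢ-trans tp! (≐ˢ-sym (src-compose s! q! tq!))
      meetR = cast≐ˢ (sym (tgt-compose q p)) refl tq!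
      L! = ⊢compose sq! p! meetL
      R! = ⊢compose s! qp! meetR
      eqL : ∀ {l} (τ : Sub l _) → compose Δ (compose Δ s q) p ∘ τ ≡
                                  compose Δ (compose Δ (s ∘ τ) (q ∘ τ)) (p ∘ τ)
      eqL τ = trans (compose-∘ (compose Δ s q) p τ) (cong (λ υ → compose Δ υ (p ∘ τ)) (compose-∘ s q τ))
      eqR : ∀ {l} (τ : Sub l _) → compose Δ s (compose Δ q p) ∘ τ ≡
                                  compose Δ (s ∘ τ) (compose Δ (q ∘ τ) (p ∘ τ))
      eqR τ = trans (compose-∘ s (compose Δ q p) τ) (cong (compose Δ (s ∘ τ)) (compose-∘ q p τ))
      sρ : s ∘ ρ ≡ rfl Δ ∘ (proj n ∘ proj n)
      sρ = trans (∘-assoc-cong (proj n) (proj n) ρ (proj-lifts n (lifts n (rfl Δ))))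
          (trans (∘-cong-assoc (proj n) (lifts n (rfl Δ)) (proj n) (proj-lifts n (rfl Δ)))
                 (∘-assoc (rfl Δ) (proj n) (proj n)))
      y = proj n ∘ proj n
      Xq! = ⊢∘ q! ρ!
      Xp! = ⊢∘ p! ρ!
      tqρ : _ ⊢ˢ tgt n ∘ (q ∘ ρ) ≐ y ∶ Δ
      tqρ = ≡⇒≐ˢ (trans (∘-cong-assoc (tgt n) q ρ tq)
              (trans (∘-assoc-cong (src n) s ρ sρ) (src-rfl∘ y))) (⊢∘ (⊢tgt W) Xq!)
      tpρ : _ ⊢ˢ tgt n ∘ (p ∘ ρ) ≐ src n ∘ (q ∘ ρ) ∶ Δ
      tpρ = ≡⇒≐ˢ (trans (∘-cong-assoc (tgt n) p ρ tp) (∘-assoc (src n) q ρ)) (⊢∘ (⊢tgt W) Xp!)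
      Xqp! = ⊢compose Xq! Xp! tpρ
      onRfl = ≐ˢ-trans
        (compose-cong (compose-rflˡ Xq! tqρ) (≐ˢ-refl Xp!)
          (≐ˢ-trans tpρ (≐ˢ-sym (src-cong (compose-rflˡ Xq! tqρ)))))
        (≐ˢ-sym (compose-rflˡ Xqp! (cast≐ˢ (sym (tgt-compose _ _)) refl tqρ)))
      generic : Y₂ ⊢ˢ compose Δ (compose Δ s q) p ≐ compose Δ s (compose Δ q p) ∶ IdCtx Δ
      generic = uniq 𝓔₂ Δ! L! R!
        (≐ˢ-trans (src-compose sq! p! meetL)
          (≐ˢ-sym (≐ˢ-trans (src-compose s! qp! meetR) (src-compose q! p! tp!))))
        (≡⇒≐ˢ (trans (tgt-compose _ p) (trans (tgt-compose s q) (sym (tgt-compose s _)))) (⊢∘ (⊢tgt W) L!))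
        (cast≐ˢ (sym (trans (eqL ρ) (cong (λ υ → compose Δ (compose Δ υ (q ∘ ρ)) (p ∘ ρ)) sρ)))
                (sym (trans (eqR ρ) (cong (λ υ → compose Δ υ (compose Δ (q ∘ ρ) (p ∘ ρ))) sρ)))
          onRfl)
      π₁ = pairing n γ₃ γ₂
      pc₁ = pairing-cong Δ! (⊢src W) (≐ˢ-refl γ₃!) (≐ˢ-refl γ₂!) t₃
      t₂′ = ≐ˢ-trans t₂ (cast≐ˢ refl (sym (∘-assoc (src n) (gen k₁) π₁)) (src-cong (≐ˢ-sym (pc₁ .proj₂))))
      π = pairing n π₁ γ₁
      pc₂ = pairing-cong Δ! k₂! (≐ˢ-refl (≐ˢ-left (pc₁ .proj₁))) (≐ˢ-refl γ₁!) t₂′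
      π! : Γ ⊢ˢ π ∶ Y₂
      π! = ≐ˢ-left (pc₂ .proj₁)
      s≐ : Γ ⊢ˢ γ₃ ≐ s ∘ π ∶ IdCtx Δ
      s≐ = ≡⇒≐ˢ (sym (trans (∘-assoc-cong (proj n) (proj n) π (proj-pairing n π₁ γ₁))
                            (proj-pairing n γ₃ γ₂))) γ₃!
      q≐ : Γ ⊢ˢ q ∘ π ≐ γ₂ ∶ IdCtx Δ
      q≐ = cast≐ˢ (sym (∘-assoc-cong (gen k₁) (proj n) π (proj-pairing n π₁ γ₁))) refl (pc₁ .proj₂)
      p≐ : Γ ⊢ˢ p ∘ π ≐ γ₁ ∶ IdCtx Δ
      p≐ = pc₂ .proj₂

  src-bulletᴳ : ∀ {m n} (Γ : Ctx m) (Δ : Ctx n) h → src n ∘ bulletᴳ Γ Δ h ≡ h ∘ src m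
  src-bulletᴳ Γ Δ h = src-inter _ _ _

  tgt-bulletᴳ : ∀ {m n} (Γ : Ctx m) (Δ : Ctx n) h → tgt n ∘ bulletᴳ Γ Δ h ≡ h ∘ tgt m
  tgt-bulletᴳ Γ Δ h = tgt-inter _ _ _

  module _ {m n} {Γ : Ctx m} {Δ : Ctx n} {h : Sub m n} (h! : Γ ⊢ˢ h ∶ Δ) where
    private
      Γ! = ⊢dom h!
      Δ! = ⊢cod h!
      W = wellFormed Γ!
      eq : inter (h ∘ src m ∘ rfl Γ) (h ∘ tgt m ∘ rfl Γ) (pth n (rfl Δ ∘ h)) ≡ rfl Δ ∘ h
      eq = trans (cong₂ (λ s t → inter s t (pth n (rfl Δ ∘ h)))
             (trans (∘-assoc-cong h (src m) (rfl Γ) (src-rfl Γ)) (trans (∘-id h) (sym (src-rfl∘ Δ! h))))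
             (trans (∘-assoc-cong h (tgt m) (rfl Γ) (tgt-rfl Γ)) (trans (∘-id h) (sym (tgt-rfl∘ Δ! h)))))
             (inter-pth n (rfl Δ ∘ h))
      ⊢β = ⊢fill-β (Elim-Id W) Δ! (⊢∘ h! (⊢src W)) (⊢∘ h! (⊢tgt W))
             (castˢ (sym eq) (⊢rfl∘ Δ! h!))

    ⊢bulletᴳ : IdCtx Γ ⊢ˢ bulletᴳ Γ Δ h ∶ IdCtx Δ
    ⊢bulletᴳ = ⊢β .proj₁

    bulletᴳ-rfl : Γ ⊢ˢ bulletᴳ Γ Δ h ∘ rfl Γ ≐ rfl Δ ∘ h ∶ IdCtx Δ
    bulletᴳ-rfl = cast≐ˢ refl eq (⊢β .proj₂)

    bulletᴳ-rfl∘ : ∀ {l} {X : Ctx l} {x} → X ⊢ˢ x ∶ Γ →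
                   X ⊢ˢ bulletᴳ Γ Δ h ∘ (rfl Γ ∘ x) ≐ rfl Δ ∘ (h ∘ x) ∶ IdCtx Δ
    bulletᴳ-rfl∘ {x = x} x! = cast≐ˢ (∘-assoc _ (rfl Γ) x) (∘-assoc (rfl Δ) h x) (∘-congˡ bulletᴳ-rfl x!)

  bulletᴳ-cong : ∀ {m n} {Γ : Ctx m} {Δ : Ctx n} {h h′} → Γ ⊢ˢ h ≐ h′ ∶ Δ →
                 IdCtx Γ ⊢ˢ bulletᴳ Γ Δ h ≐ bulletᴳ Γ Δ h′ ∶ IdCtx Δ
  bulletᴳ-cong {Γ = Γ} {Δ} {h} {h′} hh′ = path-ind Γ! Δ! (⊢bulletᴳ h!) (⊢bulletᴳ h′!)
    (cast≐ˢ (sym (src-bulletᴳ Γ Δ h)) (sym (src-bulletᴳ Γ Δ h′)) (∘-congˡ hh′ (⊢src W)))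
    (cast≐ˢ (sym (tgt-bulletᴳ Γ Δ h)) (sym (tgt-bulletᴳ Γ Δ h′)) (∘-congˡ hh′ (⊢tgt W)))
    (≐ˢ-trans (bulletᴳ-rfl h!) (≐ˢ-trans (∘-congʳ (⊢rfl (wellFormed Δ!)) hh′) (≐ˢ-sym (bulletᴳ-rfl h′!))))
    where
    h! = ≐ˢ-left hh′
    h′! = ≐ˢ-right hh′
    Γ! = ⊢dom h!
    Δ! = ⊢cod h!
    W = wellFormed Γ!

  bulletᴳ-id : ∀ {n} {Δ : Ctx n} → Δ ctx → IdCtx Δ ⊢ˢ bulletᴳ Δ Δ id ≐ id ∶ IdCtx Δ
  bulletᴳ-id {n} {Δ} Δ! = path-ind Δ! Δ! (⊢bulletᴳ id!) (⊢id (IdCtx! W))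
    (≡⇒≐ˢ (trans (src-bulletᴳ Δ Δ id) (trans (id-∘ _) (sym (∘-id _)))) (⊢∘ (⊢src W) (⊢bulletᴳ id!)))
    (≡⇒≐ˢ (trans (tgt-bulletᴳ Δ Δ id) (trans (id-∘ _) (sym (∘-id _)))) (⊢∘ (⊢tgt W) (⊢bulletᴳ id!)))
    (cast≐ˢ refl (trans (∘-id (rfl Δ)) (sym (id-∘ (rfl Δ)))) (bulletᴳ-rfl id!))
    where
    W = wellFormed Δ!
    id! = ⊢id Δ!

  bulletᴳ-∘ : ∀ {l m n} {Γ : Ctx l} {Δ : Ctx m} {Θ : Ctx n} {h k} → Δ ⊢ˢ h ∶ Θ → Γ ⊢ˢ k ∶ Δ →
              IdCtx Γ ⊢ˢ bulletᴳ Γ Θ (h ∘ k) ≐ bulletᴳ Δ Θ h ∘ bulletᴳ Γ Δ k ∶ IdCtx Θ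
  bulletᴳ-∘ {l} {m} {n} {Γ} {Δ} {Θ} {h} {k} h! k! = path-ind Γ! Θ! (⊢bulletᴳ hk!) R!
    (≡⇒≐ˢ (trans (src-bulletᴳ Γ Θ _) (sym (trans (∘-cong-assoc (src n) _ _ (src-bulletᴳ Δ Θ h))
            (trans (∘-assoc-cong h (src m) _ (src-bulletᴳ Γ Δ k)) (sym (∘-assoc h k (src l)))))))
          (⊢∘ (⊢src (wellFormed Θ!)) (⊢bulletᴳ hk!)))
    (≡⇒≐ˢ (trans (tgt-bulletᴳ Γ Θ _) (sym (trans (∘-cong-assoc (tgt n) _ _ (tgt-bulletᴳ Δ Θ h))
            (trans (∘-assoc-cong h (tgt m) _ (tgt-bulletᴳ Γ Δ k)) (sym (∘-assoc h k (tgt l)))))))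
          (⊢∘ (⊢tgt (wellFormed Θ!)) (⊢bulletᴳ hk!)))
    (≐ˢ-trans (bulletᴳ-rfl hk!) (≐ˢ-sym (≐ˢ-trans
      (cast≐ˢ (sym (∘-assoc _ _ _)) refl (∘-congʳ (⊢bulletᴳ h!) (bulletᴳ-rfl k!)))
      (bulletᴳ-rfl∘ h! k!))))
    where
    Γ! = ⊢dom k!
    Θ! = ⊢cod h!
    hk! = ⊢∘ h! k!
    R! = ⊢∘ (⊢bulletᴳ h!) (⊢bulletᴳ k!)

  bulletᴳ-compose : ∀ {l m n} {X : Ctx l} {Γ : Ctx m} {Δ : Ctx n} {h γ₂ γ₁} → Γ ⊢ˢ h ∶ Δ →
    X ⊢ˢ γ₂ ∶ IdCtx Γ → X ⊢ˢ γ₁ ∶ IdCtx Γ → X ⊢ˢ tgt m ∘ γ₁ ≐ src m ∘ γ₂ ∶ Γ →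
    X ⊢ˢ bulletᴳ Γ Δ h ∘ compose Γ γ₂ γ₁ ≐
         compose Δ (bulletᴳ Γ Δ h ∘ γ₂) (bulletᴳ Γ Δ h ∘ γ₁) ∶ IdCtx Δ
  bulletᴳ-compose {l} {m} {n} {X} {Γ} {Δ} {h} {γ₂} {γ₁} h! γ₂! γ₁! t = ≐ˢ-trans
    (cast≐ˢ (trans (∘-assoc B (compose Γ q p) π) (cong (B ∘_) (∘-assoc-id)))
            (trans (compose-∘ Δ! (B ∘ q) (B ∘ p) π)
              (cong₂ (compose Δ) (∘-assoc-cong B q π (proj-pairing m γ₂ γ₁)) (∘-assoc B p π)))
      (∘-congˡ generic π!))
    (compose-cong Δ! (≐ˢ-refl (⊢∘ B! γ₂!)) (∘-congʳ B! (pc .proj₂))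
      (cast≐ˢ (sym (endT (p ∘ π))) (sym (endS γ₂)) (∘-congʳ h! (≐ˢ-trans (tgt-cong Γ! (pc .proj₂)) t))))
    where
    Γ! = ⊢dom h!
    Δ! = ⊢cod h!
    W = wellFormed Γ!
    B = bulletᴳ Γ Δ h
    B! = ⊢bulletᴳ h!
    q = proj {trip m} m
    p = gen (src m)
    Y = Into Γ (IdCtx Γ) (src m)
    q! : Y ⊢ˢ q ∶ IdCtx Γ
    q! = ⊢proj-gen Γ! (⊢src W) .proj₁
    p! : Y ⊢ˢ p ∶ IdCtx Γ
    p! = ⊢proj-gen Γ! (⊢src W) .proj₂
    π = pairing m γ₂ γ₁
    pc = pairing-cong Γ! (⊢src W) (≐ˢ-refl γ₂!) (≐ˢ-refl γ₁!) t
    π! = ≐ˢ-left (pc .proj₁)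
    pairing-gen : ∀ {a i} j (k : Sub i j) (κ : Sub a i) γ →
                  pairing j (proj {i} j) (gen k) ∘ pairing j κ γ ≡ pairing j κ γ
    pairing-gen j k κ γ = trans (pairing-∘ j (proj j) (gen k) (pairing j κ γ))
      (trans (cong (λ υ → pairing j υ (gen k ∘ pairing j κ γ)) (proj-pairing j κ γ)) (aux j k κ γ))
      where
      aux : ∀ {a i} j (k : Sub i j) (κ : Sub a i) γ → pairing j κ (gen k ∘ pairing j κ γ) ≡ pairing j κ γ
      aux zero    []      κ []              = refl
      aux (suc j) (b ∷ k) κ (q ∷ c ∷ a ∷ γ) = cong₂ _∷_ (var-[] zero _) (cong₂ _∷_ (var-[] (suc zero) _)
        (trans (cong (pairing j κ) (∘wk²-∷ (gen k) q a _)) (aux j k κ γ)))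
    ∘-assoc-id : compose Γ q p ∘ π ≡ compose Γ γ₂ γ₁
    ∘-assoc-id = ∘-assoc-cong (compᴳ Γ) _ π (pairing-gen m (src m) γ₂ γ₁)
    endS : ∀ {i} (γ : Sub i (trip m)) → src n ∘ (B ∘ γ) ≡ h ∘ (src m ∘ γ)
    endS γ = trans (∘-cong-assoc (src n) B γ (src-bulletᴳ Γ Δ h)) (∘-assoc h (src m) γ)
    endT : ∀ {i} (γ : Sub i (trip m)) → tgt n ∘ (B ∘ γ) ≡ h ∘ (tgt m ∘ γ)
    endT γ = trans (∘-cong-assoc (tgt n) B γ (tgt-bulletᴳ Γ Δ h)) (∘-assoc h (tgt m) γ)
    tp! : Y ⊢ˢ tgt m ∘ p ≐ src m ∘ q ∶ Γ
    tp! = ≡⇒≐ˢ (tgt-gen (src m)) (⊢∘ (⊢tgt W) p!)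
    meet : Y ⊢ˢ tgt n ∘ (B ∘ p) ≐ src n ∘ (B ∘ q) ∶ Δ
    meet = cast≐ˢ (sym (endT p)) (sym (endS q)) (∘-congʳ h! tp!)
    qp! = ⊢compose Γ! q! p! tp!
    Bq! = ⊢∘ B! q!
    Bp! = ⊢∘ B! p!
    ρ = lifts m (rfl Γ)
    ρ! = ⊢along (Elim-Into (Elim-Id W) Γ! (⊢src W))
    Z = Into Γ Γ (src m ∘ rfl Γ)
    ⊢Z = ⊢proj-gen Γ! (⊢∘ (⊢src W) (⊢rfl W))
    qρ : q ∘ ρ ≡ rfl Γ ∘ proj m
    qρ = proj-lifts m (rfl Γ)
    tpρ : Z ⊢ˢ tgt m ∘ (p ∘ ρ) ≐ proj m ∶ Γ
    tpρ = ≡⇒≐ˢ (trans (∘-cong-assoc (tgt m) p ρ (tgt-gen (src m)))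
            (trans (∘-assoc-cong (src m) q ρ qρ) (src-rfl∘ Γ! (proj m)))) (⊢∘ (⊢tgt W) (⊢∘ p! ρ!))
    Lρ : Z ⊢ˢ B ∘ compose Γ q p ∘ ρ ≐ B ∘ (p ∘ ρ) ∶ IdCtx Δ
    Lρ = cast≐ˢ (sym (∘-assoc-cong B (compose Γ q p) ρ
                   (trans (compose-∘ Γ! q p ρ) (cong (λ υ → compose Γ υ (p ∘ ρ)) qρ)))) refl
           (∘-congʳ B! (compose-rflˡ Γ! (⊢∘ p! ρ!) tpρ))
    BtgtZ : Z ⊢ˢ tgt n ∘ (B ∘ (p ∘ ρ)) ≐ h ∘ proj m ∶ Δ
    BtgtZ = cast≐ˢ (sym (endT (p ∘ ρ))) refl (∘-congʳ h! tpρ)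
    Rρ : Z ⊢ˢ compose Δ (B ∘ q) (B ∘ p) ∘ ρ ≐ B ∘ (p ∘ ρ) ∶ IdCtx Δ
    Rρ = cast≐ˢ (sym (trans (compose-∘ Δ! (B ∘ q) (B ∘ p) ρ)
                   (cong₂ (compose Δ) (∘-assoc-cong B q ρ qρ) (∘-assoc B p ρ)))) refl
      (≐ˢ-trans
        (compose-cong Δ! (bulletᴳ-rfl∘ h! (⊢Z .proj₁)) (≐ˢ-refl (⊢∘ B! (⊢∘ p! ρ!)))
          (≐ˢ-trans BtgtZ (≡⇒≐ˢ (sym (trans (endS _) (cong (h ∘_) (src-rfl∘ Γ! _)))) (⊢∘ h! (⊢Z .proj₁)))))
        (compose-rflˡ Δ! (⊢∘ B! (⊢∘ p! ρ!)) BtgtZ))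
    generic : Y ⊢ˢ B ∘ compose Γ q p ≐ compose Δ (B ∘ q) (B ∘ p) ∶ IdCtx Δ
    generic = path-ind₂ Γ! Δ! (⊢∘ B! qp!) (⊢compose Δ! Bq! Bp! meet)
      (≐ˢ-trans (cast≐ˢ (sym (endS _)) (sym (endS p)) (∘-congʳ h! (src-compose Γ! q! p! tp!)))
                (≐ˢ-sym (src-compose Δ! Bq! Bp! meet)))
      (≡⇒≐ˢ (trans (endT _) (trans (cong (h ∘_) (tgt-compose Γ! q p))
              (sym (trans (tgt-compose Δ! _ _) (endT q))))) (⊢∘ (⊢tgt (wellFormed Δ!)) (⊢∘ B! qp!)))
      (≐ˢ-trans Lρ (≐ˢ-sym Rρ))

  interchangeᴳ : ∀ {l m n} {X : Ctx l} {Γ : Ctx m} {Δ : Ctx n} {h k α γ} →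
    Γ ⊢ˢ h ∶ Δ → Γ ⊢ˢ k ∶ Δ → Γ ⊢ˢ α ∶ IdCtx Δ →
    Γ ⊢ˢ src n ∘ α ≐ h ∶ Δ → Γ ⊢ˢ tgt n ∘ α ≐ k ∶ Δ → X ⊢ˢ γ ∶ IdCtx Γ →
    X ⊢ˢ compose Δ (α ∘ (tgt m ∘ γ)) (bulletᴳ Γ Δ h ∘ γ) ≐
         compose Δ (bulletᴳ Γ Δ k ∘ γ) (α ∘ (src m ∘ γ)) ∶ IdCtx Δ
  interchangeᴳ {l} {m} {n} {X} {Γ} {Δ} {h} {k} {α} {γ} h! k! α! s t γ! = cast≐ˢ
    (trans (compose-∘ Δ! (α ∘ tgt m) H γ) (cong (λ υ → compose Δ υ (H ∘ γ)) (∘-assoc α (tgt m) γ)))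
    (trans (compose-∘ Δ! K (α ∘ src m) γ) (cong (compose Δ (K ∘ γ)) (∘-assoc α (src m) γ)))
    (∘-congˡ generic γ!)
    where
    Γ! = ⊢dom h!
    Δ! = ⊢cod h!
    W = wellFormed Γ!
    H = bulletᴳ Γ Δ h
    K = bulletᴳ Γ Δ k
    H! = ⊢bulletᴳ h!
    K! = ⊢bulletᴳ k!
    αt! = ⊢∘ α! (⊢tgt W)
    αs! = ⊢∘ α! (⊢src W)
    meetL : IdCtx Γ ⊢ˢ tgt n ∘ H ≐ src n ∘ (α ∘ tgt m) ∶ Δ
    meetL = cast≐ˢ (sym (tgt-bulletᴳ Γ Δ h)) (∘-assoc (src n) α (tgt m)) (∘-congˡ (≐ˢ-sym s) (⊢tgt W))
    meetR : IdCtx Γ ⊢ˢ tgt n ∘ (α ∘ src m) ≐ src n ∘ K ∶ Δ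
    meetR = cast≐ˢ (∘-assoc (tgt n) α (src m)) (sym (src-bulletᴳ Γ Δ k)) (∘-congˡ t (⊢src W))
    L! = ⊢compose Δ! αt! H! meetL
    R! = ⊢compose Δ! K! αs! meetR
    α∘t : α ∘ tgt m ∘ rfl Γ ≡ α
    α∘t = trans (∘-assoc-cong α (tgt m) (rfl Γ) (tgt-rfl Γ)) (∘-id α)
    α∘s : α ∘ src m ∘ rfl Γ ≡ α
    α∘s = trans (∘-assoc-cong α (src m) (rfl Γ) (src-rfl Γ)) (∘-id α)
    onRflL : Γ ⊢ˢ compose Δ α (H ∘ rfl Γ) ≐ α ∶ IdCtx Δ
    onRflL = ≐ˢ-trans (compose-cong Δ! (≐ˢ-refl α!) (bulletᴳ-rfl h!)
        (cast≐ˢ (trans (∘-assoc (tgt n) H (rfl Γ)) refl)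
          (trans (∘-assoc-cong (src n) (α ∘ tgt m) (rfl Γ) α∘t) refl) (∘-congˡ meetL (⊢rfl W))))
      (compose-rflʳ Δ! α! s)
    onRflR : Γ ⊢ˢ compose Δ (K ∘ rfl Γ) α ≐ α ∶ IdCtx Δ
    onRflR = ≐ˢ-trans (compose-cong Δ! (bulletᴳ-rfl k!) (≐ˢ-refl α!)
        (cast≐ˢ (∘-assoc-cong (tgt n) (α ∘ src m) (rfl Γ) α∘s)
          (∘-assoc (src n) K (rfl Γ)) (∘-congˡ meetR (⊢rfl W))))
      (compose-rflˡ Δ! α! t)
    generic : IdCtx Γ ⊢ˢ compose Δ (α ∘ tgt m) H ≐ compose Δ K (α ∘ src m) ∶ IdCtx Δ
    generic = path-ind Γ! Δ! L! R!
      (≐ˢ-trans (src-compose Δ! αt! H! meetL)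
        (≐ˢ-trans (cast≐ˢ (sym (src-bulletᴳ Γ Δ h)) (∘-assoc (src n) α (src m)) (∘-congˡ (≐ˢ-sym s) (⊢src W)))
          (≐ˢ-sym (src-compose Δ! K! αs! meetR))))
      (cast≐ˢ (sym (trans (tgt-compose Δ! _ _) (sym (∘-assoc (tgt n) α (tgt m)))))
              (sym (trans (tgt-compose Δ! _ _) (tgt-bulletᴳ Γ Δ k))) (∘-congˡ t (⊢tgt W)))
      (cast≐ˢ (sym (trans (compose-∘ Δ! _ _ (rfl Γ)) (cong (λ υ → compose Δ υ (H ∘ rfl Γ)) α∘t)))
              (sym (trans (compose-∘ Δ! _ _ (rfl Γ)) (cong (compose Δ (K ∘ rfl Γ)) α∘s)))
        (≐ˢ-trans onRflL (≐ˢ-sym onRflR)))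

module Contexts {ℓ} (S : TypeTheory ℓ) (M : ML₂ S) where
  open TypeTheory S
  open ML₂ M
  open Substitution S
  open Paths S M
  open Cells S M
  open Composition S M
  open WellFormed

  record Context : Set ℓ where
    constructor context
    field
      {len}  : ℕ
      {tele} : Ctx len
      ⊢ctx   : tele ctx
  open Context public

  record Morphism (Γ Δ : Context) : Set ℓ where
    constructor morphism
    field
      sub  : Sub (len Γ) (len Δ)
      ⊢sub : tele Γ ⊢ˢ sub ∶ tele Δ
  open Morphism public

  -- A judgement Γ ⊢ path : Id_Δ (f , g).
  record 2Cell {Γ Δ : Context} (f g : Morphism Γ Δ) : Set ℓ where
    constructor 2cell
    field
      path  : Vec (Tm (len Γ)) (len Δ)
      ⊢path : tele Γ ⊢ˢ inter (sub f) (sub g) path ∶ IdCtx (tele Δ)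
  open 2Cell public

  span : ∀ {Γ Δ} {f g : Morphism Γ Δ} → 2Cell f g → Sub (len Γ) (trip (len Δ))
  span {f = f} {g} α = inter (sub f) (sub g) (path α)

  module _ {Γ Δ : Context} where
    src-span : ∀ {f g : Morphism Γ Δ} (α : 2Cell f g) → src (len Δ) ∘ span α ≡ sub f
    src-span {f} {g} α = src-inter (sub f) (sub g) (path α)

    tgt-span : ∀ {f g : Morphism Γ Δ} (α : 2Cell f g) → tgt (len Δ) ∘ span α ≡ sub g
    tgt-span {f} {g} α = tgt-inter (sub f) (sub g) (path α)

    fromPath : ∀ {f g : Morphism Γ Δ} {γ} → tele Γ ⊢ˢ γ ∶ IdCtx (tele Δ) →
               tele Γ ⊢ˢ src (len Δ) ∘ γ ≐ sub f ∶ tele Δ →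
               tele Γ ⊢ˢ tgt (len Δ) ∘ γ ≐ sub g ∶ tele Δ →
               Σ[ α ∈ 2Cell f g ] (tele Γ ⊢ˢ span α ≐ γ ∶ IdCtx (tele Δ))
    fromPath {γ = γ} γ! s t = 2cell (pth (len Δ) γ) (≐ˢ-right e) , ≐ˢ-sym e
      where e = respan (⊢ctx Δ) γ! s t

    private
      id′ : (f : Morphism Γ Δ) → Σ[ α ∈ 2Cell f f ] (tele Γ ⊢ˢ span α ≐ rfl (tele Δ) ∘ sub f ∶ IdCtx (tele Δ))
      id′ f = fromPath γ! (≡⇒≐ˢ (src-rfl∘ (⊢ctx Δ) (sub f)) (⊢∘ (⊢src W) γ!))
                          (≡⇒≐ˢ (tgt-rfl∘ (⊢ctx Δ) (sub f)) (⊢∘ (⊢tgt W) γ!))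
        where
        W = wellFormed (⊢ctx Δ)
        γ! = ⊢rfl∘ (⊢ctx Δ) (⊢sub f)

    idCell : (f : Morphism Γ Δ) → 2Cell f f
    idCell f = proj₁ (id′ f)

    span-id : (f : Morphism Γ Δ) → tele Γ ⊢ˢ span (idCell f) ≐ rfl (tele Δ) ∘ sub f ∶ IdCtx (tele Δ)
    span-id f = proj₂ (id′ f)

    meet : ∀ {f g h : Morphism Γ Δ} (β : 2Cell g h) (α : 2Cell f g) →
           tele Γ ⊢ˢ tgt (len Δ) ∘ span α ≐ src (len Δ) ∘ span β ∶ tele Δ
    meet β α = ≡⇒≐ˢ (trans (tgt-span α) (sym (src-span β))) (⊢∘ (⊢tgt (wellFormed (⊢ctx Δ))) (⊢path α))

    private
      comp′ : ∀ {f g h : Morphism Γ Δ} (β : 2Cell g h) (α : 2Cell f g) →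
              Σ[ δ ∈ 2Cell f h ] (tele Γ ⊢ˢ span δ ≐ compose (tele Δ) (span β) (span α) ∶ IdCtx (tele Δ))
      comp′ β α = fromPath γ!
        (cast≐ˢ refl (src-span α) (src-compose (⊢ctx Δ) (⊢path β) (⊢path α) (meet β α)))
        (≡⇒≐ˢ (trans (tgt-compose (⊢ctx Δ) (span β) (span α)) (tgt-span β)) (⊢∘ (⊢tgt (wellFormed (⊢ctx Δ))) γ!))
        where γ! = ⊢compose (⊢ctx Δ) (⊢path β) (⊢path α) (meet β α)

    _∙_ : ∀ {f g h : Morphism Γ Δ} → 2Cell g h → 2Cell f g → 2Cell f h
    β ∙ α = proj₁ (comp′ β α)

    span-∙ : ∀ {f g h : Morphism Γ Δ} (β : 2Cell g h) (α : 2Cell f g) →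
             tele Γ ⊢ˢ span (β ∙ α) ≐ compose (tele Δ) (span β) (span α) ∶ IdCtx (tele Δ)
    span-∙ β α = proj₂ (comp′ β α)

    private
      coe′ : ∀ {f g f′ g′ : Morphism Γ Δ} → tele Γ ⊢ˢ sub f ≐ sub f′ ∶ tele Δ →
             tele Γ ⊢ˢ sub g ≐ sub g′ ∶ tele Δ → (α : 2Cell f g) →
             Σ[ δ ∈ 2Cell f′ g′ ] (tele Γ ⊢ˢ span δ ≐ span α ∶ IdCtx (tele Δ))
      coe′ p q α = fromPath (⊢path α) (cast≐ˢ (sym (src-span α)) refl p) (cast≐ˢ (sym (tgt-span α)) refl q)

    coeCell : ∀ {f g f′ g′ : Morphism Γ Δ} → tele Γ ⊢ˢ sub f ≐ sub f′ ∶ tele Δ →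
              tele Γ ⊢ˢ sub g ≐ sub g′ ∶ tele Δ → 2Cell f g → 2Cell f′ g′
    coeCell {f′ = f′} {g′} p q α = proj₁ (coe′ {f′ = f′} {g′} p q α)

    span-coe : ∀ {f g f′ g′ : Morphism Γ Δ} (p : tele Γ ⊢ˢ sub f ≐ sub f′ ∶ tele Δ)
               (q : tele Γ ⊢ˢ sub g ≐ sub g′ ∶ tele Δ) (α : 2Cell f g) →
               tele Γ ⊢ˢ span (coeCell {f′ = f′} {g′} p q α) ≐ span α ∶ IdCtx (tele Δ)
    span-coe {f′ = f′} {g′} p q α = proj₂ (coe′ {f′ = f′} {g′} p q α)

    _≈ᵐ_ : Morphism Γ Δ → Morphism Γ Δ → Set ℓ
    f ≈ᵐ g = tele Γ ⊢ˢ sub f ≐ sub g ∶ tele Δ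

    _≋ᶜ_ : {f g f′ g′ : Morphism Γ Δ} → 2Cell f g → 2Cell f′ g′ → Set ℓ
    α ≋ᶜ β = tele Γ ⊢ˢ span α ≐ span β ∶ IdCtx (tele Δ)

  homCtx : Context → Context → Category ℓ
  homCtx Γ Δ = record
    { Obj = Morphism Γ Δ
    ; _≈_ = _≈ᵐ_
    ; ≈-isEquivalence = record
      { refl = λ {f} → ≐ˢ-refl (⊢sub f) ; sym = ≐ˢ-sym ; trans = ≐ˢ-trans }
    ; Hom = 2Cell
    ; _≋_ = _≋ᶜ_
    ; ≋-refl = λ {f} {g} {α} → ≐ˢ-refl (⊢path α)
    ; ≋-sym = ≐ˢ-sym
    ; ≋-trans = ≐ˢ-trans
    ; ≋-dom = λ {_} {_} {_} {_} {α} {β} p → cast≐ˢ (src-span α) (src-span β) (src-cong (⊢ctx Δ) p)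
    ; ≋-cod = λ {_} {_} {_} {_} {α} {β} p → cast≐ˢ (tgt-span α) (tgt-span β) (tgt-cong (⊢ctx Δ) p)
    ; coe = coeCell
    ; coe-≋ = λ {_} {_} {f} {g} → span-coe {f′ = f} {g}
    ; id = idCell
    ; _∘_ = _∙_
    ; id-cong = λ {f} {g} p → ≐ˢ-trans (span-id f) (≐ˢ-trans (∘-congʳ (⊢rfl W) p) (≐ˢ-sym (span-id g)))
    ; ∘-cong = λ {_} {_} {_} {_} {_} {_} {β} {β′} {α} {α′} p q →
        ≐ˢ-trans (span-∙ β α) (≐ˢ-trans (compose-cong (⊢ctx Δ) p q (meet β α)) (≐ˢ-sym (span-∙ β′ α′)))
    ; assoc = λ γ β α →
        ≐ˢ-trans (span-∙ (γ ∙ β) α)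
        (≐ˢ-trans (compose-cong (⊢ctx Δ) (span-∙ γ β) (≐ˢ-refl (⊢path α)) (meet (γ ∙ β) α))
        (≐ˢ-trans (compose-assoc (⊢ctx Δ) (⊢path γ) (⊢path β) (⊢path α) (meet γ β) (meet β α))
        (≐ˢ-trans (compose-cong (⊢ctx Δ) (≐ˢ-refl (⊢path γ)) (≐ˢ-sym (span-∙ β α))
                    (cast≐ˢ (sym (tgt-compose (⊢ctx Δ) (span β) (span α))) refl (meet γ β)))
                  (≐ˢ-sym (span-∙ γ (β ∙ α))))))
    ; idˡ = λ {f} {g} α → ≐ˢ-trans (span-∙ (idCell g) α)
        (≐ˢ-trans (compose-cong (⊢ctx Δ) (span-id g) (≐ˢ-refl (⊢path α)) (meet (idCell g) α))
          (compose-rflˡ (⊢ctx Δ) (⊢path α) (≡⇒≐ˢ (tgt-span α) (⊢∘ (⊢tgt W) (⊢path α)))))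
    ; idʳ = λ {f} {g} α → ≐ˢ-trans (span-∙ α (idCell f))
        (≐ˢ-trans (compose-cong (⊢ctx Δ) (≐ˢ-refl (⊢path α)) (span-id f) (meet α (idCell f)))
          (compose-rflʳ (⊢ctx Δ) (⊢path α) (≡⇒≐ˢ (src-span α) (⊢∘ (⊢src W) (⊢path α)))))
    }
    where W = wellFormed (⊢ctx Δ)

  _∘ᵐ_ : ∀ {Γ Δ Θ} → Morphism Δ Θ → Morphism Γ Δ → Morphism Γ Θ
  g ∘ᵐ f = morphism (sub g ∘ sub f) (⊢∘ (⊢sub g) (⊢sub f))

  idᵐ : ∀ Γ → Morphism Γ Γ
  idᵐ Γ = morphism id (⊢id (⊢ctx Γ))

  bullet : ∀ {Γ Δ} → Morphism Γ Δ → Sub (trip (len Γ)) (trip (len Δ))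
  bullet {Γ} {Δ} h = bulletᴳ (tele Γ) (tele Δ) (sub h)

  module _ {Γ Δ Θ : Context} where
    private
      bullet′ : (h : Morphism Δ Θ) {f g : Morphism Γ Δ} (α : 2Cell f g) →
                Σ[ δ ∈ 2Cell (h ∘ᵐ f) (h ∘ᵐ g) ] (tele Γ ⊢ˢ span δ ≐ bullet h ∘ span α ∶ IdCtx (tele Θ))
      bullet′ h α = fromPath γ!
        (≡⇒≐ˢ (trans (∘-cong-assoc (src _) (bullet h) (span α) (src-bulletᴳ (tele Δ) (tele Θ) (sub h)))
                (∘-assoc-cong (sub h) (src _) (span α) (src-span α))) (⊢∘ (⊢src (wellFormed (⊢ctx Θ))) γ!))
        (≡⇒≐ˢ (trans (∘-cong-assoc (tgt _) (bullet h) (span α) (tgt-bulletᴳ (tele Δ) (tele Θ) (sub h)))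
                (∘-assoc-cong (sub h) (tgt _) (span α) (tgt-span α))) (⊢∘ (⊢tgt (wellFormed (⊢ctx Θ))) γ!))
        where γ! = ⊢∘ (⊢bulletᴳ (⊢sub h)) (⊢path α)

    _▹ᶜ_ : (h : Morphism Δ Θ) {f g : Morphism Γ Δ} → 2Cell f g → 2Cell (h ∘ᵐ f) (h ∘ᵐ g)
    h ▹ᶜ α = proj₁ (bullet′ h α)

    span-▹ : (h : Morphism Δ Θ) {f g : Morphism Γ Δ} (α : 2Cell f g) →
             tele Γ ⊢ˢ span (h ▹ᶜ α) ≐ bullet h ∘ span α ∶ IdCtx (tele Θ)
    span-▹ h α = proj₂ (bullet′ h α)

    _◃ᶜ_ : {f g : Morphism Δ Θ} → 2Cell f g → (k : Morphism Γ Δ) → 2Cell (f ∘ᵐ k) (g ∘ᵐ k)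
    _◃ᶜ_ {f} {g} α k = 2cell (map (_[ sub k ]) (path α))
      (castˢ (inter-∘ (sub f) (sub g) (path α) (sub k)) (⊢∘ (⊢path α) (⊢sub k)))

    span-◃ : {f g : Morphism Δ Θ} (α : 2Cell f g) (k : Morphism Γ Δ) →
             span (α ◃ᶜ k) ≡ span α ∘ sub k
    span-◃ {f} {g} α k = sym (inter-∘ (sub f) (sub g) (path α) (sub k))

    span-◃≐ : {f g : Morphism Δ Θ} (α : 2Cell f g) (k : Morphism Γ Δ) →
             tele Γ ⊢ˢ span (α ◃ᶜ k) ≐ span α ∘ sub k ∶ IdCtx (tele Θ)
    span-◃≐ α k = ≡⇒≐ˢ (span-◃ α k) (⊢path (α ◃ᶜ k))

  ℭ : 2-Category ℓ
  ℭ = record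
    { Ob = Context
    ; hom = homCtx
    ; id₁ = idᵐ
    ; _∘₁_ = _∘ᵐ_
    ; _▹_ = _▹ᶜ_
    ; _◃_ = _◃ᶜ_
    ; ∘₁-cong = ∘-cong
    ; ∘₁-assoc = λ h g f → ≡⇒≐ˢ (∘-assoc (sub h) (sub g) (sub f)) (⊢∘ (⊢∘ (⊢sub h) (⊢sub g)) (⊢sub f))
    ; ∘₁-idˡ = λ {_} {y} f → ≡⇒≐ˢ (id-∘ (sub f)) (⊢∘ (⊢sub (idᵐ y)) (⊢sub f))
    ; ∘₁-idʳ = λ {x} f → ≡⇒≐ˢ (∘-id (sub f)) (⊢∘ (⊢sub f) (⊢sub (idᵐ x)))
    ; ▹-cong = λ {_} {_} {_} {h} {h′} {_} {_} {_} {_} {α} {α′} p q →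
        ≐ˢ-trans (span-▹ h α) (≐ˢ-trans (∘-cong (bulletᴳ-cong p) q) (≐ˢ-sym (span-▹ h′ α′)))
    ; ◃-cong = λ {_} {_} {_} {k} {k′} {_} {_} {_} {_} {α} {α′} p q →
        cast≐ˢ (sym (span-◃ α k)) (sym (span-◃ α′ k′)) (∘-cong p q)
    ; ▹-id = λ h f → ≐ˢ-trans (span-▹ h (idCell f))
        (≐ˢ-trans (∘-congʳ (⊢bulletᴳ (⊢sub h)) (span-id f))
        (≐ˢ-trans (bulletᴳ-rfl∘ (⊢sub h) (⊢sub f)) (≐ˢ-sym (span-id (h ∘ᵐ f)))))
    ; ◃-id = λ {_} {_} {z} f k → ≐ˢ-trans (span-◃≐ (idCell f) k)
        (≐ˢ-trans (∘-congˡ (span-id f) (⊢sub k))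
        (≐ˢ-trans (≡⇒≐ˢ (∘-assoc (rfl (tele z)) (sub f) (sub k)) (⊢∘ (⊢rfl∘ (⊢ctx z) (⊢sub f)) (⊢sub k)))
          (≐ˢ-sym (span-id (f ∘ᵐ k)))))
    ; ▹-∘ = λ {_} {y} {z} h β α → ≐ˢ-trans (span-▹ h (β ∙ α))
        (≐ˢ-trans (∘-congʳ (⊢bulletᴳ (⊢sub h)) (span-∙ β α))
        (≐ˢ-trans (bulletᴳ-compose (⊢sub h) (⊢path β) (⊢path α) (meet β α))
        (≐ˢ-trans (≐ˢ-sym (compose-cong (⊢ctx z) (span-▹ h β) (span-▹ h α) (meet (h ▹ᶜ β) (h ▹ᶜ α))))
          (≐ˢ-sym (span-∙ (h ▹ᶜ β) (h ▹ᶜ α))))))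
    ; ◃-∘ = λ {_} {_} {z} β α k → ≐ˢ-trans (span-◃≐ (β ∙ α) k)
        (≐ˢ-trans (∘-congˡ (span-∙ β α) (⊢sub k))
        (≐ˢ-trans (≡⇒≐ˢ (trans (compose-∘ (⊢ctx z) (span β) (span α) (sub k))
                          (cong₂ (compose (tele z)) (sym (span-◃ β k)) (sym (span-◃ α k))))
                        (⊢∘ (≐ˢ-right (span-∙ β α)) (⊢sub k)))
          (≐ˢ-sym (span-∙ (β ◃ᶜ k) (α ◃ᶜ k)))))
    ; ▹-id₁ = λ {_} {y} α → ≐ˢ-trans (span-▹ (idᵐ y) α)
        (cast≐ˢ refl (id-∘ (span α)) (∘-congˡ (bulletᴳ-id (⊢ctx y)) (⊢path α)))
    ; ◃-id₁ = λ {x} α → ≐ˢ-trans (span-◃≐ α (idᵐ x))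
        (≡⇒≐ˢ (∘-id (span α)) (⊢∘ (⊢path α) (⊢id (⊢ctx x))))
    ; ▹-∘₁ = λ h k α → ≐ˢ-trans (span-▹ (h ∘ᵐ k) α)
        (≐ˢ-trans (∘-congˡ (bulletᴳ-∘ (⊢sub h) (⊢sub k)) (⊢path α))
        (≐ˢ-trans (cast≐ˢ (sym (∘-assoc (bullet h) (bullet k) (span α))) refl
                    (∘-congʳ (⊢bulletᴳ (⊢sub h)) (≐ˢ-sym (span-▹ k α))))
          (≐ˢ-sym (span-▹ h (k ▹ᶜ α)))))
    ; ◃-∘₁ = λ α h k → ≐ˢ-trans (span-◃≐ α (h ∘ᵐ k))
        (≡⇒≐ˢ (trans (sym (∘-assoc (span α) (sub h) (sub k)))
                 (trans (cong (_∘ sub k) (sym (span-◃ α h))) (sym (span-◃ (α ◃ᶜ h) k))))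
              (⊢∘ (⊢path α) (⊢sub (h ∘ᵐ k))))
    ; ▹-◃ = λ h α k → ≐ˢ-trans (span-◃≐ (h ▹ᶜ α) k)
        (≐ˢ-trans (∘-congˡ (span-▹ h α) (⊢sub k))
        (≐ˢ-trans (≡⇒≐ˢ (∘-assoc-cong (bullet h) (span α) (sub k) (sym (span-◃ α k)))
                        (⊢∘ (≐ˢ-right (span-▹ h α)) (⊢sub k)))
          (≐ˢ-sym (span-▹ h (α ◃ᶜ k)))))
    ; interchange = λ {_} {y} {z} {h} {k} {f} {g} β α →
        ≐ˢ-trans (span-∙ (β ◃ᶜ g) (h ▹ᶜ α))
        (≐ˢ-trans (compose-cong (⊢ctx z)
            (≡⇒≐ˢ (trans (span-◃ β g) (cong (span β ∘_) (sym (tgt-span α)))) (⊢path (β ◃ᶜ g)))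
            (span-▹ h α) (meet (β ◃ᶜ g) (h ▹ᶜ α)))
        (≐ˢ-trans (interchangeᴳ (⊢sub h) (⊢sub k) (⊢path β)
            (≡⇒≐ˢ (src-span β) (⊢∘ (⊢src (wellFormed (⊢ctx z))) (⊢path β)))
            (≡⇒≐ˢ (tgt-span β) (⊢∘ (⊢tgt (wellFormed (⊢ctx z))) (⊢path β))) (⊢path α))
        (≐ˢ-trans (≐ˢ-sym (compose-cong (⊢ctx z) (span-▹ k α)
            (≡⇒≐ˢ (trans (span-◃ β f) (cong (span β ∘_) (sym (src-span α)))) (⊢path (β ◃ᶜ f)))
            (meet (k ▹ᶜ α) (β ◃ᶜ f))))
          (≐ˢ-sym (span-∙ (k ▹ᶜ α) (β ◃ᶜ f))))))
    }

module FibreCells {ℓ} (S : TypeTheory ℓ) (M : ML₂ S) where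
  open TypeTheory S
  open ML₂ M
  open Substitution S
  open Paths S M
  open Cells S M
  open Composition S M
  open WellFormed
  open Elim

  v3 : ∀ {n} → Tm (suc (suc (suc (suc n))))
  v3 = var (suc (suc (suc zero)))

  -- q ∘ p, in the context y, z : B, q : Id y z, x : B, p : Id x y over Γ
  compᵀ : ∀ {n} → Ty n → Tm (suc (suc (suc (suc (suc n)))))
  compᵀ B = extend (extend (J B) (diag B) (B [ wk³ ]ᵀ)) (diag B ↑) (Id (B [ wk³ ∘ wk ]ᵀ) v0 v3)
                   (Id (B [ wk³ ∘ wk² ]ᵀ) v1 v3) v0

  -- k• p, in the context x, y : B, p : Id x y over Γ
  bulletᵀ : ∀ {n} → Ty n → Ty n → Tm (suc n) → Tm (suc (suc (suc n)))
  bulletᵀ B C k = J B (Id (C [ wk³ ]ᵀ) (k [ v2 ∷ wk³ ]) (k [ v1 ∷ wk³ ])) (r (C [ wk ]ᵀ) k)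

  module Emb {n} {G : Ctx n} (G! : G ctx) where

    -- the path (r σ , α) from (σ , f) to (σ , g)
    emb : ∀ {l} → Sub l n → Tm l → Tm l → Tm l → Sub l (trip (suc n))
    emb σ f g α = α ∷ g ∷ f ∷ rfl G ∘ σ

    src-emb : ∀ {l} (σ : Sub l n) f g α → src (suc n) ∘ emb σ f g α ≡ f ∷ σ
    src-emb σ f g α = trans (src-∷ n α g f _) (cong (f ∷_) (src-rfl∘ G! σ))

    tgt-emb : ∀ {l} (σ : Sub l n) f g α → tgt (suc n) ∘ emb σ f g α ≡ g ∷ σ
    tgt-emb σ f g α = trans (tgt-∷ n α g f _) (cong (g ∷_) (tgt-rfl∘ G! σ))

    emb-∘ : ∀ {l m} (σ : Sub m n) f g α (τ : Sub l m) →
            emb σ f g α ∘ τ ≡ emb (σ ∘ τ) (f [ τ ]) (g [ τ ]) (α [ τ ])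
    emb-∘ σ f g α τ = cong (λ υ → α [ τ ] ∷ g [ τ ] ∷ f [ τ ] ∷ υ) (∘-assoc (rfl G) σ τ)

    rfl-∷ : ∀ {l} B f (σ : Sub l n) → rfl (G ▷ B) ∘ (f ∷ σ) ≡ emb σ f f (r (B [ σ ]ᵀ) f)
    rfl-∷ B f σ = cong₂ _∷_
      (trans (r-[] _ _ _) (cong₂ r ([]ᵀ≡ B (wk-∷ f σ)) (var-[] zero _)))
      (cong₂ _∷_ (var-[] zero _) (cong₂ _∷_ (var-[] zero _) (∘wk-∷ (rfl G) f σ)))

    module _ {B} (B! : G ⊢ B type) where
      open Transport (wellFormed G!) B!

      private
        srcB : ∀ {l} (σ : Sub l n) → B [ src n ∘ (rfl G ∘ σ) ]ᵀ ≡ B [ σ ]ᵀ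
        srcB σ = cong (B [_]ᵀ) (src-rfl∘ G! σ)
        tgtB : ∀ {l} (σ : Sub l n) → B [ tgt n ∘ (rfl G ∘ σ) ]ᵀ ≡ B [ σ ]ᵀ
        tgtB σ = cong (B [_]ᵀ) (tgt-rfl∘ G! σ)

        Id≐ : ∀ {l} {Θ : Ctx l} {σ f g} → Θ ⊢ˢ σ ∶ G → Θ ⊢ f ∶ B [ σ ]ᵀ → Θ ⊢ g ∶ B [ σ ]ᵀ →
              Θ ⊢ Id (B [ σ ]ᵀ) f g ≐ Id (B [ src n ∘ (rfl G ∘ σ) ]ᵀ) f (tr G B [ g ∷ rfl G ∘ σ ]) type
        Id≐ {Θ = Θ} {σ} {f} {g} σ! f! g! =
          subst (λ A → Θ ⊢ Id (B [ σ ]ᵀ) f g ≐ Id A f (tr G B [ g ∷ rfl G ∘ σ ]) type) (sym (srcB σ))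
            (Id-cong (≐type-refl (sub-type σ! B!)) (≐-refl f!) (≐-sym (tr-β σ! g!)))

      emb-cong : ∀ {l} {Θ : Ctx l} {σ f f′ g g′ α α′} → Θ ⊢ˢ σ ∶ G →
        Θ ⊢ f ≐ f′ ∶ B [ σ ]ᵀ → Θ ⊢ g ≐ g′ ∶ B [ σ ]ᵀ → Θ ⊢ α ≐ α′ ∶ Id (B [ σ ]ᵀ) f g →
        Θ ⊢ˢ emb σ f g α ≐ emb σ f′ g′ α′ ∶ IdCtx (G ▷ B)
      emb-cong {σ = σ} σ! ff′ gg′ αα′ =
        path-cong (≐ˢ-refl (⊢rfl∘ G! σ!)) (cast≐ (sym (srcB σ)) ff′) (cast≐ (sym (tgtB σ)) gg′)
          (≐-conv αα′ (Id≐ σ! (proj₁ (≐term⇒term ff′)) (proj₁ (≐term⇒term gg′))))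

      ⊢emb : ∀ {l} {Θ : Ctx l} {σ f g α} → Θ ⊢ˢ σ ∶ G →
        Θ ⊢ f ∶ B [ σ ]ᵀ → Θ ⊢ g ∶ B [ σ ]ᵀ → Θ ⊢ α ∶ Id (B [ σ ]ᵀ) f g →
        Θ ⊢ˢ emb σ f g α ∶ IdCtx (G ▷ B)
      ⊢emb σ! f! g! α! = ≐ˢ-left (emb-cong σ! (≐-refl f!) (≐-refl g!) (≐-refl α!))

      emb-cong⁻ : ∀ {l} {Θ : Ctx l} {σ f f′ g g′ α α′} → Θ ⊢ˢ σ ∶ G →
        Θ ⊢ˢ emb σ f g α ≐ emb σ f′ g′ α′ ∶ IdCtx (G ▷ B) →
        Θ ⊢ f ≐ f′ ∶ B [ σ ]ᵀ × Θ ⊢ g ≐ g′ ∶ B [ σ ]ᵀ × Θ ⊢ α ≐ α′ ∶ Id (B [ σ ]ᵀ) f g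
      emb-cong⁻ {σ = σ} σ! e =
        ff′ , gg′ , ≐-conv (p .proj₂ .proj₂ .proj₂)
          (≐type-sym (Id≐ σ! (proj₁ (≐term⇒term ff′)) (proj₁ (≐term⇒term gg′))))
        where
        p = unpath-cong e
        ff′ = cast≐ (srcB σ) (p .proj₂ .proj₁)
        gg′ = cast≐ (tgtB σ) (p .proj₂ .proj₂ .proj₁)

    module _ {B} (B! : G ⊢ B type) where

      private
        T₁ = B [ wk³ ]ᵀ
        T₂ = Id (B [ wk³ ∘ wk ]ᵀ) v0 v3
        T₃ = Id (B [ wk³ ∘ wk² ]ᵀ) v1 v3
        Y : Ctx (suc (suc (suc (suc (suc n)))))
        Y = G ▷Id B ▷ T₁ ▷ T₂

        B₁ : ∀ {l} (y : Tm l) σ → B [ wk ]ᵀ [ y ∷ σ ]ᵀ ≡ B [ σ ]ᵀ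
        B₁ y σ = []ᵀ≡ B (wk-∷ y σ)
        I₁ : ∀ {l} (z y : Tm l) σ → Id (B [ wk² ]ᵀ) v1 v0 [ z ∷ y ∷ σ ]ᵀ ≡ Id (B [ σ ]ᵀ) y z
        I₁ z y σ = trans (Id-[] _ _ _ _) (Id≡ ([]ᵀ≡ B (wk²-∷ z y σ)) (var-[] _ _) (var-[] _ _))
        B₂ : ∀ {l} (q z y : Tm l) σ → T₁ [ q ∷ z ∷ y ∷ σ ]ᵀ ≡ B [ σ ]ᵀ
        B₂ q z y σ = []ᵀ≡ B (wk³-∷ q z y σ)
        I₂ : ∀ {l} (x q z y : Tm l) σ → T₂ [ x ∷ q ∷ z ∷ y ∷ σ ]ᵀ ≡ Id (B [ σ ]ᵀ) x y
        I₂ x q z y σ = trans (Id-[] _ _ _ _)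
          (Id≡ ([]ᵀ≡ B (trans (∘wk-∷ wk³ x _) (wk³-∷ q z y σ))) (var-[] _ _) (var-[] _ _))
        wk⁵-∷ : ∀ {l} (p x q z y : Tm l) (σ : Sub l n) → wk³ ∘ wk² ∘ (p ∷ x ∷ q ∷ z ∷ y ∷ σ) ≡ σ
        wk⁵-∷ p x q z y σ = trans (∘wk²-∷ wk³ p x _) (wk³-∷ q z y σ)
        I₃ : ∀ {l} (p x q z y : Tm l) σ → T₃ [ p ∷ x ∷ q ∷ z ∷ y ∷ σ ]ᵀ ≡ Id (B [ σ ]ᵀ) x z
        I₃ p x q z y σ = trans (Id-[] _ _ _ _)
          (Id≡ ([]ᵀ≡ B (wk⁵-∷ p x q z y σ)) (var-[] _ _) (var-[] _ _))

        diag-∷ : ∀ {l} (y : Tm l) σ → diag B ∘ (y ∷ σ) ≡ r (B [ σ ]ᵀ) y ∷ y ∷ y ∷ σ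
        diag-∷ y σ = cong₂ _∷_ (trans (r-[] _ _ _) (cong₂ r (B₁ y σ) (var-[] zero _)))
          (cong₂ _∷_ (var-[] zero _) (cong₂ _∷_ (var-[] zero _) (wk-∷ y σ)))


      ⊢triple : ∀ {l} {Θ : Ctx l} {σ y z q y′ z′ q′} → Θ ⊢ˢ σ ∶ G →
        Θ ⊢ y ≐ y′ ∶ B [ σ ]ᵀ → Θ ⊢ z ≐ z′ ∶ B [ σ ]ᵀ → Θ ⊢ q ≐ q′ ∶ Id (B [ σ ]ᵀ) y z →
        Θ ⊢ˢ q ∷ z ∷ y ∷ σ ≐ q′ ∷ z′ ∷ y′ ∷ σ ∶ G ▷Id B
      ⊢triple {σ = σ} {y} {z} σ! yy zz qq =
        cons (cons (cons (≐ˢ-refl σ!) B! yy) (▷type B″!) (cast≐ (sym (B₁ y σ)) zz))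
             (▷type Id!) (cast≐ (sym (I₁ z y σ)) qq)
        where
        Id! = ⊢cod (⊢along (Elim-J B!))
        B″! = ▷ctx Id!

      private
        J! = Elim-J B!
        GId! : G ▷Id B ctx
        GId! = ⊢cod (⊢along J!)
        wk³! : G ▷Id B ⊢ˢ wk³ ∶ G
        wk³! = castˢ (id-∘ wk³) (⊢∘wk³ GId! (⊢id G!))
        T₁! : G ▷Id B ⊢ T₁ type
        T₁! = sub-type wk³! B!
        vars₃ : G ▷Id B ⊢ˢ v0 ∷ v1 ∷ v2 ∷ wk³ ∶ G ▷Id B
        vars₃ = castˢ id-wk³ (⊢id GId!)

      untriple : ∀ {l} {Θ : Ctx l} {σ y z q} → Θ ⊢ˢ q ∷ z ∷ y ∷ σ ∶ G ▷Id B →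
        Θ ⊢ y ∶ B [ σ ]ᵀ × Θ ⊢ z ∶ B [ σ ]ᵀ × Θ ⊢ q ∶ Id (B [ σ ]ᵀ) y z
      untriple {σ = σ} {y} {z} (cons (cons (cons _ _ y!) _ z!) _ q!) =
        y! , cast (B₁ y σ) z! , cast (I₁ z y σ) q!

      ⊢vars₃ : G ▷Id B ⊢ v2 ∶ B [ wk³ ]ᵀ × G ▷Id B ⊢ v1 ∶ B [ wk³ ]ᵀ ×
               G ▷Id B ⊢ v0 ∶ Id (B [ wk³ ]ᵀ) v2 v1
      ⊢vars₃ = untriple vars₃

      private
        T₂! : G ▷Id B ▷ T₁ ⊢ T₂ type
        T₂! = Id-form (cast ([]ᵀ-∘ B wk³ wk) (⊢v0 T₁!))
                      (castᵗ (var-[] (suc (suc zero)) wk)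
                        (cast ([]ᵀ-∘ B wk³ wk) (wk-term T₁! (⊢vars₃ .proj₁))))
        Y! : Y ctx
        Y! = GId! ▷ T₁! ▷ T₂!

      tuple-cong : ∀ {l} {Θ : Ctx l} {σ y z q x p y′ z′ q′ x′ p′} → Θ ⊢ˢ σ ∶ G →
        Θ ⊢ y ≐ y′ ∶ B [ σ ]ᵀ → Θ ⊢ z ≐ z′ ∶ B [ σ ]ᵀ → Θ ⊢ q ≐ q′ ∶ Id (B [ σ ]ᵀ) y z →
        Θ ⊢ x ≐ x′ ∶ B [ σ ]ᵀ → Θ ⊢ p ≐ p′ ∶ Id (B [ σ ]ᵀ) x y →
        Θ ⊢ˢ p ∷ x ∷ q ∷ z ∷ y ∷ σ ≐ p′ ∷ x′ ∷ q′ ∷ z′ ∷ y′ ∷ σ ∶ Y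
      tuple-cong {σ = σ} {y} {z} {q} {x} σ! yy zz qq xx pp =
        cons (cons (⊢triple σ! yy zz qq) T₁! (cast≐ (sym (B₂ q z y σ)) xx))
             T₂! (cast≐ (sym (I₂ x q z y σ)) pp)

      untuple : ∀ {l} {Θ : Ctx l} {σ y z q x p} → Θ ⊢ˢ p ∷ x ∷ q ∷ z ∷ y ∷ σ ∶ Y →
        Θ ⊢ˢ σ ∶ G × Θ ⊢ y ∶ B [ σ ]ᵀ × Θ ⊢ z ∶ B [ σ ]ᵀ × Θ ⊢ q ∶ Id (B [ σ ]ᵀ) y z ×
        Θ ⊢ x ∶ B [ σ ]ᵀ × Θ ⊢ p ∶ Id (B [ σ ]ᵀ) x y
      untuple {σ = σ} {y} {z} {q} {x} (cons (cons t@(cons (cons (cons σ! _ _) _ _) _ _) _ x!) _ p!) =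
        σ! , t′ .proj₁ , t′ .proj₂ .proj₁ , t′ .proj₂ .proj₂ ,
        cast (B₂ q z y σ) x! , cast (I₂ x q z y σ) p!
        where t′ = untriple t

      private
        v4 : Tm (suc (suc (suc (suc (suc n)))))
        v4 = var (suc (suc (suc (suc zero))))
        wk⁵ : Sub (suc (suc (suc (suc (suc n))))) n
        wk⁵ = wk³ ∘ wk²
        id₅ : id {suc (suc (suc (suc (suc n))))} ≡ v0 ∷ v1 ∷ v2 ∷ v3 ∷ v4 ∷ wk⁵
        id₅ = cong (λ σ → v0 ∷ v1 ∷ v2 ∷ v3 ∷ v4 ∷ σ)
                (trans (sym (wk⁵-∷ v0 v1 v2 v3 v4 _)) (∘-id wk⁵))
        vars₅ : Y ⊢ˢ v0 ∷ v1 ∷ v2 ∷ v3 ∷ v4 ∷ wk⁵ ∶ Y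
        vars₅ = castˢ id₅ (⊢id Y!)
        σ! = untuple vars₅ .proj₁
        y! = untuple vars₅ .proj₂ .proj₁
        z! = untuple vars₅ .proj₂ .proj₂ .proj₁
        q! = untuple vars₅ .proj₂ .proj₂ .proj₂ .proj₁
        x! = untuple vars₅ .proj₂ .proj₂ .proj₂ .proj₂ .proj₁
        p! = untuple vars₅ .proj₂ .proj₂ .proj₂ .proj₂ .proj₂
        T₃! : Y ⊢ T₃ type
        T₃! = Id-form x! z!

        ρ = diag B ↑ ↑
        X : Ctx (suc (suc (suc n)))
        X = G ▷ B ▷ T₁ [ diag B ]ᵀ ▷ T₂ [ diag B ↑ ]ᵀ
        𝓔 : Elim X Y ρ (extend (extend (J B) (diag B) T₁) (diag B ↑) T₂)
        𝓔 = Elim-extend T₂! (Elim-extend T₁! J!)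

        X₁ : ∀ {l} (y : Tm l) σ → T₁ [ diag B ]ᵀ [ y ∷ σ ]ᵀ ≡ B [ σ ]ᵀ
        X₁ y σ = trans ([]ᵀ≡ T₁ (diag-∷ y σ)) (B₂ _ y y σ)
        X₂ : ∀ {l} (x y : Tm l) σ → T₂ [ diag B ↑ ]ᵀ [ x ∷ y ∷ σ ]ᵀ ≡ Id (B [ σ ]ᵀ) x y
        X₂ x y σ = trans ([]ᵀ≡ T₂ (trans (↑-∷ (diag B) x _) (cong (x ∷_) (diag-∷ y σ)))) (I₂ x _ y y σ)
        ρ-∷ : ∀ {l} (p x y : Tm l) σ →
              ρ ∘ (p ∷ x ∷ y ∷ σ) ≡ p ∷ x ∷ r (B [ σ ]ᵀ) y ∷ y ∷ y ∷ σ
        ρ-∷ p x y σ = trans (↑↑-∷ (diag B) p x _) (cong (λ υ → p ∷ x ∷ υ) (diag-∷ y σ))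

        X! = ⊢dom (⊢along 𝓔)
        varsX : X ⊢ˢ v0 ∷ v1 ∷ v2 ∷ wk³ ∶ X
        varsX = castˢ id-wk³ (⊢id X!)
        unX : ∀ {l} {Θ : Ctx l} {σ y x p} → Θ ⊢ˢ p ∷ x ∷ y ∷ σ ∶ X →
          Θ ⊢ˢ σ ∶ G × Θ ⊢ y ∶ B [ σ ]ᵀ × Θ ⊢ x ∶ B [ σ ]ᵀ × Θ ⊢ p ∶ Id (B [ σ ]ᵀ) x y
        unX {σ = σ} {y} {x} (cons (cons (cons σ! _ y!) _ x!) _ p!) =
          σ! , y! , cast (X₁ y σ) x! , cast (X₂ x y σ) p!
        ρ≡ : ρ ≡ v0 ∷ v1 ∷ r (B [ wk³ ]ᵀ) v2 ∷ v2 ∷ v2 ∷ wk³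
        ρ≡ = trans (sym (∘-id ρ)) (trans (cong (ρ ∘_) id-wk³) (ρ-∷ v0 v1 v2 wk³))
        T₃ρ : T₃ [ ρ ]ᵀ ≡ Id (B [ wk³ ]ᵀ) v1 v2
        T₃ρ = trans (cong (T₃ [_]ᵀ) ρ≡) (I₃ _ _ _ _ _ _)
        d! : X ⊢ v0 ∶ T₃ [ ρ ]ᵀ
        d! = cast (sym T₃ρ) (unX varsX .proj₂ .proj₂ .proj₂)

      ⊢compᵀ : Y ⊢ compᵀ B ∶ T₃
      ⊢compᵀ = ⊢elim 𝓔 T₃! d!

      compᵀ-cong : ∀ {l} {Θ : Ctx l} {σ y z q x p y′ z′ q′ x′ p′} → Θ ⊢ˢ σ ∶ G →
        Θ ⊢ y ≐ y′ ∶ B [ σ ]ᵀ → Θ ⊢ z ≐ z′ ∶ B [ σ ]ᵀ → Θ ⊢ q ≐ q′ ∶ Id (B [ σ ]ᵀ) y z →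
        Θ ⊢ x ≐ x′ ∶ B [ σ ]ᵀ → Θ ⊢ p ≐ p′ ∶ Id (B [ σ ]ᵀ) x y →
        Θ ⊢ compᵀ B [ p ∷ x ∷ q ∷ z ∷ y ∷ σ ] ≐ compᵀ B [ p′ ∷ x′ ∷ q′ ∷ z′ ∷ y′ ∷ σ ] ∶ Id (B [ σ ]ᵀ) x z
      compᵀ-cong {σ = σ} {y} {z} {q} {x} {p} σ! yy zz qq xx pp =
        cast≐ (I₃ p x q z y σ) (sub-≐term (tuple-cong σ! yy zz qq xx pp) (≐-refl ⊢compᵀ))

      emb-compose : ∀ {l} {Θ : Ctx l} {σ x y z p q} → Θ ⊢ˢ σ ∶ G →
        Θ ⊢ x ∶ B [ σ ]ᵀ → Θ ⊢ y ∶ B [ σ ]ᵀ → Θ ⊢ z ∶ B [ σ ]ᵀ →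
        Θ ⊢ p ∶ Id (B [ σ ]ᵀ) x y → Θ ⊢ q ∶ Id (B [ σ ]ᵀ) y z →
        Θ ⊢ˢ emb σ x z (compᵀ B [ p ∷ x ∷ q ∷ z ∷ y ∷ σ ]) ≐
             compose (G ▷ B) (emb σ y z q) (emb σ x y p) ∶ IdCtx (G ▷ B)
      emb-compose {σ = σ} {x} {y} {z} {p} {q} σ₀! x₀! y₀! z₀! p₀! q₀! = cast≐ˢ
        (trans (emb-∘ wk⁵ v1 v3 (compᵀ B) τ) (emb≡ στ (var-[] _ τ) (var-[] _ τ) refl))
        (trans (compose-∘ GB! Q P τ)
          (cong₂ (compose (G ▷ B))
            (trans (emb-∘ wk⁵ v4 v3 v2 τ) (emb≡ στ (var-[] _ τ) (var-[] _ τ) (var-[] _ τ)))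
            (trans (emb-∘ wk⁵ v1 v4 v0 τ) (emb≡ στ (var-[] _ τ) (var-[] _ τ) (var-[] _ τ)))))
        (∘-congˡ generic (≐ˢ-left (tuple-cong σ₀! (≐-refl y₀!) (≐-refl z₀!) (≐-refl q₀!) (≐-refl x₀!) (≐-refl p₀!))))
        where
        τ = p ∷ x ∷ q ∷ z ∷ y ∷ σ
        στ = wk⁵-∷ p x q z y σ
        GB! = G! ▷ B!
        emb≡ : ∀ {l} {σ σ′ : Sub l n} {f f′ g g′ α α′} → σ ≡ σ′ → f ≡ f′ → g ≡ g′ → α ≡ α′ →
               emb σ f g α ≡ emb σ′ f′ g′ α′
        emb≡ refl refl refl refl = refl
        Q = emb wk⁵ v4 v3 v2
        P = emb wk⁵ v1 v4 v0
        R = emb wk⁵ v1 v3 (compᵀ B)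
        Q! = ⊢emb B! σ! y! z! q!
        P! = ⊢emb B! σ! x! y! p!
        R! : Y ⊢ˢ R ∶ IdCtx (G ▷ B)
        R! = ⊢emb B! σ! x! z! ⊢compᵀ
        WB = wellFormed GB!
        meet : Y ⊢ˢ tgt (suc n) ∘ P ≐ src (suc n) ∘ Q ∶ G ▷ B
        meet = ≡⇒≐ˢ (trans (tgt-emb wk⁵ v1 v4 v0) (sym (src-emb wk⁵ v4 v3 v2))) (⊢∘ (⊢tgt WB) P!)
        L! = ⊢compose GB! Q! P! meet
        vX = unX varsX
        wkρ : wk⁵ ∘ ρ ≡ wk³
        wkρ = trans (cong (wk⁵ ∘_) ρ≡) (wk⁵-∷ _ _ _ _ _ _)
        lk : ∀ i → var i [ ρ ] ≡ lookup (v0 ∷ v1 ∷ r (B [ wk³ ]ᵀ) v2 ∷ v2 ∷ v2 ∷ wk³) i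
        lk i = trans (var-[] i ρ) (cong (λ υ → lookup υ i) ρ≡)
        Qρ : Q ∘ ρ ≡ rfl (G ▷ B) ∘ (v2 ∷ wk³)
        Qρ = trans (emb-∘ wk⁵ v4 v3 v2 ρ)
          (trans (emb≡ wkρ (lk _) (lk _) (lk _)) (sym (rfl-∷ B v2 wk³)))
        Pρ : P ∘ ρ ≡ emb wk³ v1 v2 v0
        Pρ = trans (emb-∘ wk⁵ v1 v4 v0 ρ) (emb≡ wkρ (lk _) (lk _) (lk _))
        Pρ! = ⊢emb B! (vX .proj₁) (vX .proj₂ .proj₂ .proj₁) (vX .proj₂ .proj₁) (vX .proj₂ .proj₂ .proj₂)
        Rρ : X ⊢ˢ R ∘ ρ ≐ emb wk³ v1 v2 v0 ∶ IdCtx (G ▷ B)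
        Rρ = cast≐ˢ (sym (trans (emb-∘ wk⁵ v1 v3 (compᵀ B) ρ) (emb≡ wkρ (lk _) (lk _) refl))) refl
          (emb-cong B! (vX .proj₁) (≐-refl (vX .proj₂ .proj₂ .proj₁)) (≐-refl (vX .proj₂ .proj₁))
            (cast≐ T₃ρ (elim-β 𝓔 T₃! d!)))
        Lρ : X ⊢ˢ compose (G ▷ B) Q P ∘ ρ ≐ emb wk³ v1 v2 v0 ∶ IdCtx (G ▷ B)
        Lρ = cast≐ˢ (sym (trans (compose-∘ GB! Q P ρ) (cong₂ (compose (G ▷ B)) Qρ Pρ))) refl
          (compose-rflˡ GB! Pρ! (≡⇒≐ˢ (tgt-emb wk³ v1 v2 v0) (⊢∘ (⊢tgt WB) Pρ!)))
        generic : Y ⊢ˢ R ≐ compose (G ▷ B) Q P ∶ IdCtx (G ▷ B)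
        generic = uniq 𝓔 GB! R! L!
          (≐ˢ-trans (≡⇒≐ˢ (trans (src-emb _ _ _ _) (sym (src-emb _ _ _ _))) (⊢∘ (⊢src WB) R!))
            (≐ˢ-sym (src-compose GB! Q! P! meet)))
          (≡⇒≐ˢ (trans (tgt-emb _ _ _ _) (sym (trans (tgt-compose GB! Q P) (tgt-emb _ _ _ _))))
            (⊢∘ (⊢tgt WB) R!))
          (≐ˢ-trans Rρ (≐ˢ-sym Lρ))

      private
        diag≡ : diag B ≡ r (B [ wk ]ᵀ) v0 ∷ v0 ∷ v0 ∷ wk
        diag≡ = refl
        lkd : ∀ i → var i [ diag B ] ≡ lookup (diag B) i
        lkd i = var-[] i (diag B)
        wk³-diag : wk³ ∘ diag B ≡ wk
        wk³-diag = wk³-∷ _ _ _ wk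
        E₃ = emb wk³ v2 v1 v0
        E₃! : G ▷Id B ⊢ˢ E₃ ∶ IdCtx (G ▷ B)
        E₃! = ⊢emb B! wk³! (⊢vars₃ .proj₁) (⊢vars₃ .proj₂ .proj₁) (⊢vars₃ .proj₂ .proj₂)
        emb≡′ : ∀ {l} {σ σ′ : Sub l n} {f f′ g g′ α α′} → σ ≡ σ′ → f ≡ f′ → g ≡ g′ → α ≡ α′ →
               emb σ f g α ≡ emb σ′ f′ g′ α′
        emb≡′ refl refl refl refl = refl
        E₃-diag : E₃ ∘ diag B ≡ rfl (G ▷ B) ∘ (v0 ∷ wk)
        E₃-diag = trans (emb-∘ wk³ v2 v1 v0 (diag B))
          (trans (emb≡′ wk³-diag (lkd _) (lkd _) (lkd _)) (sym (rfl-∷ B v0 wk)))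
        ⊢id▷ : G ▷ B ⊢ˢ v0 ∷ wk ∶ G ▷ B
        ⊢id▷ = ⊢id (G! ▷ B!)
        E₃-τ : ∀ {l} (σ : Sub l n) y z q → E₃ ∘ (q ∷ z ∷ y ∷ σ) ≡ emb σ y z q
        E₃-τ σ y z q = trans (emb-∘ wk³ v2 v1 v0 _)
          (emb≡′ (wk³-∷ q z y σ) (var-[] _ _) (var-[] _ _) (var-[] _ _))

      -- π• (r σ , q) = r σ
      bullet-wk : ∀ {l} {Θ : Ctx l} {σ y z q} → Θ ⊢ˢ σ ∶ G →
        Θ ⊢ y ∶ B [ σ ]ᵀ → Θ ⊢ z ∶ B [ σ ]ᵀ → Θ ⊢ q ∶ Id (B [ σ ]ᵀ) y z →
        Θ ⊢ˢ bulletᴳ (G ▷ B) G wk ∘ emb σ y z q ≐ rfl G ∘ σ ∶ IdCtx G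
      bullet-wk {σ = σ} {y} {z} {q} σ₀! y₀! z₀! q₀! = cast≐ˢ
        (∘-assoc-cong _ E₃ (q ∷ z ∷ y ∷ σ) (E₃-τ σ y z q))
        (∘-assoc-cong (rfl G) wk³ _ (wk³-∷ q z y σ))
        (∘-congˡ generic (≐ˢ-left (⊢triple σ₀! (≐-refl y₀!) (≐-refl z₀!) (≐-refl q₀!))))
        where
        W = wellFormed G!
        b = bulletᴳ (G ▷ B) G wk
        b! = ⊢bulletᴳ (⊢wk B!)
        L! = ⊢∘ b! E₃!
        generic : G ▷Id B ⊢ˢ b ∘ E₃ ≐ rfl G ∘ wk³ ∶ IdCtx G
        generic = uniq J! G! L! (⊢rfl∘ G! wk³!)
          (≡⇒≐ˢ (trans (∘-cong-assoc (src n) b E₃ (src-bulletᴳ (G ▷ B) G wk))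
            (trans (∘-assoc-cong wk (src (suc n)) E₃ (src-emb wk³ v2 v1 v0))
            (trans (wk-∷ v2 wk³) (sym (src-rfl∘ G! wk³))))) (⊢∘ (⊢src W) L!))
          (≡⇒≐ˢ (trans (∘-cong-assoc (tgt n) b E₃ (tgt-bulletᴳ (G ▷ B) G wk))
            (trans (∘-assoc-cong wk (tgt (suc n)) E₃ (tgt-emb wk³ v2 v1 v0))
            (trans (wk-∷ v1 wk³) (sym (tgt-rfl∘ G! wk³))))) (⊢∘ (⊢tgt W) L!))
          (cast≐ˢ (sym (∘-assoc-cong b E₃ (diag B) E₃-diag))
            (trans (cong (rfl G ∘_) (wk-∷ v0 wk)) (sym (∘-assoc-cong (rfl G) wk³ (diag B) wk³-diag)))
            (bulletᴳ-rfl∘ (⊢wk B!) ⊢id▷))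

      module Whisker {C k} (C! : G ⊢ C type) (k! : G ▷ B ⊢ k ∶ C [ wk ]ᵀ) where

        ⊢k∷ : G ▷ B ⊢ˢ k ∷ wk ∶ G ▷ C
        ⊢k∷ = cons (⊢wk B!) C! k!

        ⊢k : ∀ {l} {Θ : Ctx l} {σ y y′} → Θ ⊢ˢ σ ∶ G → Θ ⊢ y ≐ y′ ∶ B [ σ ]ᵀ →
             Θ ⊢ k [ y ∷ σ ] ≐ k [ y′ ∷ σ ] ∶ C [ σ ]ᵀ
        ⊢k {σ = σ} {y} σ! yy = cast≐ ([]ᵀ≡ C (wk-∷ y σ)) (sub-≐term (cons (≐ˢ-refl σ!) B! yy) (≐-refl k!))

        private
          k₂ = k [ v2 ∷ wk³ ]
          k₁ = k [ v1 ∷ wk³ ]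
          T = Id (C [ wk³ ]ᵀ) k₂ k₁
          k₂! = proj₁ (≐term⇒term (⊢k wk³! (≐-refl (⊢vars₃ .proj₁))))
          k₁! = proj₁ (≐term⇒term (⊢k wk³! (≐-refl (⊢vars₃ .proj₂ .proj₁))))
          T! : G ▷Id B ⊢ T type
          T! = Id-form k₂! k₁!
          T-∷ : ∀ {l} (q z y : Tm l) σ → T [ q ∷ z ∷ y ∷ σ ]ᵀ ≡ Id (C [ σ ]ᵀ) (k [ y ∷ σ ]) (k [ z ∷ σ ])
          T-∷ q z y σ = trans (Id-[] _ _ _ _) (Id≡ ([]ᵀ≡ C (wk³-∷ q z y σ))
            ([]≡ k (cong₂ _∷_ (var-[] _ _) (wk³-∷ q z y σ)))
            ([]≡ k (cong₂ _∷_ (var-[] _ _) (wk³-∷ q z y σ))))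
          k-id : k [ v0 ∷ wk ] ≡ k
          k-id = []-id k
          T-diag : T [ diag B ]ᵀ ≡ Id (C [ wk ]ᵀ) k k
          T-diag = trans (T-∷ _ _ _ _) (cong₂ (Id (C [ wk ]ᵀ)) k-id k-id)
          d₀! : G ▷ B ⊢ r (C [ wk ]ᵀ) k ∶ T [ diag B ]ᵀ
          d₀! = cast (sym T-diag) (Id-intro k!)

        ⊢bulletᵀ : G ▷Id B ⊢ bulletᵀ B C k ∶ T
        ⊢bulletᵀ = ⊢elim J! T! d₀!

        bulletᵀ-cong : ∀ {l} {Θ : Ctx l} {σ y z q y′ z′ q′} → Θ ⊢ˢ σ ∶ G →
          Θ ⊢ y ≐ y′ ∶ B [ σ ]ᵀ → Θ ⊢ z ≐ z′ ∶ B [ σ ]ᵀ → Θ ⊢ q ≐ q′ ∶ Id (B [ σ ]ᵀ) y z →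
          Θ ⊢ bulletᵀ B C k [ q ∷ z ∷ y ∷ σ ] ≐ bulletᵀ B C k [ q′ ∷ z′ ∷ y′ ∷ σ ]
            ∶ Id (C [ σ ]ᵀ) (k [ y ∷ σ ]) (k [ z ∷ σ ])
        bulletᵀ-cong {σ = σ} {y} {z} {q} σ! yy zz qq =
          cast≐ (T-∷ q z y σ) (sub-≐term (⊢triple σ! yy zz qq) (≐-refl ⊢bulletᵀ))

        emb-bullet : ∀ {l} {Θ : Ctx l} {σ y z q} → Θ ⊢ˢ σ ∶ G →
          Θ ⊢ y ∶ B [ σ ]ᵀ → Θ ⊢ z ∶ B [ σ ]ᵀ → Θ ⊢ q ∶ Id (B [ σ ]ᵀ) y z →
          Θ ⊢ˢ emb σ (k [ y ∷ σ ]) (k [ z ∷ σ ]) (bulletᵀ B C k [ q ∷ z ∷ y ∷ σ ]) ≐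
               bulletᴳ (G ▷ B) (G ▷ C) (k ∷ wk) ∘ emb σ y z q ∶ IdCtx (G ▷ C)
        emb-bullet {σ = σ} {y} {z} {q} σ₀! y₀! z₀! q₀! = cast≐ˢ
          (trans (emb-∘ wk³ k₂ k₁ (bulletᵀ B C k) τ)
            (emb≡′ (wk³-∷ q z y σ) ([]≡ k (cong₂ _∷_ (var-[] _ _) (wk³-∷ q z y σ)))
                   ([]≡ k (cong₂ _∷_ (var-[] _ _) (wk³-∷ q z y σ))) refl))
          (∘-assoc-cong b E₃ τ (E₃-τ σ y z q))
          (∘-congˡ generic (≐ˢ-left (⊢triple σ₀! (≐-refl y₀!) (≐-refl z₀!) (≐-refl q₀!))))
          where
          τ = q ∷ z ∷ y ∷ σ
          GC! = G! ▷ C!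
          WC = wellFormed GC!
          b = bulletᴳ (G ▷ B) (G ▷ C) (k ∷ wk)
          b! = ⊢bulletᴳ ⊢k∷
          R = emb wk³ k₂ k₁ (bulletᵀ B C k)

          embC : ∀ {l} {Θ : Ctx l} {σ f f′ g g′ α α′} → Θ ⊢ˢ σ ∶ G →
            Θ ⊢ f ≐ f′ ∶ C [ σ ]ᵀ → Θ ⊢ g ≐ g′ ∶ C [ σ ]ᵀ → Θ ⊢ α ≐ α′ ∶ Id (C [ σ ]ᵀ) f g →
            Θ ⊢ˢ emb σ f g α ≐ emb σ f′ g′ α′ ∶ IdCtx (G ▷ C)
          embC = emb-cong C!
          R! : G ▷Id B ⊢ˢ R ∶ IdCtx (G ▷ C)
          R! = ≐ˢ-left (embC wk³! (≐-refl k₂!) (≐-refl k₁!) (≐-refl ⊢bulletᵀ))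
          L! = ⊢∘ b! E₃!
          end : ∀ (v : Tm (suc (suc (suc n)))) → (k ∷ wk) ∘ (v ∷ wk³) ≡ k [ v ∷ wk³ ] ∷ wk³
          end v = cong (k [ v ∷ wk³ ] ∷_) (wk-∷ v wk³)
          Rd : G ▷ B ⊢ˢ R ∘ diag B ≐ emb wk k k (r (C [ wk ]ᵀ) k) ∶ IdCtx (G ▷ C)
          Rd = cast≐ˢ (sym (trans (emb-∘ wk³ k₂ k₁ (bulletᵀ B C k) (diag B))
                (emb≡′ wk³-diag (trans ([]≡ k (cong₂ _∷_ (var-[] _ _) wk³-diag)) k-id)
                               (trans ([]≡ k (cong₂ _∷_ (var-[] _ _) wk³-diag)) k-id) refl))) refl
            (embC (⊢wk B!) (≐-refl k!) (≐-refl k!) (cast≐ T-diag (elim-β J! T! d₀!)))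
          Ld : G ▷ B ⊢ˢ b ∘ E₃ ∘ diag B ≐ emb wk k k (r (C [ wk ]ᵀ) k) ∶ IdCtx (G ▷ C)
          Ld = cast≐ˢ (sym (∘-assoc-cong b E₃ (diag B) E₃-diag))
            (trans (cong (rfl (G ▷ C) ∘_) (trans (cong₂ _∷_ k-id (wk-∷ v0 wk)) refl)) (rfl-∷ C k wk))
            (bulletᴳ-rfl∘ ⊢k∷ ⊢id▷)
          generic : G ▷Id B ⊢ˢ R ≐ b ∘ E₃ ∶ IdCtx (G ▷ C)
          generic = uniq J! GC! R! L!
            (≡⇒≐ˢ (trans (src-emb wk³ k₂ k₁ _) (sym (trans (∘-cong-assoc (src (suc n)) b E₃ (src-bulletᴳ (G ▷ B) (G ▷ C) (k ∷ wk)))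
              (trans (∘-assoc-cong (k ∷ wk) (src (suc n)) E₃ (src-emb wk³ v2 v1 v0)) (end v2))))) (⊢∘ (⊢src WC) R!))
            (≡⇒≐ˢ (trans (tgt-emb wk³ k₂ k₁ _) (sym (trans (∘-cong-assoc (tgt (suc n)) b E₃ (tgt-bulletᴳ (G ▷ B) (G ▷ C) (k ∷ wk)))
              (trans (∘-assoc-cong (k ∷ wk) (tgt (suc n)) E₃ (tgt-emb wk³ v2 v1 v0)) (end v1))))) (⊢∘ (⊢tgt WC) R!))
            (≐ˢ-trans Rd (≐ˢ-sym Ld))

module Fibre {ℓ} (S : TypeTheory ℓ) (M : ML₂ S) (Γ : Contexts.Context S M) where
  open TypeTheory S
  open ML₂ M
  open Substitution S
  open Paths S M
  open Cells S M
  open Composition S M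
  open WellFormed
  open Contexts S M
  open FibreCells S M

  private
    G = tele Γ
    G! = ⊢ctx Γ
    module ℭ = 2-Category ℭ

  open Emb G!
  open Slice ℭ Γ

  record TypeIn : Set ℓ where
    constructor typeIn
    field
      {ty} : Ty (len Γ)
      ⊢ty  : G ⊢ ty type
  open TypeIn public

  record Term (A B : TypeIn) : Set ℓ where
    constructor term
    field
      {tm} : Tm (suc (len Γ))
      ⊢tm  : G ▷ ty A ⊢ tm ∶ ty B [ wk ]ᵀ
  open Term public

  record Identification {A B : TypeIn} (f g : Term A B) : Set ℓ where
    constructor identification
    field
      {idn} : Tm (suc (len Γ))
      ⊢idn  : G ▷ ty A ⊢ idn ∶ Id (ty B [ wk ]ᵀ) (tm f) (tm g)
  open Identification public

  module _ {A B : TypeIn} where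
    _≈ᵗ_ : Term A B → Term A B → Set ℓ
    f ≈ᵗ g = G ▷ ty A ⊢ tm f ≐ tm g ∶ ty B [ wk ]ᵀ

    _≋ᵗ_ : {f g f′ g′ : Term A B} → Identification f g → Identification f′ g′ → Set ℓ
    _≋ᵗ_ {f} {g} {f′} {g′} α β =
      f ≈ᵗ f′ × g ≈ᵗ g′ × G ▷ ty A ⊢ idn α ≐ idn β ∶ Id (ty B [ wk ]ᵀ) (tm f) (tm g)

  module _ {A B : TypeIn} where
    idᵗ : (f : Term A B) → Identification f f
    idᵗ f = identification (Id-intro (⊢tm f))

    _∙ᵗ_ : {f g h : Term A B} → Identification g h → Identification f g → Identification f h
    _∙ᵗ_ {f} {g} {h} β α = identification {idn = compᵀ (ty B) [ idn α ∷ tm f ∷ idn β ∷ tm h ∷ tm g ∷ wk ]}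
      (proj₁ (≐term⇒term (compᵀ-cong (⊢ty B) (⊢wk (⊢ty A)) (≐-refl (⊢tm g)) (≐-refl (⊢tm h))
        (≐-refl (⊢idn β)) (≐-refl (⊢tm f)) (≐-refl (⊢idn α)))))

  one : ∀ A → Term A A
  one A = term (⊢v0 (⊢ty A))

  module _ {A B C : TypeIn} where
    _∘ᵗ_ : Term B C → Term A B → Term A C
    g ∘ᵗ f = term {tm = tm g [ tm f ∷ wk ]}
      (cast ([]ᵀ≡ (ty C) (wk-∷ (tm f) wk)) (sub-term (cons (⊢wk (⊢ty A)) (⊢ty B) (⊢tm f)) (⊢tm g)))

    _▹ᵗ_ : (k : Term B C) {f g : Term A B} → Identification f g → Identification (k ∘ᵗ f) (k ∘ᵗ g)
    _▹ᵗ_ k {f} {g} α = identification {idn = bulletᵀ (ty B) (ty C) (tm k) [ idn α ∷ tm g ∷ tm f ∷ wk ]}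
      (proj₁ (≐term⇒term (Whisker.bulletᵀ-cong (⊢ty B) (⊢ty C) (⊢tm k) (⊢wk (⊢ty A))
        (≐-refl (⊢tm f)) (≐-refl (⊢tm g)) (≐-refl (⊢idn α)))))

    _◃ᵗ_ : {f g : Term B C} → Identification f g → (k : Term A B) → Identification (f ∘ᵗ k) (g ∘ᵗ k)
    _◃ᵗ_ {f} {g} α k = identification {idn = idn α [ tm k ∷ wk ]}
      (cast (trans (Id-[] _ _ _ _) (cong (λ D → Id D (tm f [ tm k ∷ wk ]) (tm g [ tm k ∷ wk ])) ([]ᵀ≡ (ty C) (wk-∷ (tm k) wk))))
        (sub-term (cons (⊢wk (⊢ty A)) (⊢ty B) (⊢tm k)) (⊢idn α)))

  ℭ/Γ : 2-Category ℓ
  ℭ/Γ = slice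

  E₀ : TypeIn → Over
  E₀ A = over {total = context (G! ▷ ⊢ty A)} (morphism wk (⊢wk (⊢ty A)))

  module _ {A B : TypeIn} where
    Eᵐ : Term A B → Morphism (Over.total (E₀ A)) (Over.total (E₀ B))
    Eᵐ f = morphism (tm f ∷ wk) (cons (⊢wk (⊢ty A)) (⊢ty B) (⊢tm f))

    E₁ : Term A B → Triangle (E₀ A) (E₀ B)
    E₁ f = triangle (Eᵐ f) (≡⇒≐ˢ (wk-∷ (tm f) wk) (⊢∘ (⊢wk (⊢ty B)) (⊢sub (Eᵐ f))))

    E₁-cong : {f g : Term A B} → f ≈ᵗ g → Eᵐ f ℭ.≈ Eᵐ g
    E₁-cong p = cons (≐ˢ-refl (⊢wk (⊢ty A))) (⊢ty B) p

    E₁-cong⁻ : {f g : Term A B} → Eᵐ f ℭ.≈ Eᵐ g → f ≈ᵗ g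
    E₁-cong⁻ p = proj₂ (cons⁻ p)

    private
      rflwk : Sub (suc (len Γ)) (trip (len Γ))
      rflwk = rfl G ∘ wk

    E-span : (f g : Term A B) (α : Identification f g) →
             inter (tm f ∷ wk) (tm g ∷ wk) (idn α ∷ pth (len Γ) rflwk) ≡ emb wk (tm f) (tm g) (idn α)
    E-span f g α = cong (λ υ → idn α ∷ tm g ∷ tm f ∷ υ)
      (trans (cong₂ (λ s t → inter s t (pth (len Γ) rflwk))
                    (sym (src-rfl∘ G! wk)) (sym (tgt-rfl∘ G! wk)))
             (inter-pth (len Γ) rflwk))

    -- (x , y) ↦ (r x , α (x , y))
    Eᶜ : {f g : Term A B} → Identification f g → 2Cell (Eᵐ f) (Eᵐ g)
    Eᶜ {f} {g} α = 2cell (idn α ∷ pth (len Γ) rflwk)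
      (castˢ (sym (E-span f g α)) (⊢emb (⊢ty B) (⊢wk (⊢ty A)) (⊢tm f) (⊢tm g) (⊢idn α)))

    E₂ : {f g : Term A B} → Identification f g → Triangle₂ (E₁ f) (E₁ g)
    E₂ {f} {g} α = triangle₂ (Eᶜ α)
      (≐ˢ-trans (span-▹ π (Eᶜ α))
        (≐ˢ-trans (≡⇒≐ˢ (cong (bullet π ∘_) (E-span f g α)) (⊢∘ (⊢bulletᴳ (⊢sub π)) (⊢path (Eᶜ α))))
          (≐ˢ-trans (bullet-wk (⊢ty B) (⊢wk (⊢ty A)) (⊢tm f) (⊢tm g) (⊢idn α))
            (≐ˢ-sym (span-id (Over.base (E₀ A)))))))
      where π = Over.base (E₀ B)

    E₂-cong : {f g f′ g′ : Term A B} {α : Identification f g} {α′ : Identification f′ g′} →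
              α ≋ᵗ α′ → Eᶜ α ℭ.≋ Eᶜ α′
    E₂-cong {f} {g} {f′} {g′} {α} {α′} (p , q , s) =
      cast≐ˢ (sym (E-span f g α)) (sym (E-span f′ g′ α′)) (emb-cong (⊢ty B) (⊢wk (⊢ty A)) p q s)

    E₂-cong⁻ : {f g f′ g′ : Term A B} {α : Identification f g} {α′ : Identification f′ g′} →
               Eᶜ α ℭ.≋ Eᶜ α′ → α ≋ᵗ α′
    E₂-cong⁻ {f} {g} {f′} {g′} {α} {α′} p =
      emb-cong⁻ (⊢ty B) (⊢wk (⊢ty A)) (cast≐ˢ (E-span f g α) (E-span f′ g′ α′) p)

    E₂-id : (f : Term A B) → Eᶜ (idᵗ f) ℭ.≋ ℭ.id₂ (Eᵐ f)
    E₂-id f = ≐ˢ-trans (≡⇒≐ˢ (trans (E-span f f (idᵗ f)) (sym (rfl-∷ (ty B) (tm f) wk))) (⊢path (Eᶜ (idᵗ f))))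
                       (≐ˢ-sym (span-id (Eᵐ f)))

    E₂-∙ : {f g h : Term A B} (β : Identification g h) (α : Identification f g) →
           Eᶜ (β ∙ᵗ α) ℭ.≋ Eᶜ β ℭ.∘ᵥ Eᶜ α
    E₂-∙ {f} {g} {h} β α = ≐ˢ-trans
      (cast≐ˢ (sym (E-span f h (β ∙ᵗ α)))
              (cong₂ (compose (G ▷ ty B)) (sym (E-span g h β)) (sym (E-span f g α)))
        (emb-compose (⊢ty B) (⊢wk (⊢ty A)) (⊢tm f) (⊢tm g) (⊢tm h) (⊢idn α) (⊢idn β)))
      (≐ˢ-sym (span-∙ (Eᶜ β) (Eᶜ α)))

  E₁-one : ∀ A → Eᵐ (one A) ℭ.≈ ℭ.id₁ (Over.total (E₀ A))
  E₁-one A = ≐ˢ-refl (⊢id (G! ▷ ⊢ty A))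

  module _ {A B C : TypeIn} where
    E₁-∘ : (g : Term B C) (f : Term A B) → Eᵐ (g ∘ᵗ f) ℭ.≈ Eᵐ g ℭ.∘₁ Eᵐ f
    E₁-∘ g f = ≡⇒≐ˢ (cong (tm g [ tm f ∷ wk ] ∷_) (sym (wk-∷ (tm f) wk))) (⊢sub (Eᵐ (g ∘ᵗ f)))

    E₂-▹ : (k : Term B C) {f g : Term A B} (α : Identification f g) →
           Eᶜ (k ▹ᵗ α) ℭ.≋ Eᵐ k ℭ.▹ Eᶜ α
    E₂-▹ k {f} {g} α = ≐ˢ-trans
      (cast≐ˢ (sym (E-span (k ∘ᵗ f) (k ∘ᵗ g) (k ▹ᵗ α))) (cong (bullet (Eᵐ k) ∘_) (sym (E-span f g α)))
        (Whisker.emb-bullet (⊢ty B) (⊢ty C) (⊢tm k) (⊢wk (⊢ty A)) (⊢tm f) (⊢tm g) (⊢idn α)))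
      (≐ˢ-sym (span-▹ (Eᵐ k) (Eᶜ α)))

    E₂-◃ : {f g : Term B C} (α : Identification f g) (k : Term A B) →
           Eᶜ (α ◃ᵗ k) ℭ.≋ Eᶜ α ℭ.◃ Eᵐ k
    E₂-◃ {f} {g} α k = ≡⇒≐ˢ
      (trans (E-span (f ∘ᵗ k) (g ∘ᵗ k) (α ◃ᵗ k))
      (trans (cong (λ σ → emb σ (tm f [ tm k ∷ wk ]) (tm g [ tm k ∷ wk ]) (idn α [ tm k ∷ wk ])) (sym (wk-∷ (tm k) wk)))
      (trans (sym (emb-∘ wk (tm f) (tm g) (idn α) (tm k ∷ wk)))
      (trans (cong (_∘ (tm k ∷ wk)) (sym (E-span f g α))) (sym (span-◃ (Eᶜ α) (Eᵐ k)))))))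
      (⊢path (Eᶜ (α ◃ᵗ k)))

  𝔼-data : LocalEmbedding ℭ/Γ
  𝔼-data = record
    { Ob = TypeIn
    ; 1-Cell = Term
    ; _≈_ = _≈ᵗ_
    ; _⇒_ = Identification
    ; _≋_ = _≋ᵗ_
    ; coe = λ {_} {_} {f} {g} {f′} {g′} p q α → identification (conv (⊢idn α) (IdB {f = f} {f′} {g} {g′} p q))
    ; coe-≋ = λ {_} {_} {f} {g} {f′} {g′} p q α →
        ≐-sym p , ≐-sym q , ≐-refl (conv (⊢idn α) (IdB {f = f} {f′} {g} {g′} p q))
    ; id₂ = idᵗ
    ; _∘ᵥ_ = _∙ᵗ_
    ; id₁ = one
    ; _∘₁_ = _∘ᵗ_
    ; _▹_ = _▹ᵗ_
    ; _◃_ = _◃ᵗ_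
    ; E₀ = E₀
    ; E₁ = E₁
    ; E₂ = E₂
    ; E₁-cong = λ {_} {_} {f} {g} → E₁-cong {f = f} {g}
    ; E₁-cong⁻ = λ {_} {_} {f} {g} → E₁-cong⁻ {f = f} {g}
    ; E₂-cong = λ {_} {_} {_} {_} {_} {_} {α} {β} → E₂-cong {α = α} {β}
    ; E₂-cong⁻ = λ {_} {_} {_} {_} {_} {_} {α} {β} → E₂-cong⁻ {α = α} {β}
    ; E-id₂ = E₂-id
    ; E-∘ᵥ = E₂-∙
    ; E-id₁ = E₁-one
    ; E-∘₁ = E₁-∘
    ; E-▹ = E₂-▹
    ; E-◃ = E₂-◃
    }
    where
    IdB : ∀ {A B : TypeIn} {f f′ g g′ : Term A B} → f ≈ᵗ f′ → g ≈ᵗ g′ →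
          G ▷ ty A ⊢ Id (ty B [ wk ]ᵀ) (tm f) (tm g) ≐ Id (ty B [ wk ]ᵀ) (tm f′) (tm g′) type
    IdB {A} {B} p q = Id-cong (≐type-refl (wk-type (⊢ty A) (⊢ty B))) p q

  𝔗 : 2-Category ℓ
  𝔗 = LocalEmbedding.domain 𝔼-data

  𝔼 : 2-Functor 𝔗 ℭ/Γ
  𝔼 = LocalEmbedding.embedding 𝔼-data

  idOver : Over
  idOver = over (idᵐ Γ)

  𝟏 : TypeIn
  𝟏 = typeIn (One-form G!)

{-# OPTIONS --safe #-}
-- The functor 𝔗(Γ)(𝟏 , B) → (ℭ/Γ)(id , π_B), h ↦ (h (⋆) , id), is split surjective
-- on objects and full by 𝟏-elimination, and faithful since, by 𝟏-elimination into
-- an identity type and discreteness, identifications over Γ , z : 𝟏 are equal as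
-- soon as they agree at z = ⋆.  Any such functor is a surjective equivalence: its
-- section on arrows, θ and θ⁻¹ are lifts along it, and all equations between them
-- follow from faithfulness.  Fullness also uses that π_B• is the projection
-- (p , q) ↦ p, so that the 2-cells of the slice are those of the form (r , q).
module Submission where

open import Level using (Level)
open import Data.Nat using (suc)
open import Data.Vec using (_∷_)
open import Data.Product using (_×_; _,_; proj₁; proj₂)
open import Relation.Binary.PropositionalEquality using (_≡_; refl; sym; trans; cong)
open import Defs

module _ {ℓ} {A B : Category ℓ} (P : Functor A B) where
  private
    module A = Category A
    module B = Category B
    module P = Functor P

  -- As `≋` is heterogeneous, `faithful` compares arrows whose endpoints are merely equal; `P` need
  -- not reflect equality of objects, so that equality is a premise. Congruence of `lift` then comes
  -- for free.
  record SplitFullyFaithful : Set ℓ where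
    field
      section      : B.Obj → A.Obj
      section-cong : ∀ {b b′} → b B.≈ b′ → section b A.≈ section b′
      P-section    : ∀ b → P.F₀ (section b) B.≈ b
      lift         : ∀ {a a′} → B.Hom (P.F₀ a) (P.F₀ a′) → A.Hom a a′
      P-lift       : ∀ {a a′} (β : B.Hom (P.F₀ a) (P.F₀ a′)) → P.F₁ (lift β) B.≋ β
      faithful     : ∀ {a a′ c c′} {α : A.Hom a a′} {γ : A.Hom c c′} →
                     a A.≈ c → a′ A.≈ c′ → P.F₁ α B.≋ P.F₁ γ → α A.≋ γ

  module _ (S : SplitFullyFaithful) where
    open SplitFullyFaithful S

    private
      liftTo : ∀ {a a′ b b′} → b B.≈ P.F₀ a → b′ B.≈ P.F₀ a′ → B.Hom b b′ → A.Hom a a′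
      liftTo p q β = lift (B.coe p q β)

      P-liftTo : ∀ {a a′ b b′} (p : b B.≈ P.F₀ a) (q : b′ B.≈ P.F₀ a′) (β : B.Hom b b′) →
                 P.F₁ (liftTo p q β) B.≋ β
      P-liftTo p q β = B.≋-trans (P-lift _) (B.coe-≋ p q β)

      I₁ : ∀ {b b′} → B.Hom b b′ → A.Hom (section b) (section b′)
      I₁ = liftTo (B.≈.sym (P-section _)) (B.≈.sym (P-section _))

      P-I₁ : ∀ {b b′} (β : B.Hom b b′) → P.F₁ (I₁ β) B.≋ β
      P-I₁ = P-liftTo _ _

      θ : ∀ a → A.Hom a (section (P.F₀ a))
      -- `P` sends the section of `P a` back to `P a`, so the identity of `P a` lifts to a
      -- comparison in either direction.
      θ a = liftTo B.≈.refl (B.≈.sym (P-section _)) (B.id (P.F₀ a))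

      P-θ : ∀ a → P.F₁ (θ a) B.≋ B.id (P.F₀ a)
      P-θ a = P-liftTo _ _ _

      θ⁻¹ : ∀ a → A.Hom (section (P.F₀ a)) a
      θ⁻¹ a = liftTo (B.≈.sym (P-section _)) B.≈.refl (B.id (P.F₀ a))

      P-θ⁻¹ : ∀ a → P.F₁ (θ⁻¹ a) B.≋ B.id (P.F₀ a)
      P-θ⁻¹ a = P-liftTo _ _ _

      P-∘ : ∀ {a b c x y z} {g : A.Hom b c} {f : A.Hom a b} {g′ : B.Hom y z} {f′ : B.Hom x y} →
            P.F₁ g B.≋ g′ → P.F₁ f B.≋ f′ → P.F₁ (g A.∘ f) B.≋ g′ B.∘ f′
      P-∘ p q = B.≋-trans (P.F-∘ _ _) (B.∘-cong p q)

    splitFullyFaithful⇒surjectiveEquivalence : SurjectiveEquivalence P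
    splitFullyFaithful⇒surjectiveEquivalence = record
      { I = record
        { F₀      = section
        ; F₁      = I₁
        ; F₀-cong = section-cong
        ; F₁-cong = λ {_} {_} {_} {_} {β} {β′} p →
            faithful (section-cong (B.≋-dom p)) (section-cong (B.≋-cod p))
              (B.≋-trans (P-I₁ β) (B.≋-trans p (B.≋-sym (P-I₁ β′))))
        ; F-id    = λ b → faithful A.≈.refl A.≈.refl
            (B.≋-trans (P-I₁ (B.id b))
              (B.≋-sym (B.≋-trans (P.F-id (section b)) (B.id-cong (P-section b)))))
        ; F-∘     = λ β α → faithful A.≈.refl A.≈.refl
            (B.≋-trans (P-I₁ (β B.∘ α)) (B.≋-sym (P-∘ (P-I₁ β) (P-I₁ α))))
        }
      ; PI≈id₀    = P-section
      ; PI≈id₁    = P-I₁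
      ; θ         = θ
      ; θ⁻¹       = θ⁻¹
      ; θ-cong    = λ {a} {a′} p → faithful p (section-cong (P.F₀-cong p))
          (B.≋-trans (P-θ a) (B.≋-trans (B.id-cong (P.F₀-cong p)) (B.≋-sym (P-θ a′))))
      ; θ-natural = λ {a} {a′} f → faithful A.≈.refl A.≈.refl
          (B.≋-trans (B.≋-trans (P-∘ (P-θ a′) B.≋-refl) (B.idˡ _))
            (B.≋-sym (B.≋-trans (P-∘ (P-I₁ (P.F₁ f)) (P-θ a)) (B.idʳ _))))
      ; θ⁻¹∘θ     = λ a → faithful A.≈.refl A.≈.refl
          (B.≋-trans (B.≋-trans (P-∘ (P-θ⁻¹ a) (P-θ a)) (B.idˡ _)) (B.≋-sym (P.F-id a)))
      ; θ∘θ⁻¹     = λ a → faithful A.≈.refl A.≈.refl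
          (B.≋-trans (B.≋-trans (P-∘ (P-θ a) (P-θ⁻¹ a)) (B.idˡ _))
            (B.≋-sym (B.≋-trans (P.F-id _) (B.id-cong (P-section _)))))
      -- The two codomains are `section (P (section b))` and `section b`, equal by `section-cong`
      -- but not identical.
      ; θI≈id     = λ b → faithful A.≈.refl (section-cong (P-section b))
          (B.≋-trans (P-θ (section b)) (B.≋-sym (P.F-id (section b))))
      ; Pθ≈id     = P-θ
      }

SplitRestriction :
  ∀ {ℓ} {K L : 2-Category ℓ} (U : 2-Functor K L) {x : 2-Category.Ob L} {a : 2-Category.Ob K}
  (η : 2-Category.1-Cell L x (2-Functor.F₀ U a)) → Set ℓ
SplitRestriction U η = ∀ y → SplitFullyFaithful (transpose U η y)

splitFullyFaithful⇒retractBireflection :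
  ∀ {ℓ} {K L : 2-Category ℓ} (U : 2-Functor K L) {x : 2-Category.Ob L} {a : 2-Category.Ob K}
  (η : 2-Category.1-Cell L x (2-Functor.F₀ U a)) →
  SplitRestriction U η → RetractBireflection U x a
splitFullyFaithful⇒retractBireflection U η S = record
  { η = η
  ; surjectiveEquivalence = λ y → splitFullyFaithful⇒surjectiveEquivalence (transpose U η y) (S y)
  }

module _ {ℓ} (S : TypeTheory ℓ) (M : ML₂ S) where
  open TypeTheory S
  open ML₂ M
  open Substitution S
  open Paths S M
  open Cells S M
  open Composition S M
  open FibreCells S M
  open WellFormed

  -- Puts `𝟏`-elimination in the same form as identity elimination, so that the uniqueness principle
  -- `uniq-term` applies to it as well.
  Elim-One : ∀ {n} {G : Ctx n} → G ctx → Elim G (G ▷ One) (⋆ ∷ id) U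
  Elim-One G! = record
    { ⊢along = cons (⊢id G!) (One-form G!) (cast (sym ([]ᵀ-id One)) (One-intro G!))
    ; ⊢elim  = One-elim
    ; elim-β = One-comp
    }

  module _ {n} {G : Ctx n} (G! : G ctx) {B} (B! : G ⊢ B type) where
    open Emb G!
    open Transport (wellFormed G!) B!

    private
      WB = wellFormed (G! ▷ B!)
      W  = wellFormed G!

    -- Both sides have the same endpoints and restrict along reflexivity to `rfl G ∘ wk`, so path
    -- induction with discreteness identifies them. The base path is arbitrary here.
    bullet-wk≐wk³ : IdCtx (G ▷ B) ⊢ˢ bulletᴳ (G ▷ B) G wk ≐ wk³ ∶ IdCtx G
    bullet-wk≐wk³ = path-ind (G! ▷ B!) G! b! wk³!
      (≡⇒≐ˢ (trans (src-bulletᴳ (G ▷ B) G wk) (wk-∷ _ _)) (⊢∘ (⊢src W) b!))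
      (≡⇒≐ˢ (trans (tgt-bulletᴳ (G ▷ B) G wk) (wk-∷ _ _)) (⊢∘ (⊢tgt W) b!))
      (cast≐ˢ refl (sym (wk³-∷ _ _ _ _)) (bulletᴳ-rfl (⊢wk B!)))
      where
      b! = ⊢bulletᴳ (⊢wk B!)
      wk³! : IdCtx (G ▷ B) ⊢ˢ wk³ ∶ IdCtx G
      wk³! = castˢ (id-∘ wk³) (⊢∘wk³ (IdCtx! WB) (⊢id (IdCtx! W)))

    -- Projecting a path leaves its base component `γ`, so verticality makes `γ` reflexivity, and
    -- transport along reflexivity is the identity.
    vertical⇒emb : ∀ {l} {Θ : Ctx l} {σ f g q γ} → Θ ⊢ˢ σ ∶ G →
      Θ ⊢ f ∶ B [ σ ]ᵀ → Θ ⊢ g ∶ B [ σ ]ᵀ →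
      Θ ⊢ˢ q ∷ g ∷ f ∷ γ ∶ IdCtx (G ▷ B) →
      Θ ⊢ˢ bulletᴳ (G ▷ B) G wk ∘ (q ∷ g ∷ f ∷ γ) ≐ rfl G ∘ σ ∶ IdCtx G →
      Θ ⊢ q ∶ Id (B [ σ ]ᵀ) f g × Θ ⊢ˢ q ∷ g ∷ f ∷ γ ≐ emb σ f g q ∶ IdCtx (G ▷ B)
    vertical⇒emb {Θ = Θ} {σ} {f} {g} {q} {γ} σ! f! g! γ! v = q! ,
      path-cong γ≐rfl (≐-refl (p .proj₂ .proj₁)) (≐-refl (p .proj₂ .proj₂ .proj₁))
        (≐-refl (p .proj₂ .proj₂ .proj₂))
      where
      p = unpath γ!
      γ≐rfl : Θ ⊢ˢ γ ≐ rfl G ∘ σ ∶ IdCtx G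
      γ≐rfl = ≐ˢ-trans (cast≐ˢ (wk³-∷ q g f γ) refl (≐ˢ-sym (∘-congˡ bullet-wk≐wk³ γ!))) v
      A≐ : Θ ⊢ B [ src n ∘ γ ]ᵀ ≐ B [ σ ]ᵀ type
      A≐ = sub-cong (cast≐ˢ refl (src-rfl∘ G! σ) (src-cong G! γ≐rfl)) B!
      q! : Θ ⊢ q ∶ Id (B [ σ ]ᵀ) f g
      -- `q` ends at the transport of `g` along `γ`: `tr-cong` replaces `γ` by reflexivity and
      -- `tr-β` removes the transport.
      q! = conv (p .proj₂ .proj₂ .proj₂)
        (Id-cong A≐ (≐-refl (p .proj₂ .proj₁))
          (≐-trans (tr-cong γ≐rfl (≐-refl (p .proj₂ .proj₂ .proj₁)))
            (≐-conv (tr-β σ! g!) (≐type-sym A≐))))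

module _ {ℓ} (S : TypeTheory ℓ) (M : ML₂ S) (Γ : Contexts.Context S M) where
  open TypeTheory S
  open ML₂ M
  open Substitution S
  open Paths S M
  open Cells S M
  open Contexts S M
  open FibreCells S M
  open Fibre S M Γ
  open Emb (⊢ctx Γ)
  open Slice ℭ Γ
  open Triangle
  open Triangle₂
  open Elim

  private
    G  = tele Γ
    G! = ⊢ctx Γ
    module ℭ = 2-Category ℭ
    E𝟏 = Elim-One S M G!
    ηˢ : Sub (len Γ) (suc (len Γ))
    ηˢ = ⋆ ∷ id

  pointᵐ : Morphism Γ (Over.total (E₀ 𝟏))
  pointᵐ = morphism ηˢ (⊢along E𝟏)

  point : Triangle idOver (E₀ 𝟏)
  point = triangle pointᵐ (≡⇒≐ˢ (wk-∷ ⋆ id) (⊢∘ (⊢wk (⊢ty 𝟏)) (⊢along E𝟏)))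

  module _ (B : TypeIn) where
    private
      P = transpose (Fibre.𝔼 S M Γ) {Fibre.idOver S M Γ} {Fibre.𝟏 S M Γ} point B
      module P = Functor P
      Bσ : ∀ {l} (σ : Sub l (suc (len Γ))) → ty B [ wk ]ᵀ [ σ ]ᵀ ≡ ty B [ wk ∘ σ ]ᵀ
      Bσ σ = []ᵀ-∘ (ty B) wk σ
      wkη! : G ⊢ˢ wk ∘ ηˢ ∶ G
      wkη! = ⊢∘ (⊢wk (⊢ty 𝟏)) (⊢along E𝟏)
      Bwk! : G ▷ One ⊢ ty B [ wk ]ᵀ type
      Bwk! = wk-type (⊢ty 𝟏) (⊢ty B)
      Bη : ty B [ wk ]ᵀ [ ηˢ ]ᵀ ≡ ty B
      Bη = trans ([]ᵀ≡ (ty B) (wk-∷ ⋆ id)) ([]ᵀ-id (ty B))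

    -- The type stays over `wk ∘ ηˢ`, only propositionally `id`, to match the base at which
    -- `span-atPoint` presents restricted 2-cells.
    atPoint! : (f : Term 𝟏 B) → G ⊢ tm f [ ηˢ ] ∶ ty B [ wk ∘ ηˢ ]ᵀ
    atPoint! f = cast (Bσ ηˢ) (sub-term (⊢along E𝟏) (⊢tm f))

    Id-atPoint : (f g : Term 𝟏 B) → Id (ty B [ wk ]ᵀ) (tm f) (tm g) [ ηˢ ]ᵀ ≡
                 Id (ty B [ wk ∘ ηˢ ]ᵀ) (tm f [ ηˢ ]) (tm g [ ηˢ ])
    Id-atPoint f g = trans (Id-[] _ _ _ _) (Id≡ (Bσ ηˢ) refl refl)

    span-atPoint : {f g : Term 𝟏 B} (α : Identification f g) →
                   span (cell (P.F₁ α)) ≡ emb (wk ∘ ηˢ) (tm f [ ηˢ ]) (tm g [ ηˢ ]) (idn α [ ηˢ ])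
    span-atPoint {f} {g} α = trans (span-◃ (Eᶜ α) pointᵐ)
      (trans (cong (_∘ ηˢ) (E-span f g α)) (emb-∘ wk (tm f) (tm g) (idn α) ηˢ))

    ⊢head : ∀ {b σ} → G ⊢ˢ b ∷ σ ∶ G ▷ ty B → G ⊢ˢ wk ∘ (b ∷ σ) ≐ id ∶ G → G ⊢ b ∶ ty B
    ⊢head {b} {σ} (cons _ _ b!) c =
      cast ([]ᵀ-id (ty B)) (conv b! (sub-cong (cast≐ˢ (wk-∷ b σ) refl c) (⊢ty B)))

    ⊢rec : ∀ {b} → G ⊢ b ∶ ty B → G ▷ One ⊢ U (ty B [ wk ]ᵀ) b ∶ ty B [ wk ]ᵀ
    ⊢rec b! = ⊢elim E𝟏 Bwk! (cast (sym Bη) b!)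

    -- Only the fibre component `b` is kept: commutativity of the triangle forces `σ` to be the
    -- identity up to definitional equality, which is how `P-section` recovers it.
    section : Triangle idOver (E₀ B) → Term 𝟏 B
    section (triangle (morphism (b ∷ σ) t!) c) = term (⊢rec (⊢head t! c))

    section-cong : {s t : Triangle idOver (E₀ B)} → arrow s ℭ.≈ arrow t → section s ≈ᵗ section t
    section-cong {triangle (morphism (b ∷ σ) s!) c} {triangle (morphism (b′ ∷ σ′) t!) c′} p =
      U-cong (≐type-refl Bwk!) (cast≐ (trans ([]ᵀ-id (ty B)) (sym Bη))
        (≐-conv (proj₂ (cons⁻ p)) (sub-cong (cast≐ˢ (wk-∷ b σ) refl c) (⊢ty B))))

    P-section : (s : Triangle idOver (E₀ B)) → arrow (P.F₀ (section s)) ℭ.≈ arrow s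
    P-section (triangle (morphism (b ∷ σ) s!) c) =
      cons (≐ˢ-sym (cast≐ˢ (wk-∷ b σ) (sym (wk-∷ ⋆ id)) c)) (⊢ty B)
           (cast≐ (Bσ ηˢ) (elim-β E𝟏 Bwk! (cast (sym Bη) (⊢head s! c))))

    module _ {f g : Term 𝟏 B} where
      private
        C = Id (ty B [ wk ]ᵀ) (tm f) (tm g)

        C! : G ▷ One ⊢ C type
        C! = Id-form (⊢tm f) (⊢tm g)

        fibrewise : (β : Triangle₂ (P.F₀ f) (P.F₀ g)) → ∀ {q ps} → path (cell β) ≡ q ∷ ps →
                    G ⊢ q ∶ C [ ηˢ ]ᵀ ×
                    G ⊢ˢ span (cell β) ≐ emb (wk ∘ ηˢ) (tm f [ ηˢ ]) (tm g [ ηˢ ]) q ∶ IdCtx (G ▷ ty B)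
        fibrewise (triangle₂ β v) {q} refl = cast (sym (Id-atPoint f g)) (proj₁ e) , proj₂ e
          where
          -- The slice condition `v` says that whiskering with the projection gives an identity
          -- 2-cell; unfolding both spans turns it into the verticality hypothesis.
          e = vertical⇒emb S M G! (⊢ty B) wkη! (atPoint! f) (atPoint! g) (⊢path β)
            (≐ˢ-trans (≐ˢ-sym (span-▹ (Over.base (E₀ B)) β))
              (≐ˢ-trans v (cast≐ˢ refl (cong (rfl G ∘_) (sym (wk-∷ ⋆ id))) (span-id (idᵐ Γ)))))

      -- The fibre component `q` is an identification at `⋆`; eliminating into `C` extends it over
      -- all of `𝟏`.
      lift : Triangle₂ (P.F₀ f) (P.F₀ g) → Identification f g
      lift β@(triangle₂ (2cell (q ∷ ps) _) _) = identification (⊢elim E𝟏 C! (proj₁ (fibrewise β refl)))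

      P-lift : (β : Triangle₂ (P.F₀ f) (P.F₀ g)) → cell (P.F₁ (lift β)) ℭ.≋ cell β
      P-lift β@(triangle₂ (2cell (q ∷ ps) _) _) = cast≐ˢ (sym (span-atPoint (lift β))) refl
        (≐ˢ-trans
          (emb-cong (⊢ty B) wkη! (≐-refl (atPoint! f)) (≐-refl (atPoint! g))
            (cast≐ (Id-atPoint f g) (elim-β E𝟏 C! (proj₁ (fibrewise β refl)))))
          (≐ˢ-sym (proj₂ (fibrewise β refl))))

    faithful : {f g f′ g′ : Term 𝟏 B} {α : Identification f g} {β : Identification f′ g′} →
               f ≈ᵗ f′ → g ≈ᵗ g′ → cell (P.F₁ α) ℭ.≋ cell (P.F₁ β) → α ≋ᵗ β
    faithful {f} {g} {f′} {g′} {α} {β} ff′ gg′ p = ff′ , gg′ ,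
      uniq-term E𝟏 (⊢idn α)
        -- `uniq-term` compares inhabitants of a single identity type, so `β` is first retyped along
        -- the equalities of endpoints.
        (conv (⊢idn β) (≐type-sym (Id-cong (≐type-refl Bwk!) ff′ gg′)))
        (cast≐ (sym (Id-atPoint f g))
          (emb-cong⁻ (⊢ty B) wkη! (cast≐ˢ (span-atPoint α) (span-atPoint β) p) .proj₂ .proj₂))

  point-splitRestriction :
    SplitRestriction {K = Fibre.𝔗 S M Γ} {Fibre.ℭ/Γ S M Γ}
      (Fibre.𝔼 S M Γ) {Fibre.idOver S M Γ} {Fibre.𝟏 S M Γ} point
  point-splitRestriction B = record
    { section      = section B
    ; section-cong = λ {s} {t} → section-cong B {s} {t}
    ; P-section    = P-section B
    ; lift         = lift B
    ; P-lift       = P-lift B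
    ; faithful     = λ {_} {_} {_} {_} {α} {β} → faithful B {α = α} {β}
    }

proposition4p3p1 : ∀ {ℓ : Level} (S : TypeTheory ℓ) (M : ML₂ S) (Γ : Contexts.Context S M) →
    RetractBireflection (Fibre.𝔼 S M Γ) (Fibre.idOver S M Γ) (Fibre.𝟏 S M Γ)
proposition4p3p1 S M Γ = splitFullyFaithful⇒retractBireflection
  {K = Fibre.𝔗 S M Γ} {Fibre.ℭ/Γ S M Γ} (Fibre.𝔼 S M Γ) {Fibre.idOver S M Γ} {Fibre.𝟏 S M Γ}
  (point S M Γ) (point-splitRestriction S M Γ)
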